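{- There is an algorithm which, given a finite rooted tree $T$ with $n=|V_T|$ nodes, nonnegative edge weights $w_e$, and for every node $v$ a probability $\pi_v\in(0,1]$ and a prize $p_v\in\mathbb{R}$, computes in $O(n^2)$ time a set $S^*\subseteq V_T$ with $$G(S^*,0)=\max_{S\subseteq V_T} G(S,0),$$ i.e. an optimal solution of the Probabilistic Profitable Tour Problem on the tree, together with its optimal value.
   Context: Setting. $T$ is a finite tree rooted at $r_T$ (the depot), with node set $V_T$, $n=|V_T|$; every edge $e$ has weight $w_e\ge 0$ (cost of traversing it in both directions). Every node $v$ has a probability $\pi_v\in(0,1]$ and a prize $p_v\in\mathbb{R}$. $d(v)$ is the total weight of the path from $r_T$ to $v$. A random set $\omega\subseteq V_T$ contains each node $v$ independently with probability $\pi_v$. For $S\subseteq V_T$, $P(S)=1-\prod_{s\in S}(1-\pi_s)$ (so $P(\emptyset)=0$). For $Q\subseteq V_T$, $W(Q)$ is the total weight of the edges lying on at least one path from $r_T$ to a node of $Q$ ($W(\emptyset)=0$). The expected profit of $S\subseteq V_T$ with bonus $x\le d(r_T)=0$ is $G(S,x)=\sum_{s\in S}p_s\pi_s-\mathbb{E}[W(S\cap\omega)]+x\,P(S)$; in particular $G(S,0)=\sum_{s\in S}p_s\pi_s-\mathbb{E}[W(S\cap\omega)]$ is the expected revenue minus the expected cost of the cheapest closed tour from $r_T$ visiting $S\cap\omega$. Time is measured in the standard RAM model with unit-cost arithmetic. -}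

module Defs where

open import Algebra.Bundles using (CommutativeRing)
import Algebra.Definitions as AlgebraDefinitions
import Algebra.Definitions.RawMonoid as RawMonoidDefinitions
open import Data.Bool.Base using (if_then_else_)
open import Data.Empty using (⊥-elim)
open import Data.Fin.Base using (Fin; toℕ)
import Data.Fin.Properties as Fin
open import Data.Fin.Subset using (Subset; inside; outside; _∩_; _∈_)
open import Data.Fin.Subset.Properties using (_∈?_)
open import Data.List.Base using (List; []; _∷_; _++_; map; foldr; head; drop; tabulate)
open import Data.Maybe.Base using (Maybe; just; nothing; fromMaybe; _>>=_)
open import Data.Nat.Base as ℕ using (ℕ; zero; suc; _<_)
open import Data.Nat.GeneralisedArithmetic using (iterate)
import Data.Nat.Properties as ℕₚ
open import Data.Product.Base using (∃-syntax; _×_; _,_; proj₁; proj₂)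
open import Data.Vec.Base using ([]; _∷_; lookup)
open import Function.Base using (_∘_)
open import Level using (Level; _⊔_) renaming (suc to lsuc)
open import Relation.Binary.Core using (Rel)
open import Relation.Binary.Structures using (IsDecTotalOrder)
import Relation.Binary.Construct.NonStrictToStrict as NonStrictToStrict
open import Relation.Binary.PropositionalEquality using (_≡_; _≢_; refl; sym; trans; cong)
open import Relation.Nullary using (¬_; Dec; yes; no; does)
open import Relation.Nullary.Decidable using (map′; ¬?; _×-dec_)

------------------------------------------------------------------------
-- Scalars

-- The library has no real numbers; the scalars are an arbitrary ordered
-- field.  The order is decidable because a real RAM branches on
-- comparisons of scalars at unit cost.

record OrderedField (c ℓ₁ ℓ₂ : Level) : Set (lsuc (c ⊔ ℓ₁ ⊔ ℓ₂)) where
  infix 4 _≤_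
  field
    commutativeRing : CommutativeRing c ℓ₁
  open CommutativeRing commutativeRing public
  open AlgebraDefinitions _≈_ using (Invertible)
  field
    _≤_             : Rel Carrier ℓ₂
    isDecTotalOrder : IsDecTotalOrder _≈_ _≤_
    +-monoˡ-≤       : ∀ z {x y} → x ≤ y → x + z ≤ y + z
    *-nonNegative   : ∀ {x y} → 0# ≤ x → 0# ≤ y → 0# ≤ x * y
    0≉1             : ¬ 0# ≈ 1#
    invertible      : ∀ {x} → ¬ x ≈ 0# → Invertible 1# _*_ x

  open IsDecTotalOrder isDecTotalOrder public using (_≟_; _≤?_)

  infix 4 _<ᶠ_
  _<ᶠ_ : Rel Carrier (ℓ₁ ⊔ ℓ₂)
  _<ᶠ_ = NonStrictToStrict._<_ _≈_ _≤_

  sum product : ∀ {n} → (Fin n → Carrier) → Carrier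
  sum     = RawMonoidDefinitions.sum +-rawMonoid
  product = RawMonoidDefinitions.sum *-rawMonoid

------------------------------------------------------------------------
-- Rooted trees

-- The parent function is given the dummy value  root  at the root.  An
-- edge is identified with its lower endpoint, so the edges are the nodes
-- other than the root.

record RootedTree (n : ℕ) : Set where
  field
    root        : Fin n
    parent      : Fin n → Fin n
    parent-root : parent root ≡ root
    reachesRoot : ∀ v → ∃[ k ] iterate parent v k ≡ root

  -- The edge e, joining node e to its parent, lies on the path from the
  -- root to v.
  OnPathTo : Fin n → Fin n → Set
  OnPathTo v e = e ≢ root × (∃[ k ] iterate parent v k ≡ e)

  OnPathToSome : Subset n → Fin n → Set
  OnPathToSome Q e = ∃[ v ] (v ∈ Q × OnPathTo v e)

  private
    iterate-root : ∀ k → iterate parent root k ≡ root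
    iterate-root zero    = refl
    iterate-root (suc k) = trans (cong (λ v → iterate parent v k) parent-root) (iterate-root k)

    staysAtRoot : ∀ v j k → iterate parent v j ≡ root → j ℕ.≤ k → iterate parent v k ≡ root
    staysAtRoot v zero    k       eq ℕ.z≤n     = trans (cong (λ u → iterate parent u k) eq) (iterate-root k)
    staysAtRoot v (suc j) (suc k) eq (ℕ.s≤s p) = staysAtRoot (parent v) j k eq p

    bounded : ∀ v {e} → e ≢ root → ∀ k → iterate parent v k ≡ e → k < proj₁ (reachesRoot v)
    bounded v e≢r k eq with k ℕₚ.<? proj₁ (reachesRoot v)
    ... | yes k<j = k<j
    ... | no  k≮j = ⊥-elim (e≢r (trans (sym eq)
                      (staysAtRoot v _ k (proj₂ (reachesRoot v)) (ℕₚ.≮⇒≥ k≮j))))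

  onPathTo? : ∀ v e → Dec (OnPathTo v e)
  onPathTo? v e = map′
    (λ { (e≢r , k , _ , eq) → e≢r , k , eq })
    (λ { (e≢r , k , eq) → e≢r , k , bounded v e≢r k eq , eq })
    (¬? (e Fin.≟ root) ×-dec ℕₚ.anyUpTo? (λ k → iterate parent v k Fin.≟ e) (proj₁ (reachesRoot v)))

  onPathToSome? : ∀ Q e → Dec (OnPathToSome Q e)
  onPathToSome? Q e = Fin.any? (λ v → (v ∈? Q) ×-dec onPathTo? v e)

------------------------------------------------------------------------
-- The Probabilistic Profitable Tour Problem on a tree

subsets : ∀ n → List (Subset n)
subsets zero    = [] ∷ []
subsets (suc n) = map (inside ∷_) (subsets n) ++ map (outside ∷_) (subsets n)

module _ {c ℓ₁ ℓ₂} (K : OrderedField c ℓ₁ ℓ₂) where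
  open OrderedField K using
    (Carrier; _≤_; _<ᶠ_; _+_; _*_; _-_; 0#; 1#; sum; product)

  record Instance (n : ℕ) : Set (c ⊔ ℓ₁ ⊔ ℓ₂) where
    field
      tree : RootedTree n
    open RootedTree tree public
    field
      weight      : Fin n → Carrier     -- of the edge to the parent; meaningless at the root
      probability : Fin n → Carrier
      prize       : Fin n → Carrier
      weight≥0      : ∀ v → v ≢ root → 0# ≤ weight v
      probability>0 : ∀ v → 0# <ᶠ probability v
      probability≤1 : ∀ v → probability v ≤ 1#

    Pr : Subset n → Carrier
    Pr ω = product (λ v → if lookup ω v then probability v else (1# - probability v))

    𝔼 : (Subset n → Carrier) → Carrier
    𝔼 X = foldr _+_ 0# (map (λ ω → Pr ω * X ω) (subsets n))

    P : Subset n → Carrier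
    P S = 1# - product (λ s → if lookup S s then (1# - probability s) else 1#)

    W : Subset n → Carrier
    W Q = sum (λ e → if does (onPathToSome? Q e) then weight e else 0#)

    G : Subset n → Carrier → Carrier
    G S x = (sum (λ s → if lookup S s then prize s * probability s else 0#)
              - 𝔼 (λ ω → W (S ∩ ω)))
              + x * P S

    Optimal : Subset n → Set ℓ₂
    Optimal S = ∀ S′ → G S′ 0# ≤ G S 0#

------------------------------------------------------------------------
-- The real RAM

-- Registers and addressable memory each come in two sorts: natural
-- numbers (used for indices and addresses) and scalars.  There is no
-- conversion between the sorts, and natural numbers only have addition
-- and truncated subtraction: unit-cost multiplication of unbounded
-- integers is known to make a RAM unreasonably powerful.

Register : Set
Register = ℕ

Label : Set
Label = ℕ

data Instr : Set where
  setᴺ            : Register → ℕ → Instr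
  moveᴺ           : Register → Register → Instr
  addᴺ subᴺ       : Register → Register → Register → Instr
  loadᴺ storeᴺ    : Register → Register → Instr
  zeroᶠ oneᶠ      : Register → Instr
  moveᶠ           : Register → Register → Instr
  addᶠ subᶠ mulᶠ divᶠ : Register → Register → Register → Instr
  loadᶠ storeᶠ    : Register → Register → Instr
  jump            : Label → Instr
  jump<ᴺ jump≤ᶠ   : Register → Register → Label → Instr
  halt            : Instr

Program : Set
Program = List Instr

nth : ∀ {a} {A : Set a} → List A → ℕ → Maybe A
nth xs i = head (drop i xs)

_[_≔_] : ∀ {a} {A : Set a} → (ℕ → A) → ℕ → A → (ℕ → A)
(f [ i ≔ x ]) j = if does (j ℕₚ.≟ i) then x else f j

module _ {c ℓ₁ ℓ₂} (K : OrderedField c ℓ₁ ℓ₂) where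
  open OrderedField K using
    (Carrier; _≈_; _+_; _*_; _-_; 0#; 1#; _≟_; _≤?_; invertible)

  record State : Set c where
    constructor state
    field
      pc   : Label
      regᴺ : ℕ → ℕ
      regᶠ : ℕ → Carrier
      memᴺ : ℕ → ℕ
      memᶠ : ℕ → Carrier

  divide : Carrier → Carrier → Maybe Carrier
  divide x y with y ≟ 0#
  ... | yes _   = nothing
  ... | no  y≉0 = just (x * proj₁ (invertible y≉0))

  step : Instr → State → Maybe State
  step (setᴺ i k)   (state pc r f m g) = just (state (suc pc) (r [ i ≔ k ]) f m g)
  step (moveᴺ i j)  (state pc r f m g) = just (state (suc pc) (r [ i ≔ r j ]) f m g)
  step (addᴺ i j k) (state pc r f m g) = just (state (suc pc) (r [ i ≔ r j ℕ.+ r k ]) f m g)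
  step (subᴺ i j k) (state pc r f m g) = just (state (suc pc) (r [ i ≔ r j ℕ.∸ r k ]) f m g)
  step (loadᴺ i j)  (state pc r f m g) = just (state (suc pc) (r [ i ≔ m (r j) ]) f m g)
  step (storeᴺ i j) (state pc r f m g) = just (state (suc pc) r f (m [ r i ≔ r j ]) g)
  step (zeroᶠ i)    (state pc r f m g) = just (state (suc pc) r (f [ i ≔ 0# ]) m g)
  step (oneᶠ i)     (state pc r f m g) = just (state (suc pc) r (f [ i ≔ 1# ]) m g)
  step (moveᶠ i j)  (state pc r f m g) = just (state (suc pc) r (f [ i ≔ f j ]) m g)
  step (addᶠ i j k) (state pc r f m g) = just (state (suc pc) r (f [ i ≔ f j + f k ]) m g)
  step (subᶠ i j k) (state pc r f m g) = just (state (suc pc) r (f [ i ≔ f j - f k ]) m g)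
  step (mulᶠ i j k) (state pc r f m g) = just (state (suc pc) r (f [ i ≔ f j * f k ]) m g)
  step (divᶠ i j k) (state pc r f m g) =
    divide (f j) (f k) >>= λ x → just (state (suc pc) r (f [ i ≔ x ]) m g)
  step (loadᶠ i j)  (state pc r f m g) = just (state (suc pc) r (f [ i ≔ g (r j) ]) m g)
  step (storeᶠ i j) (state pc r f m g) = just (state (suc pc) r f m (g [ r i ≔ f j ]))
  step (jump l)     (state pc r f m g) = just (state l r f m g)
  step (jump<ᴺ i j l) (state pc r f m g) =
    just (state (if does (r i ℕₚ.<? r j) then l else suc pc) r f m g)
  step (jump≤ᶠ i j l) (state pc r f m g) =
    just (state (if does (f i ≤? f j) then l else suc pc) r f m g)
  step halt         _                  = nothing

  -- Run prog s t s′: started in s, the program reaches a halt instruction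
  -- in state s′, having executed t instructions (counting the halt).  A
  -- program that runs off its end or divides by zero has no run.
  data Run (prog : Program) : State → ℕ → State → Set c where
    halted : ∀ {s} → nth prog (State.pc s) ≡ just halt → Run prog s 1 s
    next   : ∀ {s instr s′ t s″} → nth prog (State.pc s) ≡ just instr → step instr s ≡ just s′ →
             Run prog s′ t s″ → Run prog s (suc t) s″

  -- Natural registers 0 and 1 hold n and the root; natural memory holds
  -- the parent array, scalar memory the arrays of weights, probabilities
  -- and prizes one after another.  Everything else is zero.
  initial : ∀ {n} → Instance K n → State
  initial {n} I = record
    { pc   = 0
    ; regᴺ = λ i → fromMaybe 0 (nth (n ∷ toℕ root ∷ []) i)
    ; regᶠ = λ _ → 0#
    ; memᴺ = λ a → fromMaybe 0 (nth (tabulate (toℕ ∘ parent)) a)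
    ; memᶠ = λ a → fromMaybe 0# (nth (tabulate weight ++ tabulate probability ++ tabulate prize) a)
    }
    where open Instance I

  -- A set is output as its characteristic vector at the start of natural
  -- memory, a scalar in scalar register 0.
  OutputsSet : ∀ {n} → State → Subset n → Set
  OutputsSet s S = ∀ v → State.memᴺ s (toℕ v) ≡ (if lookup S v then 1 else 0)

  OutputsValue : State → Carrier → Set ℓ₁
  OutputsValue s x = State.regᶠ s 0 ≈ x

{-# OPTIONS --safe #-}

module Submission where

-- A node set S is judged, for a reward y ≥ 0 for needing no visit, by  profit S + y · miss S,
-- where miss S = ∏ (1 − π) is the probability of that event; so y = −x for the bonus x, up to
-- a constant, and the edge above a subtree merely shifts y by its weight.  For every subtree
-- a list of sets is kept that contains a maximiser for each y.  The objective is supermodular,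
-- so along such a list the sets grow: the list of a tree with m nodes has at most m + 1
-- entries.  Two subtrees are combined by running through the shorter list and merging, for
-- each of its entries, the sorted row of pairs with the longer list into the upper hull found
-- so far, by Graham's scan.  Combining trees with a and b nodes takes O(a b) steps, which the
-- growth of the sum of the squared tree sizes pays for; that sum never exceeds n².  By
-- linearity and independence the expected tour cost of S is  ∑ w_e (1 − ∏ (1 − π_s)),  over
-- the edges e and the s in S below e.

-- Sibling subtrees interact only through the product of their miss probabilities: once the choice
-- in one of them is fixed, the other faces its own problem with y multiplied by the miss
-- probability of the fixed choice. So one optimum per subtree does not suffice, and maximisers for
-- all y ≥ 0 have to be at hand. As miss probabilities multiply while profits add, the pairs formed
-- from two lists come in no order known in advance. Sorting all of them would cost a logarithmic
-- factor, whereas a single row is sorted from the start. The price is that the bound on the number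
-- of entries must hold for the hull after every row and not only for the last one; the exchange
-- argument is therefore carried out on a grid of which only some rows have been seen. Such a hull
-- has at most a + b + 1 entries, so that a row costs O(a + b), and the at most min(a, b) + 1 rows
-- cost O(a b) together.

open import Defs

-- Ordered fields and a solver for ring identities.

module Field where
  open import Algebra.Bundles using (RawRing)
  open import Algebra.Solver.Ring.AlmostCommutativeRing using (fromCommutativeRing; _-Raw-AlmostCommutative⟶_)
  import Algebra.Properties.AbelianGroup as AbelianGroupProperties
  import Algebra.Properties.CommutativeSemigroup as CommutativeSemigroupProperties
  import Algebra.Properties.Ring as RingProperties
  import Algebra.Properties.Semiring.Mult as Mult
  import Algebra.Solver.Ring as RingSolver
  open import Data.Empty using (⊥; ⊥-elim)
  open import Data.Maybe.Base using (Maybe; just; nothing)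
  open import Data.Nat.Base as ℕ using (ℕ; zero; suc)
  import Data.Nat.Properties as ℕₚ
  open import Data.Product.Base using (∃-syntax; _×_; _,_)
  open import Data.Sum.Base using (inj₁; inj₂)
  import Relation.Binary.Reasoning.Setoid as SetoidReasoning
  open import Relation.Binary.PropositionalEquality as ≡ using (_≡_)
  open import Relation.Binary.Structures using (IsDecTotalOrder)
  open import Relation.Nullary using (¬_; yes; no)

  module FieldProperties {c ℓ₁ ℓ₂} (K : OrderedField c ℓ₁ ℓ₂) where
    open OrderedField K hiding (sum; product)
    open IsDecTotalOrder isDecTotalOrder using (total; antisym; ≤-respʳ-≈; ≤-respˡ-≈)
      renaming (trans to ≤-trans; reflexive to ≤-reflexive; refl to ≤-refl) public

    private
      open Mult semiring using (×-homo-+; ×1-homo-*) renaming (_×_ to _·_)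
      open RingProperties ring using (-‿distribˡ-*; -‿distribʳ-*; -0#≈0#)
      open AbelianGroupProperties +-abelianGroup using (⁻¹-∙-comm; ⁻¹-involutive)
      open CommutativeSemigroupProperties +-commutativeSemigroup using (interchange)
      open SetoidReasoning setoid

      -- Evaluation is arranged so that the coefficients 0 and 1 denote 0# and 1# definitionally.
      ι : ℕ → Carrier
      ι 0             = 0#
      ι 1             = 1#
      ι (suc (suc n)) = 1# + ι (suc n)

      ⟦_⟧ : ℕ × ℕ → Carrier
      ⟦ m , zero ⟧  = ι m
      ⟦ m , suc n ⟧ = ι m - ι (suc n)

      ι≈ : ∀ n → ι n ≈ n · 1#
      ι≈ 0             = refl
      ι≈ 1             = sym (+-identityʳ 1#)
      ι≈ (suc (suc n)) = +-congˡ (ι≈ (suc n))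

      ⟦⟧≈ : ∀ m n → ⟦ m , n ⟧ ≈ (m · 1#) - (n · 1#)
      ⟦⟧≈ m zero    = trans (ι≈ m) (sym (trans (+-congˡ -0#≈0#) (+-identityʳ _)))
      ⟦⟧≈ m (suc n) = +-cong (ι≈ m) (-‿cong (ι≈ (suc n)))

      -- Integers as formal differences; the solver never needs them reduced.
      differences : RawRing _ _
      differences = record
        { Carrier = ℕ × ℕ
        ; _≈_ = λ { (a , b) (a′ , b′) → a ℕ.+ b′ ≡ a′ ℕ.+ b }
        ; _+_ = λ { (a , b) (a′ , b′) → a ℕ.+ a′ , b ℕ.+ b′ }
        ; _*_ = λ { (a , b) (a′ , b′) → a ℕ.* a′ ℕ.+ b ℕ.* b′ , a ℕ.* b′ ℕ.+ b ℕ.* a′ }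
        ; -_ = λ { (a , b) → b , a }
        ; 0# = 0 , 0
        ; 1# = 1 , 0
        }

      difference-+ : ∀ x y z w → (x + z) - (y + w) ≈ (x - y) + (z - w)
      difference-+ x y z w = begin
        (x + z) + - (y + w)     ≈⟨ +-congˡ (⁻¹-∙-comm y w) ⟨
        (x + z) + (- y + - w)   ≈⟨ interchange x z (- y) (- w) ⟩
        (x - y) + (z - w)       ∎

      difference-neg : ∀ x y → y - x ≈ - (x - y)
      difference-neg x y = begin
        y + - x       ≈⟨ +-comm _ _ ⟩
        - x + y       ≈⟨ +-congˡ (⁻¹-involutive y) ⟨
        - x + - - y   ≈⟨ ⁻¹-∙-comm x (- y) ⟩
        - (x - y)     ∎

      *-difference : ∀ x z w → x * (z - w) ≈ x * z - x * w
      *-difference x z w = begin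
        x * (z - w)         ≈⟨ distribˡ x z (- w) ⟩
        x * z + x * - w     ≈⟨ +-congˡ (-‿distribʳ-* x w) ⟨
        x * z - x * w       ∎

      difference-* : ∀ x y z w → (x - y) * (z - w) ≈ (x * z + y * w) - (x * w + y * z)
      difference-* x y z w = begin
        (x - y) * (z - w)                        ≈⟨ distribʳ (z - w) x (- y) ⟩
        x * (z - w) + - y * (z - w)              ≈⟨ +-congˡ (-‿distribˡ-* y (z - w)) ⟨
        x * (z - w) + - (y * (z - w))            ≈⟨ +-cong (*-difference x z w) (-‿cong (*-difference y z w)) ⟩
        (x * z - x * w) + - (y * z - y * w)      ≈⟨ +-congˡ (difference-neg (y * z) (y * w)) ⟨
        (x * z - x * w) + (y * w - y * z)        ≈⟨ difference-+ _ _ _ _ ⟨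
        (x * z + y * w) - (x * w + y * z)        ∎

      difference-≈ : ∀ x y z w → x + w ≈ z + y → x - y ≈ z - w
      difference-≈ x y z w e = begin
        x - y                 ≈⟨ +-identityʳ _ ⟨
        (x - y) + 0#          ≈⟨ +-congˡ (-‿inverseʳ w) ⟨
        (x - y) + (w - w)     ≈⟨ difference-+ x y w w ⟨
        (x + w) - (y + w)     ≈⟨ +-cong e (-‿cong (+-comm y w)) ⟩
        (z + y) - (w + y)     ≈⟨ difference-+ z w y y ⟩
        (z - w) + (y - y)     ≈⟨ +-congˡ (-‿inverseʳ y) ⟩
        (z - w) + 0#          ≈⟨ +-identityʳ _ ⟩
        z - w                 ∎

      morphism : differences -Raw-AlmostCommutative⟶ fromCommutativeRing commutativeRing
      morphism = record
        { ⟦_⟧ = ⟦_⟧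
        ; +-homo = λ { (a , b) (a′ , b′) → trans (⟦⟧≈ _ (b ℕ.+ b′)) (trans
            (+-cong (×-homo-+ 1# a a′) (-‿cong (×-homo-+ 1# b b′))) (trans (difference-+ _ _ _ _)
            (sym (+-cong (⟦⟧≈ a b) (⟦⟧≈ a′ b′))))) }
        ; *-homo = λ { (a , b) (a′ , b′) → trans (⟦⟧≈ _ (a ℕ.* b′ ℕ.+ b ℕ.* a′))
            (sym (trans (*-cong (⟦⟧≈ a b) (⟦⟧≈ a′ b′)) (trans (difference-* _ _ _ _)
            (+-cong (sum-homo a a′ b b′) (-‿cong (sum-homo a b′ b a′)))))) }
        ; -‿homo = λ { (a , b) → trans (⟦⟧≈ b a) (trans (difference-neg _ _) (-‿cong (sym (⟦⟧≈ a b)))) }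
        ; 0-homo = refl
        ; 1-homo = refl
        }
        where
        sum-homo : ∀ a a′ b b′ → (a · 1#) * (a′ · 1#) + (b · 1#) * (b′ · 1#) ≈ (a ℕ.* a′ ℕ.+ b ℕ.* b′) · 1#
        sum-homo a a′ b b′ = sym (trans (×-homo-+ 1# (a ℕ.* a′) (b ℕ.* b′))
                               (+-cong (×1-homo-* a a′) (×1-homo-* b b′)))

      _≟ᶜ_ : ∀ x y → Maybe (⟦ x ⟧ ≈ ⟦ y ⟧)
      (a , b) ≟ᶜ (a′ , b′) with a ℕ.+ b′ ℕₚ.≟ a′ ℕ.+ b
      ... | no  _ = nothing
      ... | yes e = just (trans (⟦⟧≈ a b) (trans (difference-≈ _ _ _ _ (trans (sym (×-homo-+ 1# a b′))
                      (trans (reflexive (≡.cong (_· 1#) e)) (×-homo-+ 1# a′ b)))) (sym (⟦⟧≈ a′ b′))))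

    open RingSolver differences (fromCommutativeRing commutativeRing) morphism _≟ᶜ_ public
      using (solve; _:=_; _:+_; _:*_; _:-_; :-_; con)

    :0 :1 : ∀ {n} → RingSolver.Polynomial differences (fromCommutativeRing commutativeRing) morphism _≟ᶜ_ n
    :0 = con (0 , 0)
    :1 = con (1 , 0)

    infix 4 _<_
    -- The negation is what a failed comparison yields directly; by totality it is the strict order.
    _<_ : Carrier → Carrier → Set ℓ₂
    x < y = ¬ y ≤ x

    -- Opaque so that with-abstraction never normalises solver proofs.
    abstract
      <⇒≤ : ∀ {x y} → x < y → x ≤ y
      <⇒≤ {x} {y} x<y with total x y
      ... | inj₁ x≤y = x≤y
      ... | inj₂ y≤x = ⊥-elim (x<y y≤x)

      <-≤-trans : ∀ {x y z} → x < y → y ≤ z → x < z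
      <-≤-trans x<y y≤z z≤x = x<y (≤-trans y≤z z≤x)

      ≤-<-trans : ∀ {x y z} → x ≤ y → y < z → x < z
      ≤-<-trans x≤y y<z z≤x = y<z (≤-trans z≤x x≤y)

      <-trans : ∀ {x y z} → x < y → y < z → x < z
      <-trans x<y y<z = <-≤-trans x<y (<⇒≤ y<z)

      ≤∧≉⇒< : ∀ {x y} → x ≤ y → ¬ x ≈ y → x < y
      ≤∧≉⇒< x≤y x≉y y≤x = x≉y (antisym x≤y y≤x)

      0≤y-x⇒x≤y : ∀ {x y} → 0# ≤ y - x → x ≤ y
      0≤y-x⇒x≤y {x} {y} p = ≤-respˡ-≈ (+-identityˡ x) (≤-respʳ-≈
        (solve 2 (λ x y → (y :- x) :+ x := y) refl x y) (+-monoˡ-≤ x p))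

      x≤y⇒0≤y-x : ∀ {x y} → x ≤ y → 0# ≤ y - x
      x≤y⇒0≤y-x {x} {y} p = ≤-respˡ-≈ (-‿inverseʳ x) (+-monoˡ-≤ (- x) p)

      x<y⇒0<y-x : ∀ {x y} → x < y → 0# < y - x
      x<y⇒0<y-x {x} {y} x<y p = x<y (0≤y-x⇒x≤y (≤-respʳ-≈ (solve 2 (λ x y → :0 :- (y :- x) := x :- y) refl x y) (x≤y⇒0≤y-x {y - x} {0#} p)))

      -- Inequalities are proved from certificates  y - x ≈ e  with  0 ≤ e.
      ≤-by : ∀ {x y e} → 0# ≤ e → y - x ≈ e → x ≤ y
      ≤-by p eq = 0≤y-x⇒x≤y (≤-respʳ-≈ (sym eq) p)

      <-by : ∀ {x y e} → 0# < e → y - x ≈ e → x < y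
      <-by p eq y≤x = p (≤-respˡ-≈ eq (≤-respʳ-≈ (-‿inverseʳ _) (+-monoˡ-≤ _ y≤x)))

      +-nonNegative : ∀ {x y} → 0# ≤ x → 0# ≤ y → 0# ≤ x + y
      +-nonNegative {x} {y} p q = ≤-trans q (≤-respˡ-≈ (+-identityˡ y) (+-monoˡ-≤ y p))

      +-mono-≤ : ∀ {x y z w} → x ≤ y → z ≤ w → x + z ≤ y + w
      +-mono-≤ {x} {y} {z} {w} p q = ≤-by (+-nonNegative (x≤y⇒0≤y-x p) (x≤y⇒0≤y-x q))
        (solve 4 (λ x y z w → (y :+ w) :- (x :+ z) := (y :- x) :+ (w :- z)) refl x y z w)

      +-nonNegative-positive : ∀ {x y} → 0# ≤ x → 0# < y → 0# < x + y
      +-nonNegative-positive {x} {y} p q r =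
        q (≤-trans (≤-by p (solve 2 (λ x y → (x :+ y) :- y := x) refl x y)) r)

      -- The product is nonnegative, so if it were also at most 0 it would be 0, and multiplying by
      -- the inverse of `x` would make `y` zero.
      *-positive : ∀ {x y} → 0# < x → 0# < y → 0# < x * y
      *-positive {x} {y} 0<x 0<y xy≤0 = cancel (invertible (λ e → 0<x (≤-reflexive e)))
        where
        cancel : ∃[ z ] ((z * x ≈ 1#) × (x * z ≈ 1#)) → ⊥
        cancel (z , zx≈1 , _) = 0<y (≤-reflexive (trans (sym (*-identityˡ y)) (trans (*-congʳ (sym zx≈1))
          (trans (*-assoc z x y) (trans (*-congˡ (antisym xy≤0 (*-nonNegative (<⇒≤ 0<x) (<⇒≤ 0<y)))) (zeroʳ z))))))

      0≤x*x : ∀ x → 0# ≤ x * x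
      0≤x*x x with total 0# x
      ... | inj₁ p = *-nonNegative p p
      ... | inj₂ p = ≤-respʳ-≈ (solve 1 (λ x → (:0 :- x) :* (:0 :- x) := x :* x) refl x)
                       (*-nonNegative (x≤y⇒0≤y-x p) (x≤y⇒0≤y-x p))

      0≤1 : 0# ≤ 1#
      0≤1 = ≤-respʳ-≈ (*-identityˡ 1#) (0≤x*x 1#)

      0<1 : 0# < 1#
      0<1 = ≤∧≉⇒< 0≤1 0≉1

      *-monoˡ-≤ : ∀ {x y z} → 0# ≤ z → x ≤ y → z * x ≤ z * y
      *-monoˡ-≤ {x} {y} {z} p q = ≤-by (*-nonNegative p (x≤y⇒0≤y-x q))
        (solve 3 (λ x y z → z :* y :- z :* x := z :* (y :- x)) refl x y z)

      -- Supplies the slope at which two neighbours on a hull tie. A quotient at most 0 would make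
      -- its product with `x`, which is `y`, at most 0.
      quotient : ∀ {x y} → 0# < x → 0# < y → ∃[ z ] (0# < z × z * x ≈ y)
      quotient {x} {y} 0<x 0<y = divided (invertible (λ e → 0<x (≤-reflexive e)))
        where
        divided : ∃[ z ] ((z * x ≈ 1#) × (x * z ≈ 1#)) → ∃[ z ] (0# < z × z * x ≈ y)
        divided (x⁻¹ , e , _) = y * x⁻¹ , (λ z≤0 → 0<y (≤-respˡ-≈ zx≈y (product≤0 z≤0))) , zx≈y
          where
          zx≈y : (y * x⁻¹) * x ≈ y
          zx≈y = trans (*-assoc y _ x) (trans (*-congˡ e) (*-identityʳ y))
          product≤0 : ∀ {z} → z ≤ 0# → z * x ≤ 0#
          product≤0 {z} z≤0 = ≤-by (*-nonNegative (x≤y⇒0≤y-x z≤0) (<⇒≤ 0<x))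
            (solve 2 (λ z x → :0 :- z :* x := (:0 :- z) :* x) refl z x)

-- Upper hulls of the points (miss, profit) and Graham's scan.

module Hull where
  open Field
  open import Data.Bool.Base using (if_then_else_)
  open import Data.Empty using (⊥; ⊥-elim)
  open import Data.List.Base using (List; []; _∷_; reverse; _ʳ++_)
  open import Data.List.Membership.Propositional using () renaming (_∈_ to _∈ᴸ_)
  open import Data.List.Relation.Unary.All as All using (All; []; _∷_)
  open import Data.List.Relation.Unary.AllPairs using ([]; _∷_)
  open import Data.List.Relation.Unary.Any as Any using (Any; here; there)
  open import Data.List.Relation.Unary.Linked using (Linked; []; [-]; _∷_)
  open import Data.Nat.Base using (ℕ; suc)
  open import Data.Product.Base using (_×_; _,_)
  open import Data.Sum.Base using (_⊎_; inj₁; inj₂)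
  open import Data.Unit.Base using (⊤)
  open import Function.Base using (_∘_; flip; case_of_)
  import Level
  open import Relation.Binary.PropositionalEquality as ≡ using (_≡_)
  open import Relation.Nullary using (¬_; Dec; does; yes; no)

  linked-ʳ++ : ∀ {a r} {A : Set a} {R : A → A → Set r} {x} xs {acc} →
               Linked R (x ∷ xs) → Linked (flip R) (x ∷ acc) → Linked (flip R) (xs ʳ++ (x ∷ acc))
  linked-ʳ++ []       [-]     l = l
  linked-ʳ++ (y ∷ xs) (r ∷ k) l = linked-ʳ++ xs k (r ∷ l)

  linked-reverse : ∀ {a r} {A : Set a} {R : A → A → Set r} {xs} → Linked R xs → Linked (flip R) (reverse xs)
  linked-reverse {xs = []}     l = []
  linked-reverse {xs = x ∷ xs} l = linked-ʳ++ xs l [-]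

  module Hulls {c ℓ₁ ℓ₂} (K : OrderedField c ℓ₁ ℓ₂) where
    open OrderedField K hiding (sum; product)
    open FieldProperties K

    -- A choice of served nodes with its expected profit and the probability
    -- that none of them requires service.
    record Point (X : Set) : Set c where
      constructor point
      field
        profit miss : Carrier
        left right  : ℕ
        choice      : X
    open Point public

    value : ∀ {X} → Carrier → Point X → Carrier
    value y p = profit p + y * miss p

    -- An edge of weight `w` has to be paid with probability `1 - q`. The effect is that
    -- `value y (shift w p)` equals `value (y + w) p - w`, so the order of the points at `y` is
    -- their old order at `y + w`.
    shift : ∀ {X} → Carrier → Point X → Point X
    shift w (point c q l r x) = point ((c + w * q) - w) q l r x

    module _ {X : Set} where

      private
        Pt = Point X

      -- Compares the slopes of the segments from `s` to `t` and from `t` to `p`, multiplied out so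
      -- that no division occurs. It is meant for `miss p ≤ miss t < miss s`; collinear points count
      -- as below.
      BelowSegment : Pt → Pt → Pt → Set ℓ₂
      BelowSegment s t p = (profit t - profit s) * (miss t - miss p) ≤ (profit p - profit t) * (miss s - miss t)

      belowSegment? : ∀ s t p → Dec (BelowSegment s t p)
      belowSegment? s t p = _ ≤? _

      -- The last point on the stack is never popped: it is the anchor of the hull, of largest miss
      -- probability.
      pop : Pt → List Pt → List Pt
      pop p (t ∷ s ∷ zs) = if does (belowSegment? s t p) then pop p (s ∷ zs) else t ∷ s ∷ zs
      pop p zs           = zs

      pops : Pt → List Pt → ℕ
      pops p (t ∷ s ∷ zs) = if does (belowSegment? s t p) then suc (pops p (s ∷ zs)) else 0
      pops p zs           = 0

      -- Points arrive in order of decreasing miss probability. One that brings no more profit than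
      -- the top is therefore no better than the top at any `y ≥ 0`.
      insert : Pt → List Pt → List Pt
      insert p []       = p ∷ []
      insert p (t ∷ zs) = if does (profit p ≤? profit t) then t ∷ zs else p ∷ pop p (t ∷ zs)

      HeadBelow : List Pt → Pt → Set ℓ₂
      HeadBelow []      x = Level.Lift ℓ₂ ⊤
      HeadBelow (d ∷ _) x = miss d ≤ miss x

      -- As a relation it leaves open which list supplies the next point in case of a tie, and it
      -- lets the hull be proved correct apart from the machine.
      data Scan : List Pt → List Pt → List Pt → List Pt → Set (c Level.⊔ ℓ₂) where
        done  : ∀ {zs} → Scan [] [] zs zs
        takeˡ : ∀ {d ds rs zs zs′} → HeadBelow rs d → Scan ds rs (insert d zs) zs′ → Scan (d ∷ ds) rs zs zs′
        takeʳ : ∀ {r ds rs zs zs′} → HeadBelow ds r → Scan ds rs (insert r zs) zs′ → Scan ds (r ∷ rs) zs zs′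

      Rises : Pt → Pt → Set ℓ₂
      Rises t s = miss t < miss s × profit s < profit t

      Turn : Pt → Pt → List Pt → Set ℓ₂
      Turn p t []      = Level.Lift ℓ₂ ⊤
      Turn p t (s ∷ _) = ¬ BelowSegment s t p

      Convex : Pt → List Pt → Set (c Level.⊔ ℓ₂)
      Convex b []           = Level.Lift _ ⊥
      Convex b (x ∷ [])     = Level.Lift ℓ₂ (x ≡ b)
      Convex b (t ∷ s ∷ zs) = Rises t s × Turn t s zs × Convex b (s ∷ zs)

      -- Ensures that `p` never has to replace the anchor `b`. The second alternative is for the
      -- corner pair, which is pushed in advance and turns up again in its own row, where it is
      -- rejected.
      Fresh : Pt → Pt → Set ℓ₂
      Fresh b p = miss p < miss b ⊎ profit p ≤ profit b

      abstract
        -- Suppose that `t` beats both `s` and `p` at `y`. Weighting its two leads by the miss gaps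
        -- of the opposite segments and adding them cancels `y` and contradicts `BelowSegment`.
        between : ∀ {s t p y} → BelowSegment s t p → miss t < miss s → miss p ≤ miss t →
                  value y t ≤ value y s ⊎ value y t ≤ value y p
        between {s} {t} {p} {y} below t<s p≤t with value y t ≤? value y s | value y t ≤? value y p
        ... | yes v | _     = inj₁ v
        ... | no  _ | yes v = inj₂ v
        ... | no vs<vt | no vp<vt = ⊥-elim (<-by
              (+-nonNegative-positive (*-nonNegative (<⇒≤ (x<y⇒0<y-x vs<vt)) (x≤y⇒0≤y-x p≤t))
                 (*-positive (x<y⇒0<y-x vp<vt) (x<y⇒0<y-x t<s)))
              (solve 7 (λ cs ct cp qs qt qp y →
                  (ct :- cs) :* (qt :- qp) :- (cp :- ct) :* (qs :- qt) :=
                  ((ct :+ y :* qt) :- (cs :+ y :* qs)) :* (qt :- qp) :+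
                  ((ct :+ y :* qt) :- (cp :+ y :* qp)) :* (qs :- qt))
                refl (profit s) (profit t) (profit p) (miss s) (miss t) (miss p) y)
              below)

      data Adjacent (t s : Pt) : List Pt → Set c where
        here  : ∀ {zs} → Adjacent t s (t ∷ s ∷ zs)
        there : ∀ {h zs} → Adjacent t s zs → Adjacent t s (h ∷ zs)

      adjacent⇒linked : ∀ {r} {R : Pt → Pt → Set r} zs → (∀ {t s} → Adjacent t s zs → R t s) → Linked R zs
      adjacent⇒linked []           f = []
      adjacent⇒linked (t ∷ [])     f = [-]
      adjacent⇒linked (t ∷ s ∷ zs) f = f here ∷ adjacent⇒linked (s ∷ zs) (f ∘ there)

      module _ {b : Pt} where

        abstract
          pop-convex : ∀ {p t} zs → Convex b (t ∷ zs) → miss p ≤ miss t → profit t < profit p → Fresh b p →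
                       Convex b (p ∷ pop p (t ∷ zs))
          pop-convex [] (Level.lift ≡.refl) p≤t t<p (inj₁ p<b) = (p<b , t<p) , _ , Level.lift ≡.refl
          pop-convex [] (Level.lift ≡.refl) p≤t t<p (inj₂ p≤b) = ⊥-elim (t<p p≤b)
          pop-convex {p} {t} (s ∷ zs) ((qt<qs , cs<ct) , turn , cvx) p≤t t<p fresh with belowSegment? s t p
          ... | yes _      = pop-convex zs cvx (≤-trans p≤t (<⇒≤ qt<qs)) (<-trans cs<ct t<p) fresh
          ... | no  ¬below = (qp<qt , t<p) , ¬below , (qt<qs , cs<ct) , turn , cvx
            where
            -- If `miss t ≤ miss p`, the left side of the popping test is at most 0 and the right
            -- side nonnegative, so `t` would have been popped. Surviving neighbours are thus
            -- strictly apart.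
            qp<qt : miss p < miss t
            qp<qt qt≤qp = ¬below (≤-trans
              (≤-by (*-nonNegative (<⇒≤ (x<y⇒0<y-x cs<ct)) (x≤y⇒0≤y-x qt≤qp))
                (solve 4 (λ cs ct qt qp → :0 :- (ct :- cs) :* (qt :- qp) := (ct :- cs) :* (qp :- qt)) refl
                  (profit s) (profit t) (miss t) (miss p)))
              (*-nonNegative (<⇒≤ (x<y⇒0<y-x t<p)) (<⇒≤ (x<y⇒0<y-x qt<qs))))

          insert-convex : ∀ {p t} zs → Convex b (t ∷ zs) → miss p ≤ miss t → Fresh b p →
                          Convex b (insert p (t ∷ zs))
          insert-convex {p} {t} zs cvx p≤t fresh with profit p ≤? profit t
          ... | yes _   = cvx
          ... | no  t<p = pop-convex zs cvx p≤t t<p fresh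

        module _ {y} (0≤y : 0# ≤ y) where

          Under : List Pt → Pt → Set (c Level.⊔ ℓ₂)
          Under zs x = Any (λ z → value y x ≤ value y z) zs

          abstract
            -- A popped `t` is dominated by `p`, which stays, or by the entry `s` beneath it. That
            -- entry may be popped in its turn, but the recursion has already found what dominates
            -- it.
            pop-covers : ∀ {p t} zs → Convex b (t ∷ zs) → miss p ≤ miss t →
                         All (Under (p ∷ pop p (t ∷ zs))) (t ∷ zs)
            pop-covers []       cvx p≤t = there (here ≤-refl) ∷ []
            pop-covers {p} {t} (s ∷ zs) ((qt<qs , _) , _ , cvx) p≤t with belowSegment? s t p
            ... | no  _     = All.tabulate (λ i → there (Any.map (λ { ≡.refl → ≤-refl }) i))
            ... | yes below with pop-covers {p} zs cvx (≤-trans p≤t (<⇒≤ qt<qs)) | between {s} {t} {p} {y} below qt<qs p≤t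
            ...   | us ∷ u | inj₁ v = Any.map (≤-trans v) us ∷ us ∷ u
            ...   | us ∷ u | inj₂ v = here v ∷ us ∷ u

            insert-covers : ∀ {p t} zs → Convex b (t ∷ zs) → miss p ≤ miss t →
                            All (Under (insert p (t ∷ zs))) (p ∷ t ∷ zs)
            insert-covers {p} {t} zs cvx p≤t with profit p ≤? profit t
            -- Both coordinates of `p` are at most those of `t`, and `y ≥ 0` turns this into
            -- dominance.
            ... | yes p≤ = here (+-mono-≤ p≤ (*-monoˡ-≤ 0≤y p≤t)) ∷
                           All.tabulate (Any.map (λ { ≡.refl → ≤-refl }))
            ... | no  _  = here ≤-refl ∷ pop-covers zs cvx p≤t

          through : ∀ {v zs zs′} → All (Under zs′) zs → Any (λ z → v ≤ value y z) zs → Any (λ z → v ≤ value y z) zs′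
          through (u ∷ _)  (here v≤)   = Any.map (≤-trans v≤) u
          through (_ ∷ us) (there any) = through us any

        private
          TopBelow : List Pt → List Pt → Set ℓ₂
          TopBelow ds []      = Level.Lift ℓ₂ ⊥
          TopBelow ds (t ∷ _) = HeadBelow ds t

          headBelow-trans : ∀ ds {x y} → HeadBelow ds x → miss x ≤ miss y → HeadBelow ds y
          headBelow-trans []       _ _ = _
          headBelow-trans (d ∷ ds) p q = ≤-trans p q

          insert-top : ∀ {p t} zs ds → HeadBelow ds p → miss p ≤ miss t → TopBelow ds (insert p (t ∷ zs))
          insert-top {p} {t} zs ds h p≤t with profit p ≤? profit t
          ... | yes _ = headBelow-trans ds h p≤t
          ... | no  _ = h

        Sorted : List Pt → Set (c Level.⊔ ℓ₂)
        Sorted = Linked (λ p x → miss x ≤ miss p)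

        private
          sorted-head : ∀ {d ds} → Sorted (d ∷ ds) → HeadBelow ds d
          sorted-head [-]     = _
          sorted-head (r ∷ _) = r

          sorted-tail : ∀ {d ds} → Sorted (d ∷ ds) → Sorted ds
          sorted-tail [-]     = []
          sorted-tail (_ ∷ s) = s

        record ScanResult (ds rs zs zs′ : List Pt) : Set (c Level.⊔ ℓ₁ Level.⊔ ℓ₂) where
          field
            convex : Convex b zs′
            covers : ∀ {y} (0≤y : 0# ≤ y) → All (Under 0≤y zs′) zs × All (Under 0≤y zs′) ds × All (Under 0≤y zs′) rs

        abstract
          -- The invariant is that the top of the stack has at least the miss probability of the
          -- heads of both lists, so that every insertion takes place at the open end of the hull.
          scan-result : ∀ {ds rs zs zs′} → Scan ds rs zs zs′ → Convex b zs → TopBelow ds zs → TopBelow rs zs →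
                        Sorted ds → Sorted rs → All (Fresh b) ds → All (Fresh b) rs → ScanResult ds rs zs zs′
          scan-result {zs = zs} done cvx _ _ _ _ _ _ = record
            { convex = cvx
            ; covers = λ 0≤y → All.tabulate (Any.map (λ { ≡.refl → ≤-refl })) , [] , [] }
          scan-result {d ∷ ds} {rs} {t ∷ zs} (takeˡ h scan) cvx dt rt sd sr (fd ∷ fds) frs = record
            { convex = R.convex
            ; covers = λ 0≤y → let us , uds , urs = R.covers 0≤y in
                case insert-covers 0≤y zs cvx dt of λ { (ud ∷ uzs) →
                  All.map (through 0≤y us) uzs , through 0≤y us ud ∷ uds , urs } }
            where
            module R = ScanResult (scan-result scan (insert-convex zs cvx dt fd)
                         (insert-top zs ds (sorted-head sd) dt) (insert-top zs rs h dt) (sorted-tail sd) sr fds frs)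
          scan-result {ds} {r ∷ rs} {t ∷ zs} (takeʳ h scan) cvx dt rt sd sr fds (fr ∷ frs) = record
            { convex = R.convex
            ; covers = λ 0≤y → let us , uds , urs = R.covers 0≤y in
                case insert-covers 0≤y zs cvx rt of λ { (ur ∷ uzs) →
                  All.map (through 0≤y us) uzs , uds , through 0≤y us ur ∷ urs } }
            where
            module R = ScanResult (scan-result scan (insert-convex zs cvx rt fr)
                         (insert-top zs ds h rt) (insert-top zs rs (sorted-head sr) rt) sd (sorted-tail sr) fds frs)

        top-profit : ∀ {t} zs → Convex b (t ∷ zs) → All (λ z → profit z ≤ profit t) (t ∷ zs)
        top-profit []       _ = ≤-refl ∷ []
        top-profit (s ∷ zs) ((_ , s<t) , _ , cvx) =
          ≤-refl ∷ All.map (λ z≤s → ≤-trans z≤s (<⇒≤ s<t)) (top-profit zs cvx)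

        module _ {y : Carrier} where

          private abstract
            -- Otherwise `t` would at `y` be worse than `u` and no better than `s`, hence on or
            -- below the segment that joins them. `turn-down` is the mirror image.
            turn-up : ∀ {u t s} → ¬ BelowSegment s t u → miss u < miss t → miss t < miss s →
                      value y t ≤ value y s → value y u ≤ value y t
            turn-up {u} {t} {s} turn u<t t<s vt≤vs with value y u ≤? value y t
            ... | yes v = v
            ... | no vt<vu = ⊥-elim (turn (≤-by
                  (+-nonNegative (*-nonNegative (<⇒≤ (x<y⇒0<y-x vt<vu)) (<⇒≤ (x<y⇒0<y-x t<s)))
                                 (*-nonNegative (x≤y⇒0≤y-x vt≤vs) (<⇒≤ (x<y⇒0<y-x u<t))))
                  (solve 7 (λ cs ct cu qs qt qu y →
                      (cu :- ct) :* (qs :- qt) :- (ct :- cs) :* (qt :- qu) :=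
                      ((cu :+ y :* qu) :- (ct :+ y :* qt)) :* (qs :- qt) :+
                      ((cs :+ y :* qs) :- (ct :+ y :* qt)) :* (qt :- qu))
                    refl (profit s) (profit t) (profit u) (miss s) (miss t) (miss u) y)))

            turn-down : ∀ {t s u} → ¬ BelowSegment u s t → miss t < miss s → miss s < miss u →
                        value y s ≤ value y t → value y u ≤ value y s
            turn-down {t} {s} {u} turn t<s s<u vs≤vt with value y u ≤? value y s
            ... | yes v = v
            ... | no vs<vu = ⊥-elim (turn (≤-by
                  (+-nonNegative (*-nonNegative (<⇒≤ (x<y⇒0<y-x vs<vu)) (<⇒≤ (x<y⇒0<y-x t<s)))
                                 (*-nonNegative (x≤y⇒0≤y-x vs≤vt) (<⇒≤ (x<y⇒0<y-x s<u))))
                  (solve 7 (λ cs ct cu qs qt qu y →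
                      (ct :- cs) :* (qu :- qs) :- (cs :- cu) :* (qs :- qt) :=
                      ((cu :+ y :* qu) :- (cs :+ y :* qs)) :* (qs :- qt) :+
                      ((ct :+ y :* qt) :- (cs :+ y :* qs)) :* (qu :- qs))
                    refl (profit s) (profit t) (profit u) (miss s) (miss t) (miss u) y)))

            climb : ∀ {t s h k} zs → Convex b (h ∷ k ∷ zs) → Adjacent t s (h ∷ k ∷ zs) →
                    value y t ≤ value y s → value y h ≤ value y k
            climb _        _ here         v = v
            climb {h = h} {k} (l ∷ zs) ((h<k , _) , turn , cvx@((k<l , _) , _ , _)) (there adj) v =
              turn-up {h} {k} {l} turn h<k k<l (climb zs cvx adj v)
            climb []       _ (there (there ())) v

            descend : ∀ {t s} zs → Convex b (t ∷ s ∷ zs) → value y s ≤ value y t →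
                      All (λ z → value y z ≤ value y s) zs
            descend []       _ _ = []
            descend {t} {s} (u ∷ zs) ((t<s , _) , turn , cvx@((s<u , _) , _ , _)) v =
              vu≤vs ∷ All.map (λ w → ≤-trans w vu≤vs) (descend zs cvx vu≤vs)
              where
              vu≤vs : value y u ≤ value y s
              vu≤vs = turn-down {t} {s} {u} turn t<s s<u v

          abstract
            -- Along the hull the values at a fixed `y` first rise and then fall, so neighbours of
            -- equal value stand at the summit.
            tie-maximal : ∀ {t s} zs → Convex b zs → Adjacent t s zs → value y t ≈ value y s →
                          All (λ z → value y z ≤ value y s) zs
            tie-maximal (t ∷ s ∷ zs) cvx here v =
              ≤-reflexive v ∷ ≤-refl ∷ descend zs cvx (≤-reflexive (sym v))
            tie-maximal (h ∷ k ∷ zs) cvx@(_ , _ , cvx′) (there adj) v with tie-maximal (k ∷ zs) cvx′ adj v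
            ... | w ∷ ws = ≤-trans (climb {h = h} {k} zs cvx (there adj) (≤-reflexive v)) w ∷ w ∷ ws
            tie-maximal (h ∷ []) _ (there ()) v

        adjacent-rises : ∀ {t s} zs → Convex b zs → Adjacent t s zs → Rises t s × t ∈ᴸ zs × s ∈ᴸ zs
        adjacent-rises (t ∷ s ∷ zs) (rises , _) here = rises , here ≡.refl , there (here ≡.refl)
        adjacent-rises (h ∷ k ∷ zs) (_ , _ , cvx) (there adj) =
          let r , i , j = adjacent-rises (k ∷ zs) cvx adj in r , there i , there j
        adjacent-rises (h ∷ []) _ (there ())

-- Grids of pairs and the growth of the sets along their hulls.

module Grid where
  open Field
  open Hull
  open import Data.Empty using (⊥; ⊥-elim)
  open import Data.List.Base using (List; []; _∷_; length; reverse; _ʳ++_)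
  open import Data.List.Membership.Propositional using (find) renaming (_∈_ to _∈ᴸ_)
  open import Data.List.Relation.Unary.All as All using (All; []; _∷_)
  open import Data.List.Relation.Unary.AllPairs using (AllPairs; []; _∷_)
  open import Data.List.Relation.Unary.Any using (Any; here; there)
  import Data.List.Relation.Unary.Any.Properties as Anyₚ
  open import Data.List.Relation.Unary.Linked as Linked using (Linked; []; [-]; _∷_)
  open import Data.List.Relation.Unary.Linked.Properties using (Linked⇒AllPairs)
  open import Data.Nat.Base as ℕ using (ℕ; suc)
  import Data.Nat.Properties as ℕₚ
  open import Data.Product.Base using (∃-syntax; _×_; _,_; proj₁; proj₂)
  open import Data.Sum.Base using (_⊎_; inj₁; inj₂)
  open import Function.Base using (_∘_; _on_)
  import Level
  open import Relation.Binary.PropositionalEquality as ≡ using (_≡_; subst)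
  open import Relation.Nullary using (¬_; yes; no)

  allPairs-compare : ∀ {a r} {A : Set a} {R : A → A → Set r} {xs x y} → AllPairs R xs → x ∈ᴸ xs → y ∈ᴸ xs →
                     x ≡ y ⊎ R x y ⊎ R y x
  allPairs-compare (_ ∷ _)   (here ≡.refl) (here ≡.refl) = inj₁ ≡.refl
  allPairs-compare (rs ∷ _)  (here ≡.refl) (there j)     = inj₂ (inj₁ (All.lookup rs j))
  allPairs-compare (rs ∷ _)  (there i)     (here ≡.refl) = inj₂ (inj₂ (All.lookup rs i))
  allPairs-compare (_ ∷ rss) (there i)     (there j)     = allPairs-compare rss i j

  -- At most `N + 1` different numbers do not exceed `N`. With the number of served nodes as `f`,
  -- this bounds the length of every list that is kept.
  linked-length : ∀ {a} {A : Set a} (f : A → ℕ) {N xs} → Linked (ℕ._<_ on f) xs → All (λ x → f x ℕ.≤ N) xs →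
                  length xs ℕ.≤ suc N
  linked-length f {N} {[]}     _ _ = ℕ.z≤n
  linked-length {A = A} f {N} {x ∷ xs} l b = ℕₚ.≤-trans (ℕₚ.m≤n+m _ (f x)) (go x xs l b)
    where
    go : ∀ x xs → Linked (ℕ._<_ on f) (x ∷ xs) → All (λ x → f x ℕ.≤ N) (x ∷ xs) → f x ℕ.+ suc (length xs) ℕ.≤ suc N
    go x []       _         (x≤N ∷ _) = ℕₚ.≤-trans (ℕₚ.≤-reflexive (ℕₚ.+-comm (f x) 1)) (ℕ.s≤s x≤N)
    go x (y ∷ xs) (x<y ∷ l) (_ ∷ bs)  = ℕₚ.≤-trans (ℕₚ.≤-reflexive (ℕₚ.+-suc (f x) _))
                                          (ℕₚ.≤-trans (ℕₚ.+-monoˡ-≤ _ x<y) (go y xs l bs))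

  module Grids {c ℓ₁ ℓ₂} (K : OrderedField c ℓ₁ ℓ₂) where
    open OrderedField K hiding (sum; product)
    open FieldProperties K
    open Hulls K

    Climbs : {X : Set} → (X → ℕ) → Point X → Point X → Set ℓ₂
    Climbs rank p x = miss x < miss p × rank (choice p) ℕ.< rank (choice x)

    climbs-trans : ∀ {X} (rank : X → ℕ) {p x z} → Climbs rank p x → Climbs rank x z → Climbs rank p z
    climbs-trans rank (q , r) (q′ , r′) = <-trans q′ q , ℕₚ.<-trans r r′

    -- Positivity is asked of the first entry alone: a node with probability 1 gives later entries
    -- the miss probability 0.
    record Staircase {X : Set} (rank : X → ℕ) (x₀ : Point X) (xs : List (Point X)) : Set (c Level.⊔ ℓ₁ Level.⊔ ℓ₂) where
      field
        linked      : Linked (Climbs rank) (x₀ ∷ xs)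
        nonNegative : All (λ x → 0# ≤ miss x) (x₀ ∷ xs)
        positive    : 0# < miss x₀

      compare : ∀ {x y} → x ∈ᴸ x₀ ∷ xs → y ∈ᴸ x₀ ∷ xs → x ≡ y ⊎ Climbs rank x y ⊎ Climbs rank y x
      compare = allPairs-compare (Linked⇒AllPairs (λ {p} {x} {z} → climbs-trans rank {p} {x} {z}) linked)

      first : ∀ {x} → x ∈ᴸ x₀ ∷ xs → x ≡ x₀ ⊎ miss x < miss x₀
      first (here e)  = inj₁ e
      first (there i) with Linked⇒AllPairs (λ {p} {x} {z} → climbs-trans rank {p} {x} {z}) linked
      ... | rs ∷ _ = inj₂ (proj₁ (All.lookup rs i))

    module _ {X Y : Set} where

      pair : Point X → Point Y → ℕ → ℕ → Point (X × Y)
      pair a b i j = point (profit a + profit b) (miss a * miss b) i j (choice a , choice b)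

      row : Point Y → ℕ → ℕ → List (Point X) → List (Point (X × Y))
      row b j i []       = []
      -- A point occupies two cells, so the address of the next one is larger by 2.
      row b j i (a ∷ as) = pair a b i j ∷ row b j (2 ℕ.+ i) as

      record IsPair (as : List (Point X)) (bs : List (Point Y)) (d : Point (X × Y)) : Set c where
        constructor isPair
        field
          {a} : Point X
          {b} : Point Y
          a∈  : a ∈ᴸ as
          b∈  : b ∈ᴸ bs
          profit≡ : profit d ≡ profit a + profit b
          miss≡   : miss d ≡ miss a * miss b
          choice≡ : choice d ≡ (choice a , choice b)

      row-pairs : ∀ b j i as {as′} → (∀ {a} → a ∈ᴸ as → a ∈ᴸ as′) → ∀ {bs} → b ∈ᴸ bs → All (IsPair as′ bs) (row b j i as)
      row-pairs b j i []       f b∈ = []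
      row-pairs b j i (a ∷ as) f b∈ =
        isPair (f (here ≡.refl)) b∈ ≡.refl ≡.refl ≡.refl ∷ row-pairs b j _ as (f ∘ there) b∈

      row-any : ∀ b j i as {a} → a ∈ᴸ as → ∀ y → Any (λ d → (profit a + profit b) + y * (miss a * miss b) ≤ value y d) (row b j i as)
      row-any b j i (a ∷ as) (here ≡.refl) y = here ≤-refl
      row-any b j i (a ∷ as) (there i∈)    y = there (row-any b j _ as i∈ y)

      abstract
        -- The order is only weak: if `miss b` is 0, the entire row has miss probability 0.
        row-sorted : ∀ {rank : X → ℕ} {b} j i as → 0# ≤ miss b → Linked (Climbs rank) as →
                     Linked (λ p x → miss x ≤ miss p) (row b j i as)
        row-sorted j i []            0≤b l           = []
        row-sorted j i (a ∷ [])      0≤b l           = [-]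
        row-sorted {b = b} j i (a ∷ a′ ∷ as) 0≤b ((q , _) ∷ l) =
          ≤-by (*-nonNegative 0≤b (<⇒≤ (x<y⇒0<y-x q)))
            (solve 3 (λ x y z → x :* z :- y :* z := z :* (x :- y)) refl (miss a) (miss a′) (miss b))
          ∷ row-sorted j _ (a′ ∷ as) 0≤b l

    module _ {X : Set} where

      private
        all-pop : ∀ {p} {P : Point X → Set p} x zs → All P zs → All P (pop x zs)
        all-pop x []           ps = ps
        all-pop x (t ∷ [])     ps = ps
        all-pop x (t ∷ s ∷ zs) (pt ∷ ps) with belowSegment? s t x
        ... | yes _ = all-pop x (s ∷ zs) ps
        ... | no  _ = pt ∷ ps

        all-insert : ∀ {p} {P : Point X → Set p} x zs → P x → All P zs → All P (insert x zs)
        all-insert x []       px ps = px ∷ []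
        all-insert x (t ∷ zs) px ps with profit x ≤? profit t
        ... | yes _ = ps
        ... | no  _ = px ∷ all-pop x (t ∷ zs) ps

      all-scan : ∀ {p} {P : Point X → Set p} {ds rs zs zs′} → Scan ds rs zs zs′ → All P ds → All P rs → All P zs → All P zs′
      all-scan done        _          _          pz = pz
      all-scan {zs = zs} (takeˡ {d} _ s) (pd ∷ pds) prs        pz = all-scan s pds prs (all-insert d zs pd pz)
      all-scan {zs = zs} (takeʳ {r} _ s) pds        (pr ∷ prs) pz = all-scan s pds prs (all-insert r zs pr pz)

    private abstract
      product-mono : ∀ {x y z w} → 0# ≤ x → 0# ≤ w → x ≤ y → z ≤ w → x * z ≤ y * w
      product-mono {x} {y} {z} {w} 0≤x 0≤w x≤y z≤w = ≤-trans (*-monoˡ-≤ 0≤x z≤w)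
        (≤-by (*-nonNegative 0≤w (x≤y⇒0≤y-x x≤y))
          (solve 3 (λ x y w → y :* w :- x :* w := w :* (y :- x)) refl x y w))

      product-<ʳ : ∀ {x z w} → 0# < x → z < w → x * z < x * w
      product-<ʳ {x} {z} {w} 0<x z<w = <-by (*-positive 0<x (x<y⇒0<y-x z<w))
        (solve 3 (λ x z w → x :* w :- x :* z := x :* (w :- z)) refl x z w)

      tied : ∀ {ct cs qt qs y} → y * (qs - qt) ≈ ct - cs → ct + y * qt ≈ cs + y * qs
      tied {ct} {cs} {qt} {qs} {y} e = begin
        ct + y * qt                        ≈⟨ solve 3 (λ ct cs p → ct :+ p := (ct :- cs) :+ (cs :+ p)) refl ct cs (y * qt) ⟩
        (ct - cs) + (cs + y * qt)          ≈⟨ +-congʳ e ⟨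
        y * (qs - qt) + (cs + y * qt)      ≈⟨ solve 4 (λ cs qt qs y → y :* (qs :- qt) :+ (cs :+ y :* qt) := cs :+ y :* qs) refl cs qt qs y ⟩
        cs + y * qs                        ∎
        where open import Relation.Binary.Reasoning.Setoid setoid

    -- Supermodularity: two crossing pairs cannot both be optimal at a positive slope.
    abstract
      crossing : ∀ {ca cb ca′ cb′ qa qb qa′ qb′ y v} → 0# < y → qa′ < qa → qb < qb′ →
                 (ca + cb) + y * (qa * qb) ≈ v → (ca′ + cb′) + y * (qa′ * qb′) ≈ v →
                 (ca + cb′) + y * (qa * qb′) ≤ v → (ca′ + cb) + y * (qa′ * qb) ≤ v → ⊥
      crossing {ca} {cb} {ca′} {cb′} {qa} {qb} {qa′} {qb′} {y} {v} 0<y qa′<qa qb<qb′ e e′ l l′ =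
        <-by (*-positive 0<y (*-positive (x<y⇒0<y-x qa′<qa) (x<y⇒0<y-x qb<qb′)))
          (trans (interchanged ca cb ca′ cb′ (y * (qa * qb′)) (y * (qa′ * qb)) (y * (qa * qb)) (y * (qa′ * qb′)))
            (solve 5 (λ qa qb qa′ qb′ y →
               (y :* (qa :* qb′) :+ y :* (qa′ :* qb)) :- (y :* (qa :* qb) :+ y :* (qa′ :* qb′)) :=
               y :* ((qa :- qa′) :* (qb′ :- qb))) refl qa qb qa′ qb′ y))
          (≤-trans (+-mono-≤ l l′) (≤-reflexive (sym (+-cong e e′))))
        where
        interchanged : ∀ ca cb ca′ cb′ p q r s →
          (((ca + cb′) + p) + ((ca′ + cb) + q)) - (((ca + cb) + r) + ((ca′ + cb′) + s)) ≈ (p + q) - (r + s)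
        interchanged ca cb ca′ cb′ p q r s = trans
          (+-cong (shuffle (ca + cb′) p (ca′ + cb) q)
                  (-‿cong (trans (shuffle (ca + cb) r (ca′ + cb′) s) (+-congʳ
                    (solve 4 (λ ca cb ca′ cb′ → (ca :+ cb) :+ (ca′ :+ cb′) := (ca :+ cb′) :+ (ca′ :+ cb)) refl ca cb ca′ cb′)))))
          (solve 3 (λ t u v → (t :+ u) :- (t :+ v) := u :- v) refl _ (p + q) (r + s))
          where
          shuffle : ∀ t p u q → (t + p) + (u + q) ≈ (t + u) + (p + q)
          shuffle = solve 4 (λ t p u q → (t :+ p) :+ (u :+ q) := (t :+ u) :+ (p :+ q)) refl

    module _ {X Y : Set} (rankˣ : X → ℕ) (rankʸ : Y → ℕ) where

      rankᵖ : X × Y → ℕ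
      rankᵖ (x , y) = rankˣ x ℕ.+ rankʸ y

      private
        Tied : Point X → Point Y → Point X → Point Y → Set (c Level.⊔ ℓ₁ Level.⊔ ℓ₂)
        Tied a b a′ b′ = ∃[ y ] ∃[ v ] (0# < y
          × (profit a + profit b) + y * (miss a * miss b) ≈ v
          × (profit a′ + profit b′) + y * (miss a′ * miss b′) ≈ v
          × (profit a + profit b′) + y * (miss a * miss b′) ≤ v
          × (profit a′ + profit b) + y * (miss a′ * miss b) ≤ v)

      private abstract
        -- The miss probability falls from `(a , b)` to `(a′ , b′)`. This cannot happen if neither
        -- component moves on in its list, and `crossing` excludes that they move in opposite
        -- directions; in the remaining cases the rank grows.
        pair-rank : ∀ {a a′ : Point X} {b b′ : Point Y} → 0# ≤ miss a → 0# ≤ miss b → 0# ≤ miss b′ →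
                    a ≡ a′ ⊎ Climbs rankˣ a a′ ⊎ Climbs rankˣ a′ a →
                    b ≡ b′ ⊎ Climbs rankʸ b b′ ⊎ Climbs rankʸ b′ b →
                    ¬ miss a * miss b ≤ miss a′ * miss b′ → Tied a b a′ b′ →
                    rankˣ (choice a) ℕ.+ rankʸ (choice b) ℕ.< rankˣ (choice a′) ℕ.+ rankʸ (choice b′)
        pair-rank 0≤a 0≤b 0≤b′ (inj₁ ≡.refl) (inj₁ ≡.refl) loss _ = ⊥-elim (loss ≤-refl)
        pair-rank {a} 0≤a 0≤b 0≤b′ (inj₁ ≡.refl) (inj₂ (inj₁ (_ , r))) loss _ = ℕₚ.+-monoʳ-< (rankˣ (choice a)) r
        pair-rank {b = b} 0≤a 0≤b 0≤b′ (inj₂ (inj₁ (_ , r))) (inj₁ ≡.refl) loss _ = ℕₚ.+-monoˡ-< (rankʸ (choice b)) r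
        pair-rank 0≤a 0≤b 0≤b′ (inj₂ (inj₁ (_ , r))) (inj₂ (inj₁ (_ , r′))) loss _ = ℕₚ.+-mono-< r r′
        pair-rank 0≤a 0≤b 0≤b′ (inj₁ ≡.refl) (inj₂ (inj₂ (q , _))) loss _ =
          ⊥-elim (loss (*-monoˡ-≤ 0≤a (<⇒≤ q)))
        pair-rank 0≤a 0≤b 0≤b′ (inj₂ (inj₂ (q , _))) (inj₁ ≡.refl) loss _ =
          ⊥-elim (loss (product-mono 0≤a 0≤b (<⇒≤ q) ≤-refl))
        pair-rank 0≤a 0≤b 0≤b′ (inj₂ (inj₂ (q , _))) (inj₂ (inj₂ (q′ , _))) loss _ =
          ⊥-elim (loss (product-mono 0≤a 0≤b′ (<⇒≤ q) (<⇒≤ q′)))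
        pair-rank {a} {a′} {b} {b′} 0≤a 0≤b 0≤b′ (inj₂ (inj₁ (q , _))) (inj₂ (inj₂ (q′ , _))) loss (y , v , 0<y , e , e′ , l , l′) =
          ⊥-elim (crossing {profit a} {profit b} {profit a′} {profit b′} {miss a} {miss b} {miss a′} {miss b′} {y} {v} 0<y q q′ e e′ l l′)
        pair-rank {a} {a′} {b} {b′} 0≤a 0≤b 0≤b′ (inj₂ (inj₂ (q , _))) (inj₂ (inj₁ (q′ , _))) loss (y , v , 0<y , e , e′ , l , l′) =
          ⊥-elim (crossing {profit a′} {profit b′} {profit a} {profit b} {miss a′} {miss b′} {miss a} {miss b} {y} {v} 0<y q q′ e′ e l′ l)

      -- `bs` and `covered` may differ: the corner is on the list before the row it belongs to has
      -- been scanned, so pairs may use an entry of `bs` whose row is not yet covered.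
      record Frontier (as : List (Point X)) (bs covered : List (Point Y)) (ds : List (Point (X × Y))) : Set (c Level.⊔ ℓ₂) where
        field
          linked : Linked (Climbs rankᵖ) ds
          pairs  : All (IsPair as bs) ds
          covers : ∀ {a b y} → a ∈ᴸ as → b ∈ᴸ covered → 0# ≤ y →
                   Any (λ d → (profit a + profit b) + y * (miss a * miss b) ≤ value y d) ds

      module _ {a₀ as b₀ bs} (A : Staircase rankˣ a₀ as) (B : Staircase rankʸ b₀ bs) where
        private
          module A = Staircase A
          module B = Staircase B

        abstract
          -- As the first entries of both lists have positive miss probability, replacing either by
          -- a later entry strictly lowers the product.
          corner-fresh : ∀ {d₀ d} → profit d₀ ≡ profit a₀ + profit b₀ → miss d₀ ≡ miss a₀ * miss b₀ →
                         IsPair (a₀ ∷ as) (b₀ ∷ bs) d → Fresh d₀ d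
          corner-fresh {d₀} {d} pe me (isPair {a} {b} a∈ b∈ profit≡ miss≡ _) with A.first a∈ | B.first b∈
          ... | inj₁ ≡.refl | inj₁ ≡.refl = inj₂ (≤-reflexive (reflexive (≡.trans profit≡ (≡.sym pe))))
          ... | inj₁ ≡.refl | inj₂ q = inj₁ (≡.subst₂ _<_ (≡.sym miss≡) (≡.sym me) (product-<ʳ A.positive q))
          ... | inj₂ q | _ = inj₁ (≡.subst₂ _<_ (≡.sym miss≡) (≡.sym me)
                  (≤-<-trans (*-monoˡ-≤ (All.lookup A.nonNegative a∈) b≤b₀)
                    (<-by (*-positive B.positive (x<y⇒0<y-x q))
                      (solve 3 (λ x y z → y :* z :- x :* z := z :* (y :- x)) refl (miss a) (miss a₀) (miss b₀)))))
            where
            b≤b₀ : miss b ≤ miss b₀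
            b≤b₀ with B.first b∈
            ... | inj₁ ≡.refl = ≤-refl
            ... | inj₂ q = <⇒≤ q

        module _ {covered} (sub : ∀ {b} → b ∈ᴸ covered → b ∈ᴸ b₀ ∷ bs) {d₀ zs} (cvx : Convex d₀ zs)
                 (pairs : All (IsPair (a₀ ∷ as) covered) zs)
                 (covers : ∀ {a b y} → a ∈ᴸ a₀ ∷ as → b ∈ᴸ covered → 0# ≤ y →
                           Any (λ d → (profit a + profit b) + y * (miss a * miss b) ≤ value y d) zs) where

          private
            0≤ᴬ : ∀ {a} → a ∈ᴸ a₀ ∷ as → 0# ≤ miss a
            0≤ᴬ = All.lookup A.nonNegative
            0≤ᴮ : ∀ {b} → b ∈ᴸ covered → 0# ≤ miss b
            0≤ᴮ = All.lookup B.nonNegative ∘ sub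

            -- At the slope where s and t tie both are optimal among all pairs.
            abstract
              uncrossed : ∀ {t s a b a′ b′} → Adjacent t s zs → Rises t s →
                          a ∈ᴸ a₀ ∷ as → b ∈ᴸ covered → a′ ∈ᴸ a₀ ∷ as → b′ ∈ᴸ covered →
                          profit s ≡ profit a + profit b → miss s ≡ miss a * miss b →
                          profit t ≡ profit a′ + profit b′ → miss t ≡ miss a′ * miss b′ →
                          Tied a b a′ b′
              uncrossed {t} {s} {a} {b} {a′} {b′} adj (qt<qs , cs<ct) a∈ b∈ a′∈ b′∈ ps ms pt mt
                with quotient (x<y⇒0<y-x qt<qs) (x<y⇒0<y-x cs<ct)
              ... | y , 0<y , e = y , value y s , 0<y
                  , reflexive (≡.sym (≡.cong₂ (λ p m → p + y * m) ps ms))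
                  , trans (reflexive (≡.sym (≡.cong₂ (λ p m → p + y * m) pt mt))) tie
                  , best a∈ b′∈ , best a′∈ b∈
                where
                tie : value y t ≈ value y s
                tie = tied e
                best : ∀ {a b} → a ∈ᴸ a₀ ∷ as → b ∈ᴸ covered →
                       (profit a + profit b) + y * (miss a * miss b) ≤ value y s
                best a∈ b∈ with find (covers a∈ b∈ (<⇒≤ 0<y))
                ... | d , d∈ , v≤d = ≤-trans v≤d (All.lookup (tie-maximal zs cvx adj tie) d∈)

          abstract
            ranked : ∀ {t s} → Adjacent t s zs → Climbs rankᵖ s t
            ranked {t} {s} adj = proj₁ rises , ranked′ (All.lookup pairs s∈) (All.lookup pairs t∈)
              where
              info : Rises t s × t ∈ᴸ zs × s ∈ᴸ zs
              info = adjacent-rises zs cvx adj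
              rises : Rises t s
              rises = proj₁ info
              t∈ : t ∈ᴸ zs
              t∈ = proj₁ (proj₂ info)
              s∈ : s ∈ᴸ zs
              s∈ = proj₂ (proj₂ info)
              ranked′ : IsPair (a₀ ∷ as) covered s → IsPair (a₀ ∷ as) covered t → rankᵖ (choice s) ℕ.< rankᵖ (choice t)
              ranked′ (isPair {a} {b} a∈ b∈ ps ms gs) (isPair {a′} {b′} a′∈ b′∈ pt mt gt) =
                ≡.subst₂ (λ x y → rankᵖ x ℕ.< rankᵖ y) (≡.sym gs) (≡.sym gt)
                  (pair-rank (0≤ᴬ a∈) (0≤ᴮ b∈) (0≤ᴮ b′∈) (A.compare a∈ a′∈) (B.compare (sub b∈) (sub b′∈))
                    (λ p → proj₁ rises (≡.subst₂ _≤_ (≡.sym ms) (≡.sym mt) p))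
                    (uncrossed adj rises a∈ b∈ a′∈ b′∈ ps ms pt mt))

        record RowResult (d₀ : Point (X × Y)) (covered : List (Point Y)) (zs : List (Point (X × Y))) : Set (c Level.⊔ ℓ₁ Level.⊔ ℓ₂) where
          field
            convex   : Convex d₀ zs
            frontier : Frontier (a₀ ∷ as) covered covered (reverse zs)
            bottom   : ∃[ ds ] reverse zs ≡ d₀ ∷ ds

        private
          reverse-bottom : ∀ {d₀ : Point (X × Y)} zs acc → Convex d₀ zs → ∃[ ds ] zs ʳ++ acc ≡ d₀ ∷ ds
          reverse-bottom (x ∷ [])     acc (Level.lift ≡.refl) = acc , ≡.refl
          reverse-bottom (t ∷ s ∷ zs) acc (_ , _ , cvx)       = reverse-bottom (s ∷ zs) (t ∷ acc) cvx

        -- The corner `d₀` heads the old list and becomes the anchor of the new stack; the remaining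
        -- old points are merged with the row of `b`. Reversing the stack restores the order of
        -- decreasing miss probability.
        row-step : ∀ {d₀ ds b covered j i zs} → profit d₀ ≡ profit a₀ + profit b₀ → miss d₀ ≡ miss a₀ * miss b₀ →
                   (∀ {b′} → b′ ∈ᴸ b ∷ covered → b′ ∈ᴸ b₀ ∷ bs) →
                   Frontier (a₀ ∷ as) (b ∷ covered) covered (d₀ ∷ ds) →
                   Scan ds (row b j i (a₀ ∷ as)) (d₀ ∷ []) zs → RowResult d₀ (b ∷ covered) zs
        row-step {d₀} {ds} {b} {covered} {j} {i} {zs} pe me sub F scan = record
          { convex = S.convex
          ; frontier = record
              { linked = linked-reverse (adjacent⇒linked zs (ranked {b ∷ covered} sub {d₀} {zs} S.convex pairs′ covers′))
              ; pairs = All.tabulate (All.lookup pairs′ ∘ Anyₚ.reverse⁻)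
              ; covers = λ a∈ b∈ 0≤y → Anyₚ.reverse⁺ (covers′ a∈ b∈ 0≤y) }
          ; bottom = reverse-bottom zs [] S.convex }
          where
          module F = Frontier F
          linked-tail : ∀ {R : Point (X × Y) → Point (X × Y) → Set ℓ₂} {x xs} → Linked R (x ∷ xs) → Linked R xs
          linked-tail [-]     = []
          linked-tail (_ ∷ l) = l
          head-below : ∀ {x xs} → Linked (Climbs rankᵖ) (x ∷ xs) → HeadBelow xs x
          head-below [-]           = _
          head-below ((q , _) ∷ _) = <⇒≤ q
          row-pairs′ = row-pairs b j i (a₀ ∷ as) {a₀ ∷ as} (λ a∈ → a∈) {b ∷ covered} (here ≡.refl)
          weaken : ∀ {d} → IsPair (a₀ ∷ as) (b ∷ covered) d → IsPair (a₀ ∷ as) (b₀ ∷ bs) d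
          weaken (isPair a∈ b∈ p m g) = isPair a∈ (sub b∈) p m g
          fresh : ∀ {xs} → All (IsPair (a₀ ∷ as) (b ∷ covered)) xs → All (Fresh d₀) xs
          fresh = All.map (λ {d} p → corner-fresh {d₀} {d} pe me (weaken {d} p))
          row-below : miss a₀ * miss b ≤ miss d₀
          row-below = ≡.subst (_ ≤_) (≡.sym me) (*-monoˡ-≤ (<⇒≤ A.positive) b≤b₀)
            where
            b≤b₀ : miss b ≤ miss b₀
            b≤b₀ with B.first (sub (here ≡.refl))
            ... | inj₁ ≡.refl = ≤-refl
            ... | inj₂ q = <⇒≤ q
          module S = ScanResult (scan-result {b = d₀} scan (Level.lift ≡.refl) (head-below {d₀} F.linked) row-below
                       (Linked.map (λ {p} {x} (r : Climbs rankᵖ p x) → <⇒≤ (proj₁ r)) (linked-tail {Climbs rankᵖ} F.linked))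
                       (row-sorted j i (a₀ ∷ as) (All.lookup B.nonNegative (sub (here ≡.refl))) A.linked)
                       (fresh (All.tail F.pairs)) (fresh row-pairs′))
          pairs′ : All (IsPair (a₀ ∷ as) (b ∷ covered)) zs
          pairs′ = all-scan scan (All.tail F.pairs) row-pairs′ (All.head F.pairs ∷ [])
          covers′ : ∀ {a b′ y} → a ∈ᴸ a₀ ∷ as → b′ ∈ᴸ b ∷ covered → 0# ≤ y →
                    Any (λ d → (profit a + profit b′) + y * (miss a * miss b′) ≤ value y d) zs
          covers′ {y = y} a∈ (here ≡.refl) 0≤y =
            through {b = d₀} 0≤y (proj₂ (proj₂ (S.covers 0≤y))) (row-any b j i (a₀ ∷ as) a∈ y)
          covers′ a∈ (there b∈) 0≤y = through {b = d₀} 0≤y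
            (All.head (proj₁ (S.covers 0≤y)) ∷ proj₁ (proj₂ (S.covers 0≤y))) (F.covers a∈ b∈ 0≤y)

-- Structured commands, their compilation and timed correctness.

module Machine where
  open import Data.Bool.Base using (Bool; true; false; if_then_else_; T; _∨_)
  open import Data.Bool.Properties using (∨-conicalˡ; ∨-conicalʳ; T-∧)
  open import Function.Bundles using (module Equivalence)
  open import Data.Bool.ListAction using (all; any)
  open import Data.List.Base using (List; []; _∷_; _++_; length)
  open import Data.List.Properties using (length-++)
  open import Data.Maybe.Base using (just)
  open import Data.Nat.Base as ℕ using (ℕ; suc; _≤_)
  import Data.Nat.Properties as ℕₚ
  open import Data.Product.Base using (∃-syntax; _×_; _,_; proj₁; proj₂)
  open import Data.Unit.Base using (⊤; tt)
  import Level
  open import Relation.Binary.PropositionalEquality as ≡ using (_≡_; refl; cong; sym; trans; subst)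
  open import Relation.Nullary using (does)

  data Test : Set where
    lt le : Register → Register → Test

  -- These instructions always succeed and pass on to the next one. Division can fail and is left
  -- out; slopes are compared by products instead.
  isBasic : Instr → Bool
  isBasic (divᶠ _ _ _)   = false
  isBasic (jump _)       = false
  isBasic (jump<ᴺ _ _ _) = false
  isBasic (jump≤ᶠ _ _ _) = false
  isBasic halt           = false
  isBasic _              = true

  infixr 4 _⨾_

  data Cmd : Set where
    blk   : (is : List Instr) {_ : T (all isBasic is)} → Cmd
    _⨾_   : Cmd → Cmd → Cmd
    cond  : Test → Cmd → Cmd → Cmd
    -- while c t d  runs c, leaves the loop if t fails, otherwise runs d and repeats.
    while : Cmd → Test → Cmd → Cmd

  skip : Cmd
  skip = blk []

  jumpOn : Test → Label → Instr
  jumpOn (lt i j) = jump<ᴺ i j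
  jumpOn (le i j) = jump≤ᶠ i j

  size : Cmd → ℕ
  size (blk is)      = length is
  size (c ⨾ d)       = size c ℕ.+ size d
  size (cond t c d)  = suc (size d ℕ.+ suc (size c))
  size (while c t d) = size c ℕ.+ suc (suc (size d ℕ.+ 1))

  -- Jump targets are absolute, so the code depends on the label at which it starts. In a
  -- conditional the branch for failure comes first, because a test jumps when it holds.
  compile : Cmd → Label → List Instr
  compile (blk is)      k = is
  compile (c ⨾ d)       k = compile c k ++ compile d (k ℕ.+ size c)
  compile (cond t c d)  k =
    jumpOn t (suc (suc k ℕ.+ size d)) ∷ compile d (suc k) ++
    jump (suc (suc k ℕ.+ size d) ℕ.+ size c) ∷ compile c (suc (suc k ℕ.+ size d))
  compile (while c t d) k =
    compile c k ++ jumpOn t (suc (suc (k ℕ.+ size c))) ∷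
    jump (k ℕ.+ (size c ℕ.+ suc (suc (size d ℕ.+ 1)))) ∷
    compile d (suc (suc (k ℕ.+ size c))) ++ jump k ∷ []

  length-compile : ∀ c k → length (compile c k) ≡ size c
  length-compile (blk is) k = refl
  length-compile (c ⨾ d) k = trans (length-++ (compile c k)) (≡.cong₂ ℕ._+_ (length-compile c k) (length-compile d _))
  length-compile (cond t c d) k = cong suc (trans (length-++ (compile d _))
    (≡.cong₂ ℕ._+_ (length-compile d _) (cong suc (length-compile c _))))
  length-compile (while c t d) k = trans (length-++ (compile c k)) (≡.cong₂ ℕ._+_ (length-compile c k)
    (cong (λ m → suc (suc m)) (trans (length-++ (compile d _)) (cong (ℕ._+ 1) (length-compile d _)))))

  CodeAt : Program → Label → List Instr → Set
  CodeAt prog k []       = ⊤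
  CodeAt prog k (i ∷ is) = nth prog k ≡ just i × CodeAt prog (suc k) is

  codeAt-≡ : ∀ {prog k l} is → k ≡ l → CodeAt prog k is → CodeAt prog l is
  codeAt-≡ is refl code = code

  codeAt-++ˡ : ∀ {prog} k is {js} → CodeAt prog k (is ++ js) → CodeAt prog k is
  codeAt-++ˡ k []       _       = tt
  codeAt-++ˡ k (i ∷ is) (e , p) = e , codeAt-++ˡ (suc k) is p

  codeAt-++ʳ : ∀ {prog} k is {js} → CodeAt prog k (is ++ js) → CodeAt prog (k ℕ.+ length is) js
  codeAt-++ʳ k []       {js} p       = codeAt-≡ js (sym (ℕₚ.+-identityʳ k)) p
  codeAt-++ʳ k (i ∷ is) {js} (_ , p) = codeAt-≡ js (sym (ℕₚ.+-suc k (length is))) (codeAt-++ʳ (suc k) is p)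

  codeAt-all : ∀ prog → CodeAt prog 0 prog
  codeAt-all = suffix []
    where
    suffix : ∀ pre is → CodeAt (pre ++ is) (length pre) is
    suffix pre []       = tt
    suffix pre (i ∷ is) = lookup pre ,
      ≡.subst₂ (λ p k → CodeAt p k is) (snoc pre) (trans (length-++ pre) (ℕₚ.+-comm (length pre) 1)) (suffix (pre ++ i ∷ []) is)
      where
      lookup : ∀ pre → nth (pre ++ i ∷ is) (length pre) ≡ just i
      lookup []        = refl
      lookup (_ ∷ pre) = lookup pre
      snoc : ∀ pre → (pre ++ i ∷ []) ++ is ≡ pre ++ i ∷ is
      snoc []        = refl
      snoc (j ∷ pre) = cong (j ∷_) (snoc pre)

  program : Cmd → Program
  program cmd = compile cmd 0 ++ halt ∷ []

  writesᴺ writesᶠ : Instr → Register → Bool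
  writesᴺ (setᴺ i _)    j = does (j ℕₚ.≟ i)
  writesᴺ (moveᴺ i _)   j = does (j ℕₚ.≟ i)
  writesᴺ (addᴺ i _ _)  j = does (j ℕₚ.≟ i)
  writesᴺ (subᴺ i _ _)  j = does (j ℕₚ.≟ i)
  writesᴺ (loadᴺ i _)   j = does (j ℕₚ.≟ i)
  writesᴺ _             j = false
  writesᶠ (zeroᶠ i)     j = does (j ℕₚ.≟ i)
  writesᶠ (oneᶠ i)      j = does (j ℕₚ.≟ i)
  writesᶠ (moveᶠ i _)   j = does (j ℕₚ.≟ i)
  writesᶠ (addᶠ i _ _)  j = does (j ℕₚ.≟ i)
  writesᶠ (subᶠ i _ _)  j = does (j ℕₚ.≟ i)
  writesᶠ (mulᶠ i _ _)  j = does (j ℕₚ.≟ i)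
  writesᶠ (loadᶠ i _)   j = does (j ℕₚ.≟ i)
  writesᶠ _             j = false

  storesᴺ storesᶠ : Instr → Bool
  storesᴺ (storeᴺ _ _) = true
  storesᴺ _            = false
  storesᶠ (storeᶠ _ _) = true
  storesᶠ _            = false

  anyInstr : (Instr → Bool) → Cmd → Bool
  anyInstr f (blk is)      = any f is
  anyInstr f (c ⨾ d)       = anyInstr f c ∨ anyInstr f d
  anyInstr f (cond t c d)  = anyInstr f c ∨ anyInstr f d
  anyInstr f (while c t d) = anyInstr f c ∨ anyInstr f d

  module Machines {c ℓ₁ ℓ₂} (K : OrderedField c ℓ₁ ℓ₂) where
    open OrderedField K using (Carrier; _≤?_; _+_; _*_; _-_; 0#; 1#)

    record Store : Set c where
      constructor store
      field
        rN : ℕ → ℕ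
        rF : ℕ → Carrier
        mN : ℕ → ℕ
        mF : ℕ → Carrier
    open Store public

    at : Label → Store → State K
    at k s = state k (rN s) (rF s) (mN s) (mF s)

    eff : Instr → Store → Store
    eff (setᴺ i k)   (store r f m g) = store (r [ i ≔ k ]) f m g
    eff (moveᴺ i j)  (store r f m g) = store (r [ i ≔ r j ]) f m g
    eff (addᴺ i j k) (store r f m g) = store (r [ i ≔ r j ℕ.+ r k ]) f m g
    eff (subᴺ i j k) (store r f m g) = store (r [ i ≔ r j ℕ.∸ r k ]) f m g
    eff (loadᴺ i j)  (store r f m g) = store (r [ i ≔ m (r j) ]) f m g
    eff (storeᴺ i j) (store r f m g) = store r f (m [ r i ≔ r j ]) g
    eff (zeroᶠ i)    (store r f m g) = store r (f [ i ≔ 0# ]) m g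
    eff (oneᶠ i)     (store r f m g) = store r (f [ i ≔ 1# ]) m g
    eff (moveᶠ i j)  (store r f m g) = store r (f [ i ≔ f j ]) m g
    eff (addᶠ i j k) (store r f m g) = store r (f [ i ≔ f j + f k ]) m g
    eff (subᶠ i j k) (store r f m g) = store r (f [ i ≔ f j - f k ]) m g
    eff (mulᶠ i j k) (store r f m g) = store r (f [ i ≔ f j * f k ]) m g
    eff (loadᶠ i j)  (store r f m g) = store r (f [ i ≔ g (r j) ]) m g
    eff (storeᶠ i j) (store r f m g) = store r f m (g [ r i ≔ f j ])
    eff _            s               = s

    effs : List Instr → Store → Store
    effs []       s = s
    effs (i ∷ is) s = effs is (eff i s)

    holds : Test → Store → Bool
    holds (lt i j) s = does (rN s i ℕₚ.<? rN s j)
    holds (le i j) s = does (rF s i ≤? rF s j)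

    private
      step-basic : ∀ i {k s} → T (isBasic i) → step K i (at k s) ≡ just (at (suc k) (eff i s))
      step-basic (setᴺ _ _)    _ = refl
      step-basic (moveᴺ _ _)   _ = refl
      step-basic (addᴺ _ _ _)  _ = refl
      step-basic (subᴺ _ _ _)  _ = refl
      step-basic (loadᴺ _ _)   _ = refl
      step-basic (storeᴺ _ _)  _ = refl
      step-basic (zeroᶠ _)     _ = refl
      step-basic (oneᶠ _)      _ = refl
      step-basic (moveᶠ _ _)   _ = refl
      step-basic (addᶠ _ _ _)  _ = refl
      step-basic (subᶠ _ _ _)  _ = refl
      step-basic (mulᶠ _ _ _)  _ = refl
      step-basic (loadᶠ _ _)   _ = refl
      step-basic (storeᶠ _ _)  _ = refl

      step-test : ∀ t {l k s} → step K (jumpOn t l) (at k s) ≡ just (at (if holds t s then l else suc k) s)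
      step-test (lt _ _) = refl
      step-test (le _ _) = refl

    -- In continuation form: a run from the end of the code extends to a run from its beginning.
    -- Sequencing is then function application, and no notion of a partial run is needed. The time
    -- `t` is an upper bound.
    Exec : Cmd → Store → ℕ → Store → Set c
    Exec cmd s t s′ = ∀ {prog t₀ s″} k → CodeAt prog k (compile cmd k) →
      Run K prog (at (k ℕ.+ size cmd) s′) t₀ s″ → ∃[ t′ ] (Run K prog (at k s) t′ s″ × t′ ≤ t ℕ.+ t₀)

    -- The frame is read off the code: for concrete commands each premise is a closed Boolean
    -- equation with proof `refl`.
    record Preserved (cmd : Cmd) (s s′ : Store) : Set c where
      field
        regᴺ : ∀ i → anyInstr (λ x → writesᴺ x i) cmd ≡ false → rN s′ i ≡ rN s i
        regᶠ : ∀ i → anyInstr (λ x → writesᶠ x i) cmd ≡ false → rF s′ i ≡ rF s i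
        memᴺ : anyInstr storesᴺ cmd ≡ false → mN s′ ≡ mN s
        memᶠ : anyInstr storesᶠ cmd ≡ false → mF s′ ≡ mF s

    -- The final store is exhibited along with the frame, so that a postcondition can itself be the
    -- `wp` of the command that follows.
    record wp {a} (cmd : Cmd) (t : ℕ) (Q : Store → Set a) (s : Store) : Set (c Level.⊔ a) where
      constructor mk
      field
        final     : Store
        exec      : Exec cmd s t final
        preserved : Preserved cmd s final
        post      : Q final

    private
      ≔-keep : ∀ {a} {A : Set a} (f : ℕ → A) j {x i} → does (i ℕₚ.≟ j) ≡ false → (f [ j ≔ x ]) i ≡ f i
      ≔-keep f j e rewrite e = refl

      Kept : Instr → Store → Store → Set c
      Kept x s s′ = (∀ i → writesᴺ x i ≡ false → rN s′ i ≡ rN s i) × (∀ i → writesᶠ x i ≡ false → rF s′ i ≡ rF s i) ×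
                    (storesᴺ x ≡ false → mN s′ ≡ mN s) × (storesᶠ x ≡ false → mF s′ ≡ mF s)

      kept : ∀ x s → Kept x s (eff x s)
      kept (setᴺ j _)     s = (λ _ → ≔-keep (rN s) j) , (λ _ _ → refl) , (λ _ → refl) , (λ _ → refl)
      kept (moveᴺ j _)    s = (λ _ → ≔-keep (rN s) j) , (λ _ _ → refl) , (λ _ → refl) , (λ _ → refl)
      kept (addᴺ j _ _)   s = (λ _ → ≔-keep (rN s) j) , (λ _ _ → refl) , (λ _ → refl) , (λ _ → refl)
      kept (subᴺ j _ _)   s = (λ _ → ≔-keep (rN s) j) , (λ _ _ → refl) , (λ _ → refl) , (λ _ → refl)
      kept (loadᴺ j _)    s = (λ _ → ≔-keep (rN s) j) , (λ _ _ → refl) , (λ _ → refl) , (λ _ → refl)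
      kept (storeᴺ _ _)   s = (λ _ _ → refl) , (λ _ _ → refl) , (λ ()) , (λ _ → refl)
      kept (zeroᶠ j)      s = (λ _ _ → refl) , (λ _ → ≔-keep (rF s) j) , (λ _ → refl) , (λ _ → refl)
      kept (oneᶠ j)       s = (λ _ _ → refl) , (λ _ → ≔-keep (rF s) j) , (λ _ → refl) , (λ _ → refl)
      kept (moveᶠ j _)    s = (λ _ _ → refl) , (λ _ → ≔-keep (rF s) j) , (λ _ → refl) , (λ _ → refl)
      kept (addᶠ j _ _)   s = (λ _ _ → refl) , (λ _ → ≔-keep (rF s) j) , (λ _ → refl) , (λ _ → refl)
      kept (subᶠ j _ _)   s = (λ _ _ → refl) , (λ _ → ≔-keep (rF s) j) , (λ _ → refl) , (λ _ → refl)
      kept (mulᶠ j _ _)   s = (λ _ _ → refl) , (λ _ → ≔-keep (rF s) j) , (λ _ → refl) , (λ _ → refl)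
      kept (loadᶠ j _)    s = (λ _ _ → refl) , (λ _ → ≔-keep (rF s) j) , (λ _ → refl) , (λ _ → refl)
      kept (storeᶠ _ _)   s = (λ _ _ → refl) , (λ _ _ → refl) , (λ _ → refl) , (λ ())
      kept (divᶠ _ _ _)   s = (λ _ _ → refl) , (λ _ _ → refl) , (λ _ → refl) , (λ _ → refl)
      kept (jump _)       s = (λ _ _ → refl) , (λ _ _ → refl) , (λ _ → refl) , (λ _ → refl)
      kept (jump<ᴺ _ _ _) s = (λ _ _ → refl) , (λ _ _ → refl) , (λ _ → refl) , (λ _ → refl)
      kept (jump≤ᶠ _ _ _) s = (λ _ _ → refl) , (λ _ _ → refl) , (λ _ → refl) , (λ _ → refl)
      kept halt           s = (λ _ _ → refl) , (λ _ _ → refl) , (λ _ → refl) , (λ _ → refl)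

      preserved-blk : ∀ is {b} s → Preserved (blk is {b}) s (effs is s)
      preserved-blk []       s = record { regᴺ = λ _ _ → refl ; regᶠ = λ _ _ → refl ; memᴺ = λ _ → refl ; memᶠ = λ _ → refl }
      preserved-blk (x ∷ is) {b} s = record
        { regᴺ = λ i e → trans (P.regᴺ i (∨-conicalʳ _ _ e)) (proj₁ (kept x s) i (∨-conicalˡ _ _ e))
        ; regᶠ = λ i e → trans (P.regᶠ i (∨-conicalʳ _ _ e)) (proj₁ (proj₂ (kept x s)) i (∨-conicalˡ _ _ e))
        ; memᴺ = λ e → trans (P.memᴺ (∨-conicalʳ (storesᴺ x) _ e)) (proj₁ (proj₂ (proj₂ (kept x s))) (∨-conicalˡ _ _ e))
        ; memᶠ = λ e → trans (P.memᶠ (∨-conicalʳ (storesᶠ x) _ e)) (proj₂ (proj₂ (proj₂ (kept x s))) (∨-conicalˡ _ _ e))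
        }
        where
        module P = Preserved (preserved-blk is {proj₂ (Equivalence.to (T-∧ {isBasic x}) b)} (eff x s))

      preserved-trans : ∀ {cmd s s′ s″} → Preserved cmd s s′ → Preserved cmd s′ s″ → Preserved cmd s s″
      preserved-trans p q = record
        { regᴺ = λ i e → trans (Q.regᴺ i e) (P.regᴺ i e)
        ; regᶠ = λ i e → trans (Q.regᶠ i e) (P.regᶠ i e)
        ; memᴺ = λ e → trans (Q.memᴺ e) (P.memᴺ e)
        ; memᶠ = λ e → trans (Q.memᶠ e) (P.memᶠ e) }
        where
        module P = Preserved p
        module Q = Preserved q

      preserved-⊆ : ∀ {cmd} cmd′ {s s′} → (∀ f → anyInstr f cmd′ ≡ false → anyInstr f cmd ≡ false) →
                    Preserved cmd s s′ → Preserved cmd′ s s′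
      preserved-⊆ _ sub p = record
        { regᴺ = λ i e → P.regᴺ i (sub _ e)
        ; regᶠ = λ i e → P.regᶠ i (sub _ e)
        ; memᴺ = λ e → P.memᴺ (sub _ e)
        ; memᶠ = λ e → P.memᶠ (sub _ e) }
        where module P = Preserved p

      run-≡ : ∀ {prog k l τ s″} s → k ≡ l → Run K prog (at k s) τ s″ → Run K prog (at l s) τ s″
      run-≡ s refl run = run

      exec-blk : ∀ is {b} s → Exec (blk is {b}) s (length is) (effs is s)
      exec-blk []       s k _        run = _ , run-≡ s (ℕₚ.+-identityʳ k) run , ℕₚ.≤-refl
      exec-blk (x ∷ is) {b} s k (e , code) run
        with exec-blk is {proj₂ (Equivalence.to (T-∧ {isBasic x}) b)} (eff x s) (suc k) code
               (run-≡ _ (ℕₚ.+-suc k (length is)) run)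
      ... | t′ , run′ , t′≤ = suc t′ , next e (step-basic x (proj₁ (Equivalence.to (T-∧ {isBasic x}) b))) run′ , ℕ.s≤s t′≤

      exec-⨾ : ∀ {x y s s′ s″ t t′} → Exec x s t s′ → Exec y s′ t′ s″ → Exec (x ⨾ y) s (t ℕ.+ t′) s″
      exec-⨾ {x} {y} {s″ = s″} {t = t} {t′} f g {t₀ = t₀} k code run
        with g (k ℕ.+ size x)
               (codeAt-≡ (compile y (k ℕ.+ size x)) (cong (k ℕ.+_) (length-compile x k)) (codeAt-++ʳ k (compile x k) code))
               (run-≡ s″ (sym (ℕₚ.+-assoc k (size x) (size y))) run)
      ... | t₁ , run₁ , t₁≤ with f k (codeAt-++ˡ k (compile x k) code) run₁
      ... | t₂ , run₂ , t₂≤ = t₂ , run₂ , ℕₚ.≤-trans t₂≤ (ℕₚ.≤-trans (ℕₚ.+-monoʳ-≤ t t₁≤) (ℕₚ.≤-reflexive (sym (ℕₚ.+-assoc t t′ t₀))))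

      jumped : ∀ {prog} t {b l k s τ s″} → holds t s ≡ b → nth prog k ≡ just (jumpOn t l) →
               Run K prog (at (if b then l else suc k) s) τ s″ → Run K prog (at k s) (suc τ) s″
      jumped t refl e run = next e (step-test t) run

      cond-end : ∀ k m n → k ℕ.+ suc (n ℕ.+ suc m) ≡ suc (suc k ℕ.+ n) ℕ.+ m
      cond-end k m n = trans (ℕₚ.+-suc k _) (cong suc (trans (sym (ℕₚ.+-assoc k n (suc m))) (ℕₚ.+-suc (k ℕ.+ n) m)))

      exec-cond-true : ∀ {t x y s τ s′} → holds t s ≡ true → Exec x s τ s′ → Exec (cond t x y) s (2 ℕ.+ τ) s′
      exec-cond-true {t} {x} {y} {s′ = s′} h f k (e , code) run
        with f (suc (suc k ℕ.+ size y))
               (codeAt-≡ (compile x (suc (suc k ℕ.+ size y))) (cong (λ m → suc (suc k ℕ.+ m)) (length-compile y (suc k)))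
                 (proj₂ (codeAt-++ʳ (suc k) (compile y (suc k)) code)))
               (run-≡ s′ (cond-end k (size x) (size y)) run)
      ... | t₁ , run₁ , t₁≤ = suc t₁ , jumped t h e run₁ , ℕ.s≤s (ℕₚ.m≤n⇒m≤1+n t₁≤)

      exec-cond-false : ∀ {t x y s τ s′} → holds t s ≡ false → Exec y s τ s′ → Exec (cond t x y) s (2 ℕ.+ τ) s′
      exec-cond-false {t} {x} {y} {τ = τ} {s′} h f {prog} {t₀ = t₀} k (e , code) run
        with f (suc k) (codeAt-++ˡ (suc k) (compile y (suc k)) code)
               (next (subst (λ m → nth prog (suc k ℕ.+ m) ≡ just (jump (suc (suc k ℕ.+ size y) ℕ.+ size x))) (length-compile y (suc k))
                       (proj₁ (codeAt-++ʳ (suc k) (compile y (suc k)) code))) refl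
                 (run-≡ s′ (cond-end k (size x) (size y)) run))
      ... | t₁ , run₁ , t₁≤ = suc t₁ , jumped t h e run₁ , ℕ.s≤s (ℕₚ.≤-trans t₁≤ (ℕₚ.≤-reflexive (ℕₚ.+-suc τ t₀)))

      module _ {prog} (x : Cmd) (t : Test) (y : Cmd) (k : Label) (code : CodeAt prog k (compile (while x t y) k)) where
        private
          k₁ = k ℕ.+ size x
          tail : List Instr
          tail = jumpOn t (suc (suc k₁)) ∷ jump (k ℕ.+ size (while x t y)) ∷ compile y (suc (suc k₁)) ++ jump k ∷ []
          rest : CodeAt prog k₁ tail
          rest = codeAt-≡ tail (cong (k ℕ.+_) (length-compile x k)) (codeAt-++ʳ k (compile x k) code)

        while-head : CodeAt prog k (compile x k)
        while-head = codeAt-++ˡ k (compile x k) code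

        while-test : nth prog k₁ ≡ just (jumpOn t (suc (suc k₁)))
        while-test = proj₁ rest

        while-leave : nth prog (suc k₁) ≡ just (jump (k ℕ.+ size (while x t y)))
        while-leave = proj₁ (proj₂ rest)

        while-body : CodeAt prog (suc (suc k₁)) (compile y (suc (suc k₁)))
        while-body = codeAt-++ˡ _ (compile y (suc (suc k₁))) (proj₂ (proj₂ rest))

        while-back : nth prog (suc (suc k₁) ℕ.+ size y) ≡ just (jump k)
        while-back = subst (λ m → nth prog (suc (suc k₁) ℕ.+ m) ≡ just (jump k)) (length-compile y (suc (suc k₁)))
          (proj₁ (codeAt-++ʳ (suc (suc k₁)) (compile y (suc (suc k₁))) (proj₂ (proj₂ rest))))

      exec-while-exit : ∀ {x t y s τ s′} → Exec x s τ s′ → holds t s′ ≡ false → Exec (while x t y) s (τ ℕ.+ 2) s′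
      exec-while-exit {x} {t} {y} {τ = τ} f h {t₀ = t₀} k code run
        with f k (while-head x t y k code) (jumped t h (while-test x t y k code) (next (while-leave x t y k code) refl run))
      ... | t₁ , run₁ , t₁≤ = t₁ , run₁ , ℕₚ.≤-trans t₁≤ (ℕₚ.≤-reflexive (sym (ℕₚ.+-assoc τ 2 t₀)))

      exec-while-again : ∀ {x t y s s₁ s₂ s₃ τ₁ τ₂ τ₃} → Exec x s τ₁ s₁ → holds t s₁ ≡ true → Exec y s₁ τ₂ s₂ →
                         Exec (while x t y) s₂ τ₃ s₃ → Exec (while x t y) s ((τ₁ ℕ.+ τ₂ ℕ.+ 2) ℕ.+ τ₃) s₃
      exec-while-again {x} {t} {y} {τ₁ = τ₁} {τ₂} {τ₃} f h g w {t₀ = t₀} k code run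
        with w k code run
      ... | t₃ , run₃ , t₃≤ with g (suc (suc (k ℕ.+ size x))) (while-body x t y k code) (next (while-back x t y k code) refl run₃)
      ... | t₂ , run₂ , t₂≤ with f k (while-head x t y k code) (jumped t h (while-test x t y k code) run₂)
      ... | t₁ , run₁ , t₁≤ = t₁ , run₁ , (begin
          t₁                                   ≤⟨ t₁≤ ⟩
          τ₁ ℕ.+ suc t₂                        ≤⟨ ℕₚ.+-monoʳ-≤ τ₁ (ℕ.s≤s (ℕₚ.≤-trans t₂≤ (ℕₚ.+-monoʳ-≤ τ₂ (ℕ.s≤s t₃≤)))) ⟩
          τ₁ ℕ.+ suc (τ₂ ℕ.+ suc (τ₃ ℕ.+ t₀))  ≡⟨ solve-∀ τ₁ τ₂ τ₃ t₀ ⟩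
          ((τ₁ ℕ.+ τ₂ ℕ.+ 2) ℕ.+ τ₃) ℕ.+ t₀    ∎)
        where
        open ℕₚ.≤-Reasoning
        open import Data.Nat.Solver using (module +-*-Solver)
        open +-*-Solver
        solve-∀ : ∀ a b c d → a ℕ.+ suc (b ℕ.+ suc (c ℕ.+ d)) ≡ ((a ℕ.+ b ℕ.+ 2) ℕ.+ c) ℕ.+ d
        solve-∀ = solve 4 (λ a b c d → a :+ (con 1 :+ (b :+ (con 1 :+ (c :+ d)))) := ((a :+ b :+ con 2) :+ c) :+ d) refl

      exec-≤ : ∀ {cmd s t t′ s′} → t ≤ t′ → Exec cmd s t s′ → Exec cmd s t′ s′
      exec-≤ t≤t′ f {t₀ = t₀} k code run with f k code run
      ... | t₁ , run₁ , t₁≤ = t₁ , run₁ , ℕₚ.≤-trans t₁≤ (ℕₚ.+-monoˡ-≤ t₀ t≤t′)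

    module _ {a} {Q : Store → Set a} where

      wp-≤ : ∀ {cmd t t′ s} → t ≤ t′ → wp cmd t Q s → wp cmd t′ Q s
      wp-≤ {cmd} t≤t′ (mk s′ e p q) = mk s′ (exec-≤ {cmd} t≤t′ e) p q

      wp-post : ∀ {b} {R : Store → Set b} {cmd t s} → (∀ {s′} → Preserved cmd s s′ → Q s′ → R s′) → wp cmd t Q s → wp cmd t R s
      wp-post f (mk s′ e p q) = mk s′ e p (f p q)

      wp-blk : ∀ {is b s} → Q (effs is s) → wp (blk is {b}) (length is) Q s
      wp-blk {is} {b} {s} q = mk (effs is s) (exec-blk is {b} s) (preserved-blk is {b} s) q

      wp-⨾ : ∀ {x y t t′ s} → wp x t (wp y t′ Q) s → wp (x ⨾ y) (t ℕ.+ t′) Q s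
      wp-⨾ {x} {y} (mk s₁ e p (mk s₂ e′ p′ q)) = mk s₂ (exec-⨾ {x} {y} e e′)
        (preserved-trans (preserved-⊆ (x ⨾ y) (λ f → ∨-conicalˡ _ _) p)
                         (preserved-⊆ (x ⨾ y) (λ f → ∨-conicalʳ (anyInstr f x) _) p′)) q

      wp-cond-true : ∀ {t x y τ s} → holds t s ≡ true → wp x τ Q s → wp (cond t x y) (2 ℕ.+ τ) Q s
      wp-cond-true {t} {x} {y} h (mk s′ e p q) = mk s′ (exec-cond-true {t} {x} {y} h e)
        (preserved-⊆ (cond t x y) (λ f → ∨-conicalˡ _ _) p) q

      wp-cond-false : ∀ {t x y τ s} → holds t s ≡ false → wp y τ Q s → wp (cond t x y) (2 ℕ.+ τ) Q s
      wp-cond-false {t} {x} {y} h (mk s′ e p q) = mk s′ (exec-cond-false {t} {x} {y} h e)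
        (preserved-⊆ (cond t x y) (λ f → ∨-conicalʳ (anyInstr f x) _) p) q

      wp-while-exit : ∀ {x t y τ s} → wp x τ (λ s′ → holds t s′ ≡ false × Q s′) s → wp (while x t y) (τ ℕ.+ 2) Q s
      wp-while-exit {x} {t} {y} (mk s′ e p (h , q)) = mk s′ (exec-while-exit {x} {t} {y} e h)
        (preserved-⊆ (while x t y) (λ f → ∨-conicalˡ _ _) p) q

      -- A single unrolling. Loops are verified by recursion on the data they process, which gives
      -- each iteration a time bound of its own. The 2 counts the test and the jump back.
      wp-while-again : ∀ {x t y τ₁ τ₂ τ₃ s} →
        wp x τ₁ (λ s₁ → holds t s₁ ≡ true × wp y τ₂ (wp (while x t y) τ₃ Q) s₁) s →
        wp (while x t y) ((τ₁ ℕ.+ τ₂ ℕ.+ 2) ℕ.+ τ₃) Q s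
      wp-while-again {x} {t} {y} (mk s₁ e₁ p₁ (h , mk s₂ e₂ p₂ (mk s₃ e₃ p₃ q))) =
        mk s₃ (exec-while-again {x} {t} {y} e₁ h e₂ e₃)
          (preserved-trans (preserved-⊆ (while x t y) (λ f → ∨-conicalˡ _ _) p₁)
            (preserved-trans (preserved-⊆ (while x t y) (λ f → ∨-conicalʳ (anyInstr f x) _) p₂) p₃)) q

    -- The additional step is the final `halt`.
    program-run : ∀ {a} {Q : Store → Set a} cmd {t s} → wp cmd t Q s →
                  ∃[ t′ ] ∃[ s′ ] (Run K (program cmd) (at 0 s) t′ (at (size cmd) s′) × t′ ≤ t ℕ.+ 1 × Q s′)
    program-run cmd (mk s′ exec _ q) =
      let t′ , run , t′≤ = exec 0 (codeAt-++ˡ 0 (compile cmd 0) (codeAt-all (program cmd))) (halted halts)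
      in t′ , s′ , run , t′≤ , q
      where
      halts : nth (program cmd) (size cmd) ≡ just halt
      halts = subst (λ k → nth (program cmd) k ≡ just halt) (length-compile cmd 0)
        (proj₁ (codeAt-++ʳ 0 (compile cmd 0) (codeAt-all (program cmd))))

-- The program of the scan and its popping loop.

module Prog where
  open Field
  open Hull
  open Grid
  open Machine
  open import Data.Bool.Base using (Bool; true; false; if_then_else_; T)
  open import Data.List.Base using (List; []; _∷_; _++_; length)
  open import Data.Nat.Base as ℕ using (ℕ; suc; _≤_; _<_; z≤n; s≤s)
  import Data.Nat.Properties as ℕₚ
  open import Data.Product.Base using (∃-syntax; _×_; _,_; proj₁; proj₂)
  open import Data.Unit.Base using (⊤)
  import Level
  open import Relation.Binary.PropositionalEquality using (_≡_; _≢_; refl; cong; cong₂; trans)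
  open import Relation.Nullary using (does; yes; no)
  open import Relation.Nullary.Decidable using (dec-true; dec-false)

  -- The numbers of `N` and `Root` are dictated by the registers in which the input arrives.
  N Root Tmp V Lev U As Ae Bs Be Ds De I J Base Heap L R Adr Aux Flag : Register
  N    = 0
  Root = 1
  Tmp  = 2
  V    = 3
  Lev  = 4
  U    = 5
  As   = 6
  Ae   = 7
  Bs   = 8
  Be   = 9
  Ds   = 10
  De   = 11
  I    = 12
  J    = 13
  Base = 14
  Heap = 15
  L    = 16
  R    = 17
  Adr  = 18
  Aux  = 19
  Flag = 21

  -- Scalar registers 1 and 2 hold the profit and miss probability of the point at hand,
  -- 10 and 11 those of the point of the current row.

  loadPoint : Register → List Instr
  loadPoint a = loadᶠ 1 a ∷ setᴺ Tmp 1 ∷ addᴺ Tmp Tmp a ∷ loadᶠ 2 Tmp ∷ loadᴺ L a ∷ loadᴺ R Tmp ∷ []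

  push : List Instr
  push = storeᶠ Heap 1 ∷ storeᴺ Heap L ∷ setᴺ Tmp 1 ∷ addᴺ Tmp Tmp Heap ∷ storeᶠ Tmp 2 ∷ storeᴺ Tmp R ∷
         setᴺ Tmp 2 ∷ addᴺ Heap Tmp Heap ∷ []

  -- `Heap` is the first free address, so the entry under the top starts at `Heap - 4`. It goes to
  -- registers 3 and 4, the top to 5 and 6, and the two sides of `BelowSegment` end up in 7 and 8.
  cross : List Instr
  cross = setᴺ Tmp 4 ∷ subᴺ Adr Heap Tmp ∷ loadᶠ 3 Adr ∷ setᴺ Tmp 1 ∷ addᴺ Adr Tmp Adr ∷ loadᶠ 4 Adr ∷
          addᴺ Adr Tmp Adr ∷ loadᶠ 5 Adr ∷ addᴺ Adr Tmp Adr ∷ loadᶠ 6 Adr ∷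
          subᶠ 7 5 3 ∷ subᶠ 8 6 2 ∷ mulᶠ 7 7 8 ∷ subᶠ 8 1 5 ∷ subᶠ 9 4 6 ∷ mulᶠ 8 8 9 ∷ []

  popTest popLoop insertCmd : Cmd
  popTest =
    blk (setᴺ Flag 0 ∷ setᴺ Tmp 2 ∷ addᴺ Tmp Tmp Base ∷ []) ⨾
    -- `Base + 2 < Heap` says that two points or more are on the stack; a single one must stay.
    cond (lt Tmp Heap) (blk cross ⨾ cond (le 7 8) (blk (setᴺ Flag 1 ∷ [])) skip) skip ⨾
    blk (setᴺ Tmp 0 ∷ [])
  popLoop = while popTest (lt Tmp Flag) (blk (setᴺ Tmp 2 ∷ subᴺ Heap Heap Tmp ∷ []))
  insertCmd =
    blk (setᴺ Tmp 2 ∷ subᴺ Adr Heap Tmp ∷ loadᶠ 3 Adr ∷ []) ⨾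
    cond (le 1 3) skip (popLoop ⨾ blk push)

  -- An entry of the row is computed only when it is taken, so rows are never stored. Its pointers
  -- are the addresses of the two points combined.
  takeOld takeNew : List Instr
  takeOld = loadPoint I ++ setᴺ Tmp 2 ∷ addᴺ I Tmp I ∷ []
  takeNew = loadᶠ 3 J ∷ addᶠ 1 3 10 ∷ setᴺ Tmp 1 ∷ addᴺ Tmp Tmp J ∷ loadᶠ 4 Tmp ∷ mulᶠ 2 4 11 ∷
            moveᴺ L J ∷ moveᴺ R Bs ∷ setᴺ Tmp 2 ∷ addᴺ J Tmp J ∷ []

  select scanLoop : Cmd
  select =
    cond (lt J Ae)
      (cond (lt I De)
        (blk (setᴺ Tmp 1 ∷ addᴺ Adr Tmp I ∷ loadᶠ 5 Adr ∷ addᴺ Adr Tmp J ∷ loadᶠ 4 Adr ∷ mulᶠ 6 4 11 ∷ []) ⨾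
         cond (le 6 5) (blk takeOld) (blk takeNew))
        (blk takeNew))
      -- With the row exhausted an old point must be left, since the loop test adds up what remains
      -- of both lists.
      (blk takeOld)
  scanLoop = while (blk (subᴺ Tmp De I ∷ subᴺ Adr Ae J ∷ addᴺ Adr Tmp Adr ∷ setᴺ Tmp 0 ∷ [])) (lt Tmp Adr) (select ⨾ insertCmd)

  ≔-same : ∀ {a} {A : Set a} (f : ℕ → A) i x → (f [ i ≔ x ]) i ≡ x
  ≔-same f i x rewrite dec-true (i ℕₚ.≟ i) refl = refl

  ≔-other : ∀ {a} {A : Set a} (f : ℕ → A) {i x j} → j ≢ i → (f [ i ≔ x ]) j ≡ f j
  ≔-other f {i} {x} {j} j≢i rewrite dec-false (j ℕₚ.≟ i) j≢i = refl

  -- A pop takes 25 steps for `popTest`, 2 for removing the point and 2 for the jumps of the loop.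
  popTime : ℕ
  popTime = 29

  module Programs {c ℓ₁ ℓ₂} (K : OrderedField c ℓ₁ ℓ₂) where
    open OrderedField K using (Carrier; _≤?_; _+_; _*_; _-_; 0#; 1#) renaming (_≤_ to _≤ᶠ_)
    open Hulls K
    open Grids K
    open Machines K

    ≤! : ∀ m n {_ : T (m ℕ.≤ᵇ n)} → m ≤ n
    ≤! m n {p} = ℕₚ.≤ᵇ⇒≤ m n p

    lt-true : ∀ {i j s a b} → rN s i ≡ a → rN s j ≡ b → a < b → holds (lt i j) s ≡ true
    lt-true {i} {j} {s} refl refl p = dec-true (rN s i ℕₚ.<? rN s j) p

    lt-false : ∀ {i j s a b} → rN s i ≡ a → rN s j ≡ b → b ≤ a → holds (lt i j) s ≡ false
    lt-false {i} {j} {s} refl refl p = dec-false (rN s i ℕₚ.<? rN s j) (ℕₚ.≤⇒≯ p)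

    record Agree (hi : ℕ) (s s′ : Store) : Set c where
      constructor agree
      field on : ∀ a → a < hi → mN s′ a ≡ mN s a × mF s′ a ≡ mF s a
    open Agree public

    agree-trans : ∀ {hi s s′ s″} → Agree hi s s′ → Agree hi s′ s″ → Agree hi s s″
    agree-trans p q = agree λ a a< →
      trans (proj₁ (on q a a<)) (proj₁ (on p a a<)) , trans (proj₂ (on q a a<)) (proj₂ (on p a a<))

    agree-≤ : ∀ {lo hi s s′} → lo ≤ hi → Agree hi s s′ → Agree lo s s′
    agree-≤ l p = agree λ a a< → on p a (ℕₚ.≤-trans a< l)

    agree-≡ : ∀ {hi s s′} → mN s′ ≡ mN s → mF s′ ≡ mF s → Agree hi s s′
    agree-≡ e f = agree λ a _ → cong (λ m → m a) e , cong (λ m → m a) f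

    module _ {X : Set} where

      -- The same two addresses serve in both memories: one holds the scalars of the point, the
      -- other its pointers.
      record PointAt (s : Store) (a : ℕ) (p : Point X) : Set c where
        constructor pointAt
        field
          profitᵃ : mF s a ≡ profit p
          missᵃ   : mF s (suc a) ≡ miss p
          leftᵃ   : mN s a ≡ left p
          rightᵃ  : mN s (suc a) ≡ right p
      open PointAt public

      end : ℕ → List (Point X) → ℕ
      end a []       = a
      end a (_ ∷ ps) = end (2 ℕ.+ a) ps

      Segment : Store → ℕ → List (Point X) → Set c
      Segment s a []       = Level.Lift c ⊤
      Segment s a (p ∷ ps) = PointAt s a p × Segment s (2 ℕ.+ a) ps

      -- Top of the stack first; the stack occupies the addresses from base to top.
      Stack : Store → ℕ → ℕ → List (Point X) → Set c
      Stack s base top []       = Level.Lift c (top ≡ base)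
      Stack s base top (z ∷ zs) = ∃[ b ] (top ≡ 2 ℕ.+ b × PointAt s b z × Stack s base b zs)

      Loaded : Store → Point X → Set c
      Loaded s p = rF s 1 ≡ profit p × rF s 2 ≡ miss p × rN s L ≡ left p × rN s R ≡ right p

      end-≥ : ∀ a ps → a ≤ end a ps
      end-≥ a []       = ℕₚ.≤-refl
      end-≥ a (p ∷ ps) = ℕₚ.≤-trans (ℕₚ.m≤n+m a 2) (end-≥ (2 ℕ.+ a) ps)

      stack-≥ : ∀ {s base top} zs → Stack s base top zs → base ≤ top
      stack-≥ []       (Level.lift refl)  = ℕₚ.≤-refl
      stack-≥ (z ∷ zs) (b , refl , _ , k) = ℕₚ.≤-trans (stack-≥ zs k) (ℕₚ.m≤n+m b 2)

      pointAt-agree : ∀ {s s′ a hi p} → Agree hi s s′ → 2 ℕ.+ a ≤ hi → PointAt s a p → PointAt s′ a p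
      pointAt-agree {a = a} g l (pointAt p m x y) = pointAt
        (trans (proj₂ (on g a a<)) p) (trans (proj₂ (on g (suc a) l)) m)
        (trans (proj₁ (on g a a<)) x) (trans (proj₁ (on g (suc a) l)) y)
        where a< = ℕₚ.≤-trans (ℕₚ.n≤1+n (suc a)) l

      segment-agree : ∀ {s s′ a hi} ps → Agree hi s s′ → end a ps ≤ hi → Segment s a ps → Segment s′ a ps
      segment-agree []       g l _       = _
      segment-agree {a = a} (p ∷ ps) g l (x , k) =
        pointAt-agree g (ℕₚ.≤-trans (end-≥ (2 ℕ.+ a) ps) l) x , segment-agree ps g l k

      stack-agree : ∀ {s s′ base top hi} zs → Agree hi s s′ → top ≤ hi → Stack s base top zs → Stack s′ base top zs
      stack-agree []       g l e                 = e
      stack-agree (z ∷ zs) g l (b , refl , x , k) =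
        b , refl , pointAt-agree g l x , stack-agree zs g (ℕₚ.≤-trans (ℕₚ.m≤n+m b 2) l) k

      length-pop : ∀ (p t : Point X) zs → pops p (t ∷ zs) ℕ.+ length (pop p (t ∷ zs)) ≡ suc (length zs)
      length-pop p t []       = refl
      length-pop p t (s ∷ zs) with belowSegment? s t p
      ... | yes _ = cong suc (length-pop p s zs)
      ... | no  _ = refl

    private
      bit : Bool → ℕ
      bit b = if b then 1 else 0

    module _ {X : Set} where

      private
        popTest-both : ∀ {b h base} {p t u : Point X} {s : Store} → rF s 1 ≡ profit p → rF s 2 ≡ miss p →
          rN s Base ≡ base → rN s Heap ≡ 4 ℕ.+ b → base ≤ b → PointAt s (2 ℕ.+ b) t → PointAt s b u →
          does (belowSegment? u t p) ≡ h →
          wp popTest 25 (λ s′ → rN s′ Tmp ≡ 0 × rN s′ Flag ≡ bit h) s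
        popTest-both {b} {h} {base} {p} {t} {u} {s} ep em eb eh b≥ tᵃ uᵃ eq =
          wp-⨾ (wp-blk (wp-⨾ (wp-cond-true (lt-true {Tmp} {Heap} {s₁} (cong (2 ℕ.+_) eb) eh (s≤s (s≤s (s≤s (ℕₚ.m≤n⇒m≤1+n b≥)))))
            (wp-⨾ (wp-blk (finish h (trans (cong₂ (λ x y → does (x ≤? y)) lhs rhs) eq)))))))
          where
          s₁ s₂ : Store
          s₁ = effs (setᴺ Flag 0 ∷ setᴺ Tmp 2 ∷ addᴺ Tmp Tmp Base ∷ []) s
          s₂ = effs cross s₁
          adr : rN s Heap ℕ.∸ 4 ≡ b
          adr = cong (ℕ._∸ 4) eh
          f3 : mF s (rN s Heap ℕ.∸ 4) ≡ profit u
          f3 = trans (cong (mF s) adr) (profitᵃ uᵃ)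
          f4 : mF s (suc (rN s Heap ℕ.∸ 4)) ≡ miss u
          f4 = trans (cong (λ x → mF s (suc x)) adr) (missᵃ uᵃ)
          f5 : mF s (2 ℕ.+ (rN s Heap ℕ.∸ 4)) ≡ profit t
          f5 = trans (cong (λ x → mF s (2 ℕ.+ x)) adr) (profitᵃ tᵃ)
          f6 : mF s (3 ℕ.+ (rN s Heap ℕ.∸ 4)) ≡ miss t
          f6 = trans (cong (λ x → mF s (3 ℕ.+ x)) adr) (missᵃ tᵃ)
          lhs : rF s₂ 7 ≡ (profit t - profit u) * (miss t - miss p)
          lhs = cong₂ _*_ (cong₂ _-_ f5 f3) (cong₂ _-_ f6 em)
          rhs : rF s₂ 8 ≡ (profit p - profit t) * (miss u - miss t)
          rhs = cong₂ _*_ (cong₂ _-_ ep f5) (cong₂ _-_ f4 f6)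
          finish : ∀ h → holds (le 7 8) s₂ ≡ h →
            wp (cond (le 7 8) (blk (setᴺ Flag 1 ∷ [])) skip) 3 (wp (blk (setᴺ Tmp 0 ∷ [])) 1
              (λ s′ → rN s′ Tmp ≡ 0 × rN s′ Flag ≡ bit h)) s₂
          finish true  e = wp-cond-true e (wp-blk (wp-blk (refl , refl)))
          finish false e = wp-≤ (≤! 2 3) (wp-cond-false e (wp-blk (wp-blk (refl , refl))))

        popTest-one : ∀ {base} {s : Store} → rN s Base ≡ base → rN s Heap ≡ 2 ℕ.+ base →
          wp popTest 25 (λ s′ → rN s′ Tmp ≡ 0 × rN s′ Flag ≡ 0) s
        popTest-one {s = s} eb eh = wp-≤ (≤! 6 25) (wp-⨾ (wp-blk (wp-⨾ (wp-cond-false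
          (lt-false {Tmp} {Heap} {effs (setᴺ Flag 0 ∷ setᴺ Tmp 2 ∷ addᴺ Tmp Tmp Base ∷ []) s} (cong (2 ℕ.+_) eb) eh ℕₚ.≤-refl)
          (wp-blk (wp-blk (refl , refl)))))))

      stack-kept : ∀ {s s′ : Store} {base h} {zs : List (Point X)} → rN s′ Heap ≡ h → mN s′ ≡ mN s → mF s′ ≡ mF s →
                   Stack s base h zs → Stack s′ base (rN s′ Heap) zs
      stack-kept {s} {s′} {zs = zs} refl em ef st = stack-agree zs (agree-≡ em ef) ℕₚ.≤-refl st

      abstract
        -- The failing test that ends the loop is charged like a pop, hence the `suc`.
        popLoop-wp : ∀ (p : Point X) t zs {s : Store} {base h} → rF s 1 ≡ profit p → rF s 2 ≡ miss p →
          rN s Base ≡ base → rN s Heap ≡ h → Stack s base h (t ∷ zs) →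
          wp popLoop (suc (pops p (t ∷ zs)) ℕ.* popTime) (λ s′ → Stack s′ base (rN s′ Heap) (pop p (t ∷ zs))) s
        popLoop-wp p t [] {s} {base} ep em eb refl st@(_ , eh , _ , Level.lift refl) =
          wp-≤ (≤! 27 29) (wp-while-exit (wp-post (λ {s′} pr (e , f) →
            lt-false {Tmp} {Flag} {s′} e f z≤n ,
            stack-kept {zs = t ∷ []} (Preserved.regᴺ pr Heap refl) (Preserved.memᴺ pr refl) (Preserved.memᶠ pr refl) st)
            (popTest-one {s = s} eb eh)))
        popLoop-wp p t (u ∷ zs) {s} {base} ep em eb refl st@(_ , eh , tᵃ , b , refl , uᵃ , st′) with belowSegment? u t p in eq
        ... | no  _ =
          wp-≤ (≤! 27 29) (wp-while-exit (wp-post (λ {s′} pr (e , f) →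
            lt-false {Tmp} {Flag} {s′} e f z≤n ,
            stack-kept {zs = t ∷ u ∷ zs} (Preserved.regᴺ pr Heap refl) (Preserved.memᴺ pr refl) (Preserved.memᶠ pr refl) st)
            (popTest-both {b} {false} {base} {p} {t} {u} {s} ep em eb eh (stack-≥ zs st′) tᵃ uᵃ (cong does eq))))
        ... | yes _ =
          wp-while-again (wp-post (λ {s₁} pr (e , f) →
            lt-true {Tmp} {Flag} {s₁} e f ℕₚ.≤-refl ,
            wp-blk (popLoop-wp p u zs {effs (setᴺ Tmp 2 ∷ subᴺ Heap Heap Tmp ∷ []) s₁} {base} {2 ℕ.+ b}
              (trans (Preserved.regᶠ pr 1 refl) ep) (trans (Preserved.regᶠ pr 2 refl) em)
              (trans (Preserved.regᴺ pr Base refl) eb)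
              (cong (ℕ._∸ 2) (trans (Preserved.regᴺ pr Heap refl) eh))
              (stack-agree (u ∷ zs) (agree-≡ (Preserved.memᴺ pr refl) (Preserved.memᶠ pr refl)) ℕₚ.≤-refl (b , refl , uᵃ , st′))))
            (popTest-both {b} {true} {base} {p} {t} {u} {s} ep em eb eh (stack-≥ zs st′) tᵃ uᵃ (cong does eq)))

-- Correctness and running time of one scan.

module Scan where
  open Field
  open Hull
  open Grid
  open Machine
  open Prog
  open import Data.Bool.Base using (Bool; true; false; if_then_else_)
  open import Data.Empty using (⊥)
  open import Data.List.Base using (List; []; _∷_; length)
  open import Data.Nat.Base as ℕ using (ℕ; suc; _≤_; _<_; z≤n)
  import Data.Nat.Properties as ℕₚ
  open import Data.Nat.Solver using (module +-*-Solver)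
  open import Data.Product.Base using (∃-syntax; _×_; _,_; proj₁; proj₂)
  open import Data.Unit.Base using (⊤; tt)
  import Level
  open import Relation.Binary.PropositionalEquality using (_≡_; refl; cong; cong₂; sym; trans; subst; subst₂)
  open import Relation.Nullary using (¬_; Dec; does; yes; no)
  open import Relation.Nullary.Decidable using (dec-true; dec-false)

  module _ {a} {A : Set a} (f : ℕ → A) where

    write-below : ∀ {h j} → j < h → ∀ x y → ((f [ h ≔ x ]) [ suc h ≔ y ]) j ≡ f j
    write-below {h} j<h x y = trans (≔-other (f [ h ≔ x ]) (ℕₚ.<⇒≢ (ℕₚ.m<n⇒m<1+n j<h))) (≔-other f (ℕₚ.<⇒≢ j<h))

    write-fst : ∀ h x y → ((f [ h ≔ x ]) [ suc h ≔ y ]) h ≡ x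
    write-fst h x y = trans (≔-other (f [ h ≔ x ]) {suc h} {y} {h} (ℕₚ.<⇒≢ ℕₚ.≤-refl)) (≔-same f h x)

    write-snd : ∀ h x y → ((f [ h ≔ x ]) [ suc h ≔ y ]) (suc h) ≡ y
    write-snd h x y = ≔-same (f [ h ≔ x ]) (suc h) y

  module Scans {c ℓ₁ ℓ₂} (K : OrderedField c ℓ₁ ℓ₂) where
    open OrderedField K using (Carrier; _≤?_; _+_; _*_; _-_; 0#; 1#; isDecTotalOrder) renaming (_≤_ to _≤ᶠ_)
    open FieldProperties K using (<⇒≤)
    open Hulls K
    open Grids K
    open Machines K
    open Programs K

    abstract
      push-agree : ∀ s → Agree (rN s Heap) s (effs push s)
      push-agree s = agree λ a a<h →
        write-below (mN s) a<h (rN s L) (rN s R) , write-below (mF s) a<h (rF s 1) (rF s 2)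

      push-point : ∀ {X} {p : Point X} s → Loaded s p → PointAt (effs push s) (rN s Heap) p
      push-point s (e₁ , e₂ , e₃ , e₄) = pointAt
        (trans (write-fst (mF s) (rN s Heap) (rF s 1) (rF s 2)) e₁)
        (trans (write-snd (mF s) (rN s Heap) (rF s 1) (rF s 2)) e₂)
        (trans (write-fst (mN s) (rN s Heap) (rN s L) (rN s R)) e₃)
        (trans (write-snd (mN s) (rN s Heap) (rN s L) (rN s R)) e₄)

      push-stack : ∀ {X base h} {p : Point X} {zs} s → Loaded s p → rN s Heap ≡ h → Stack s base h zs →
                   Stack (effs push s) base (2 ℕ.+ rN s Heap) (p ∷ zs)
      push-stack {p = p} {zs} s l refl st =
        rN s Heap , refl , push-point {p = p} s l , stack-agree zs (push-agree s) ℕₚ.≤-refl st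

    module _ {X : Set} where

      private
        insert-branch : Point X → Point X → List (Point X) → Bool → List (Point X)
        insert-branch p t zs b = if b then t ∷ zs else p ∷ pop p (t ∷ zs)

        stack-top : ∀ {s : Store} {base h t} {zs : List (Point X)} → Stack s base h (t ∷ zs) →
                    mF s (h ℕ.∸ 2) ≡ profit t
        stack-top (_ , refl , tᵃ , _) = profitᵃ tᵃ

      insertPops : Point X → Point X → List (Point X) → ℕ
      insertPops p t zs = if does (profit p ≤? profit t) then 0 else pops p (t ∷ zs)

      -- Every pop shortens the stack and at most one point is pushed. This is the amortisation:
      -- pops are paid for by earlier pushes.
      length-insert : ∀ (p t : Point X) zs → insertPops p t zs ℕ.+ length (insert p (t ∷ zs)) ≤ 2 ℕ.+ length zs
      length-insert p t zs with profit p ≤? profit t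
      ... | yes _ = ℕₚ.n≤1+n _
      ... | no  _ = ℕₚ.≤-reflexive (trans (ℕₚ.+-suc _ _) (cong suc (length-pop p t zs)))

      abstract
        insert-wp : ∀ (p t : Point X) zs {s base h} → Loaded s p → rN s Base ≡ base → rN s Heap ≡ h →
          Stack s base h (t ∷ zs) →
          wp insertCmd (42 ℕ.+ insertPops p t zs ℕ.* popTime)
              (λ s′ → Stack s′ base (rN s′ Heap) (insert p (t ∷ zs)) × Agree base s s′) s
        insert-wp p t zs {s} {base} {h} l@(e₁ , e₂ , e₃ , e₄) eb refl st = go (does (profit p ≤? profit t)) refl
          where
          s₁ : Store
          s₁ = effs (setᴺ Tmp 2 ∷ subᴺ Adr Heap Tmp ∷ loadᶠ 3 Adr ∷ []) s
          go : ∀ b → does (profit p ≤? profit t) ≡ b →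
            wp insertCmd (42 ℕ.+ (if b then 0 else pops p (t ∷ zs)) ℕ.* popTime)
                (λ s′ → Stack s′ base (rN s′ Heap) (insert-branch p t zs b) × Agree base s s′) s
          go true e = wp-≤ (≤! 5 42) (wp-⨾ (wp-blk (wp-cond-true
            (trans (cong₂ (λ x y → does (x ≤? y)) e₁ (stack-top st)) e) (wp-blk
            (stack-kept {s = s} {s′ = s₁} {zs = t ∷ zs} refl refl refl st , agree-≡ {s = s} {s′ = s₁} refl refl)))))
          go false e = wp-≤ (ℕₚ.≤-reflexive (solve 1 (λ x → con 5 :+ ((con 29 :+ x) :+ con 8) := con 42 :+ x) refl (pops p (t ∷ zs) ℕ.* popTime)))
              (wp-⨾ (wp-blk (wp-cond-false
                (trans (cong₂ (λ x y → does (x ≤? y)) e₁ (stack-top st)) e)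
                (wp-⨾ (wp-post (λ {s₂} pr st₂ → wp-blk
                  (push-stack {p = p} s₂ (trans (Preserved.regᶠ pr 1 refl) e₁ , trans (Preserved.regᶠ pr 2 refl) e₂ ,
                                trans (Preserved.regᴺ pr L refl) e₃ , trans (Preserved.regᴺ pr R refl) e₄) refl st₂ ,
                   agree-trans (agree-≡ {s = s} {s′ = s₂} (Preserved.memᴺ pr refl) (Preserved.memᶠ pr refl))
                     (agree-≤ (stack-≥ (pop p (t ∷ zs)) st₂) (push-agree s₂))))
                  (popLoop-wp p t zs {s₁} {base} e₁ e₂ eb refl (stack-kept {s = s} {s′ = s₁} {zs = t ∷ zs} refl refl refl st)))))))
            where open +-*-Solver

    module _ {X Y : Set} where

      record ScanState (s : Store) (ds : List (Point (X × Y))) (as : List (Point X)) (b : Point Y)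
                       (zs : List (Point (X × Y))) (base i j pb : ℕ) : Set c where
        field
          profitᵇ : rF s 10 ≡ profit b
          missᵇ   : rF s 11 ≡ miss b
          regBs   : rN s Bs ≡ pb
          regBase : rN s Base ≡ base
          regI    : rN s I ≡ i
          regDe   : rN s De ≡ end i ds
          regJ    : rN s J ≡ j
          regAe   : rN s Ae ≡ end j as
          segᵈ    : Segment s i ds
          segᵃ    : Segment s j as
          end≤ᵈ   : end i ds ≤ base
          end≤ᵃ   : end j as ≤ base
          stack   : Stack s base (rN s Heap) zs

      Scanned : List (Point (X × Y)) → List (Point (X × Y)) → List (Point (X × Y)) → ℕ → Store → Store → Set (c Level.⊔ ℓ₂)
      Scanned ds rs zs base s s′ = ∃[ zs′ ] (Scan ds rs zs zs′ × Stack s′ base (rN s′ Heap) zs′ × Agree base s s′)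

      -- Here `k` points are still to be taken and `m` are on the stack. Each of these `m + k`
      -- points is popped at most once. The 80 covers the 70 other steps of an iteration, and one
      -- further 80 the end of the loop.
      scanTime : ℕ → ℕ → ℕ
      scanTime k m = suc k ℕ.* 80 ℕ.+ (m ℕ.+ k) ℕ.* popTime

      private
        end-< : ∀ {X : Set} i (d : Point X) ds → i < end i (d ∷ ds)
        end-< i d ds = ℕₚ.≤-trans (ℕₚ.n≤1+n (suc i)) (end-≥ (2 ℕ.+ i) ds)

        Selected : Point (X × Y) → ℕ → ℕ → Store → Set c
        Selected p i j s = Loaded s p × rN s I ≡ i × rN s J ≡ j

        NonEmpty : {A : Set c} → List A → Set
        NonEmpty []      = ⊥
        NonEmpty (_ ∷ _) = ⊤

        insert-nonEmpty : ∀ (p : Point (X × Y)) t zs → NonEmpty (insert p (t ∷ zs))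
        insert-nonEmpty p t zs with profit p ≤? profit t
        ... | yes _ = tt
        ... | no  _ = tt

        iterationTime : ∀ n m k l → n ℕ.+ m ≤ 2 ℕ.+ l →
          ((4 ℕ.+ (22 ℕ.+ (42 ℕ.+ n ℕ.* popTime))) ℕ.+ 2) ℕ.+ scanTime k m ≤ scanTime (suc k) (suc l)
        iterationTime n m k l p = begin
          ((4 ℕ.+ (22 ℕ.+ (42 ℕ.+ n ℕ.* popTime))) ℕ.+ 2) ℕ.+ (suc k ℕ.* 80 ℕ.+ (m ℕ.+ k) ℕ.* popTime)
            ≡⟨ solve 4 (λ n m k l → ((con 4 :+ (con 22 :+ (con 42 :+ n :* con 29))) :+ con 2) :+ ((con 1 :+ k) :* con 80 :+ (m :+ k) :* con 29)
                 := (con 70 :+ (con 1 :+ k) :* con 80) :+ ((n :+ m) :+ k) :* con 29) refl n m k l ⟩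
          (70 ℕ.+ suc k ℕ.* 80) ℕ.+ ((n ℕ.+ m) ℕ.+ k) ℕ.* popTime
            ≤⟨ ℕₚ.+-mono-≤ (ℕₚ.+-monoˡ-≤ (suc k ℕ.* 80) (≤! 70 80)) (ℕₚ.*-monoˡ-≤ popTime (ℕₚ.+-monoˡ-≤ k p)) ⟩
          suc (suc k) ℕ.* 80 ℕ.+ (2 ℕ.+ l ℕ.+ k) ℕ.* popTime
            ≡⟨ cong (λ x → suc (suc k) ℕ.* 80 ℕ.+ x ℕ.* popTime) {2 ℕ.+ l ℕ.+ k} {suc l ℕ.+ suc k} (cong suc (sym (ℕₚ.+-suc l k))) ⟩
          scanTime (suc k) (suc l) ∎
          where
          open ℕₚ.≤-Reasoning
          open +-*-Solver

        preBlock : List Instr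
        preBlock = subᴺ Tmp De I ∷ subᴺ Adr Ae J ∷ addᴺ Adr Tmp Adr ∷ setᴺ Tmp 0 ∷ []

        module _ {s ds as b t zs base i j pb} (st : ScanState s ds as b (t ∷ zs) base i j pb) where
          open ScanState st

          old-loaded : ∀ (s′ : Store) {d} → rN s′ I ≡ i → rN s′ J ≡ j → mN s′ ≡ mN s → mF s′ ≡ mF s → PointAt s i d →
                       Selected d (2 ℕ.+ i) j (effs takeOld s′)
          old-loaded s′ refl ej refl refl (pointAt p m x y) = (p , m , x , y) , refl , ej

          new-loaded : ∀ (s′ : Store) {a} → rN s′ I ≡ i → rN s′ J ≡ j → rN s′ Bs ≡ pb → mF s′ ≡ mF s →
                       rF s′ 10 ≡ profit b → rF s′ 11 ≡ miss b → PointAt s j a →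
                       Selected (pair a b j pb) i (2 ℕ.+ j) (effs takeNew s′)
          new-loaded s′ ei refl refl refl pb mb (pointAt p m _ _) = (cong₂ _+_ p pb , cong₂ _*_ m mb , refl , refl) , ei , refl

          -- The four ways in which `scan-wp` takes a point differ only in that point and in the
          -- lists that remain; what they share is done here.
          iterate : ∀ {p i′ j′ ds′ as′ k} → 0 < (rN s De ℕ.∸ rN s I) ℕ.+ (rN s Ae ℕ.∸ rN s J) →
            wp select 22 (Selected p i′ j′) (effs preBlock s) →
            end i′ ds′ ≡ end i ds → end j′ as′ ≡ end j as → Segment s i′ ds′ → Segment s j′ as′ →
            (∀ {s₂} zs₂ → NonEmpty zs₂ → ScanState s₂ ds′ as′ b zs₂ base i′ j′ pb →
              wp scanLoop (scanTime k (length zs₂)) (Scanned ds′ (row b pb j′ as′) zs₂ base s₂) s₂) →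
            wp scanLoop (scanTime (suc k) (suc (length zs))) (Scanned ds′ (row b pb j′ as′) (insert p (t ∷ zs)) base s) s
          iterate {p} {i′} {j′} {ds′} {as′} {k} more sel ed ea sd sa rec =
            wp-≤ (iterationTime (insertPops p t zs) (length (insert p (t ∷ zs))) k (length zs) (length-insert p t zs))
              (wp-while-again {τ₁ = 4} {τ₂ = 22 ℕ.+ (42 ℕ.+ insertPops p t zs ℕ.* popTime)}
                {τ₃ = scanTime k (length (insert p (t ∷ zs)))}
                (wp-blk (lt-true {Tmp} {Adr} {s₀} refl refl more ,
                wp-⨾ (wp-post (λ {s₁} pr (l , ei , ej) →
                  let same = agree-≡ {s = s} {s′ = s₁} (Preserved.memᴺ pr refl) (Preserved.memᶠ pr refl) in
                  wp-post (λ {s₂} pr′ (st₂ , same′) →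
                    let same″ = agree-trans same same′ in
                    wp-post (λ { {s₃} _ (zs′ , scan , st₃ , same₃) → zs′ , scan , st₃ , agree-trans same″ same₃ })
                      (rec {s₂} (insert p (t ∷ zs)) (insert-nonEmpty p t zs) (record
                        { profitᵇ = trans (Preserved.regᶠ pr′ 10 refl) (trans (Preserved.regᶠ pr 10 refl) profitᵇ)
                        ; missᵇ = trans (Preserved.regᶠ pr′ 11 refl) (trans (Preserved.regᶠ pr 11 refl) missᵇ)
                        ; regBs = trans (Preserved.regᴺ pr′ Bs refl) (trans (Preserved.regᴺ pr Bs refl) regBs)
                        ; regBase = trans (Preserved.regᴺ pr′ Base refl) (trans (Preserved.regᴺ pr Base refl) regBase)
                        ; regI = trans (Preserved.regᴺ pr′ I refl) ei
                        ; regDe = trans (Preserved.regᴺ pr′ De refl) (trans (Preserved.regᴺ pr De refl) (trans regDe (sym ed)))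
                        ; regJ = trans (Preserved.regᴺ pr′ J refl) ej
                        ; regAe = trans (Preserved.regᴺ pr′ Ae refl) (trans (Preserved.regᴺ pr Ae refl) (trans regAe (sym ea)))
                        ; segᵈ = segment-agree ds′ same″ (subst (_≤ base) (sym ed) end≤ᵈ) sd
                        ; segᵃ = segment-agree as′ same″ (subst (_≤ base) (sym ea) end≤ᵃ) sa
                        ; end≤ᵈ = subst (_≤ base) (sym ed) end≤ᵈ
                        ; end≤ᵃ = subst (_≤ base) (sym ea) end≤ᵃ
                        ; stack = st₂ })))
                    (insert-wp p t zs {s₁} {base} {rN s₁ Heap} l
                      (trans (Preserved.regᴺ pr Base refl) regBase) refl
                      (subst (λ h → Stack s₁ base h (t ∷ zs)) (sym (Preserved.regᴺ pr Heap refl))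
                        (stack-agree (t ∷ zs) (agree-≡ {s = s} {s′ = s₁} (Preserved.memᴺ pr refl) (Preserved.memᶠ pr refl)) ℕₚ.≤-refl stack)))) sel))))
            where
            s₀ : Store
            s₀ = effs preBlock s

          moreᵈ : i < end i ds → 0 < (rN s De ℕ.∸ rN s I) ℕ.+ (rN s Ae ℕ.∸ rN s J)
          moreᵈ p = ℕₚ.≤-trans (ℕₚ.m<n⇒0<n∸m (subst₂ _<_ (sym regI) (sym regDe) p)) (ℕₚ.m≤m+n _ _)

          moreᵃ : j < end j as → 0 < (rN s De ℕ.∸ rN s I) ℕ.+ (rN s Ae ℕ.∸ rN s J)
          moreᵃ p = ℕₚ.≤-trans (ℕₚ.m<n⇒0<n∸m (subst₂ _<_ (sym regJ) (sym regAe) p)) (ℕₚ.m≤n+m _ _)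

          s₀ : Store
          s₀ = effs preBlock s

          finish : i ≡ end i ds → j ≡ end j as →
                   wp scanLoop 80 (λ s′ → Stack s′ base (rN s′ Heap) (t ∷ zs) × Agree base s s′) s
          finish ei ej = wp-≤ (≤! 6 80) (wp-while-exit (wp-blk (lt-false {Tmp} {Adr} {s₀} refl empty z≤n ,
            stack-kept {s = s} {s′ = s₀} {zs = t ∷ zs} refl refl refl stack , agree-≡ {s = s} {s′ = s₀} refl refl)))
            where
            empty : (rN s De ℕ.∸ rN s I) ℕ.+ (rN s Ae ℕ.∸ rN s J) ≡ 0
            empty = cong₂ ℕ._+_
              (trans (cong₂ ℕ._∸_ (trans regDe (sym ei)) regI) (ℕₚ.n∸n≡0 i))
              (trans (cong₂ ℕ._∸_ (trans regAe (sym ej)) regJ) (ℕₚ.n∸n≡0 j))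

          select-old : ∀ {d} → j ≡ end j as → PointAt s i d → wp select 22 (Selected d (2 ℕ.+ i) j) s₀
          select-old ej dᵃ = wp-≤ (≤! 10 22) (wp-cond-false (lt-false {J} {Ae} {s₀} regJ regAe (ℕₚ.≤-reflexive (sym ej)))
            (wp-blk (old-loaded s₀ regI regJ refl refl dᵃ)))

          select-new : ∀ {a} → i ≡ end i ds → j < end j as → PointAt s j a →
                       wp select 22 (Selected (pair a b j pb) i (2 ℕ.+ j)) s₀
          select-new ei j< aᵃ = wp-≤ (≤! 14 22) (wp-cond-true (lt-true {J} {Ae} {s₀} regJ regAe j<)
            (wp-cond-false (lt-false {I} {De} {s₀} regI regDe (ℕₚ.≤-reflexive (sym ei)))
              (wp-blk (new-loaded s₀ regI regJ regBs refl profitᵇ missᵇ aᵃ))))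

          module _ {d : Point (X × Y)} {a : Point X} (i< : i < end i ds) (j< : j < end j as) (dᵃ : PointAt s i d) (aᵃ : PointAt s j a) where
            private
              s₁ : Store
              s₁ = effs (setᴺ Tmp 1 ∷ addᴺ Adr Tmp I ∷ loadᶠ 5 Adr ∷ addᴺ Adr Tmp J ∷ loadᶠ 4 Adr ∷ mulᶠ 6 4 11 ∷ []) s₀
              test : holds (le 6 5) s₁ ≡ does (miss a * miss b ≤? miss d)
              test = cong₂ (λ x y → does (x ≤? y))
                (cong₂ _*_ (trans (cong (λ x → mF s (suc x)) regJ) (missᵃ aᵃ)) missᵇ)
                (trans (cong (λ x → mF s (suc x)) regI) (missᵃ dᵃ))
              enter : ∀ {p i′ j′} → wp (cond (le 6 5) (blk takeOld) (blk takeNew)) 12 (Selected p i′ j′) s₁ →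
                      wp select 22 (Selected p i′ j′) s₀
              enter w = wp-cond-true (lt-true {J} {Ae} {s₀} regJ regAe j<)
                (wp-cond-true (lt-true {I} {De} {s₀} regI regDe i<) (wp-⨾ (wp-blk w)))

            select-old′ : miss a * miss b ≤ᶠ miss d → wp select 22 (Selected d (2 ℕ.+ i) j) s₀
            select-old′ p = enter {d} {2 ℕ.+ i} {j} (wp-≤ (≤! 10 12) (wp-cond-true (trans test (dec-true (_ ≤? _) p))
              (wp-blk (old-loaded s₁ regI regJ refl refl dᵃ))))

            select-new′ : ¬ miss a * miss b ≤ᶠ miss d → wp select 22 (Selected (pair a b j pb) i (2 ℕ.+ j)) s₀
            select-new′ p = enter {pair a b j pb} {i} {2 ℕ.+ j} (wp-cond-false (trans test (dec-false (_ ≤? _) p))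
              (wp-blk (new-loaded s₁ regI regJ regBs refl profitᵇ missᵇ aᵃ)))

        after-old : ∀ {d ds rs zs base s cmd τ} → HeadBelow rs d → wp cmd τ (Scanned ds rs (insert d zs) base s) s →
                    wp cmd τ (Scanned (d ∷ ds) rs zs base s) s
        after-old h = wp-post λ { _ (zs′ , scan , rest) → zs′ , takeˡ h scan , rest }

        after-new : ∀ {r ds rs zs base s cmd τ} → HeadBelow ds r → wp cmd τ (Scanned ds rs (insert r zs) base s) s →
                    wp cmd τ (Scanned ds (r ∷ rs) zs base s) s
        after-new h = wp-post λ { _ (zs′ , scan , rest) → zs′ , takeʳ h scan , rest }

      abstract
        scan-wp : ∀ ds as b zs {s base i j pb} → NonEmpty zs → ScanState s ds as b zs base i j pb →
          wp scanLoop (scanTime (length ds ℕ.+ length as) (length zs)) (Scanned ds (row b pb j as) zs base s) s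
        scan-wp [] [] b (t ∷ zs) {s} _ st =
          wp-≤ (ℕₚ.m≤m+n 80 _) (wp-post (λ { _ (st′ , same) → t ∷ zs , done , st′ , same }) (finish st refl refl))
        scan-wp (d ∷ ds) [] b (t ∷ zs) {i = i} {j} _ st =
          after-old _ (iterate st {d} {2 ℕ.+ i} {j} {ds} {[]} {length ds ℕ.+ 0} (moreᵈ st (end-< i d ds)) (select-old st refl (proj₁ (ScanState.segᵈ st)))
            refl refl (proj₂ (ScanState.segᵈ st)) (ScanState.segᵃ st) (λ zs₂ ne st₂ → scan-wp ds [] b zs₂ ne st₂))
        scan-wp [] (a ∷ as) b (t ∷ zs) {i = i} {j} {pb} _ st =
          after-new _ (iterate st {pair a b j pb} {i} {2 ℕ.+ j} {[]} {as} {length as} (moreᵃ st (end-< j a as))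
            (select-new st refl (end-< j a as) (proj₁ (ScanState.segᵃ st)))
            refl refl (ScanState.segᵈ st) (proj₂ (ScanState.segᵃ st)) (λ zs₂ ne st₂ → scan-wp [] as b zs₂ ne st₂))
        scan-wp (d ∷ ds) (a ∷ as) b (t ∷ zs) {s} {base} {i} {j} {pb} _ st = go (miss a * miss b ≤? miss d)
            (λ zs₂ ne st₂ → scan-wp ds (a ∷ as) b zs₂ ne st₂) (λ zs₂ ne st₂ → scan-wp (d ∷ ds) as b zs₂ ne st₂)
          where
          module S = ScanState st
          go : Dec (miss a * miss b ≤ᶠ miss d) →
            (∀ {s₂} zs₂ → NonEmpty zs₂ → ScanState s₂ ds (a ∷ as) b zs₂ base (2 ℕ.+ i) j pb →
              wp scanLoop (scanTime (length ds ℕ.+ suc (length as)) (length zs₂)) (Scanned ds (row b pb j (a ∷ as)) zs₂ base s₂) s₂) →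
            (∀ {s₂} zs₂ → NonEmpty zs₂ → ScanState s₂ (d ∷ ds) as b zs₂ base i (2 ℕ.+ j) pb →
              wp scanLoop (scanTime (suc (length ds) ℕ.+ length as) (length zs₂)) (Scanned (d ∷ ds) (row b pb (2 ℕ.+ j) as) zs₂ base s₂) s₂) →
            wp scanLoop (scanTime (length (d ∷ ds) ℕ.+ length (a ∷ as)) (length (t ∷ zs)))
              (Scanned (d ∷ ds) (row b pb j (a ∷ as)) (t ∷ zs) base s) s
          go (yes p) rec _ = after-old p (iterate st {d} {2 ℕ.+ i} {j} {ds} {a ∷ as} {length ds ℕ.+ suc (length as)} (moreᵈ st (end-< i d ds))
            (select-old′ st (end-< i d ds) (end-< j a as) (proj₁ S.segᵈ) (proj₁ S.segᵃ) p)
            refl refl (proj₂ S.segᵈ) S.segᵃ rec)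
          go (no ¬p) _ rec = wp-≤ (ℕₚ.≤-reflexive (cong (λ k → scanTime k (length (t ∷ zs))) {suc (suc (length ds) ℕ.+ length as)} {suc (length ds) ℕ.+ suc (length as)} (sym (ℕₚ.+-suc (suc (length ds)) (length as)))))
            (after-new (<⇒≤ ¬p) (iterate st {pair a b j pb} {i} {2 ℕ.+ j} {d ∷ ds} {as} {suc (length ds) ℕ.+ length as} (moreᵈ st (end-< i d ds))
            (select-new′ st (end-< i d ds) (end-< j a as) (proj₁ S.segᵈ) (proj₁ S.segᵃ) ¬p)
            refl refl S.segᵈ (proj₂ S.segᵃ) rec))

-- The loop over the rows.

module Rows where
  open Hull
  open Grid
  open Machine
  open Prog
  open Scan
  open import Data.Bool.Base using (T)
  open import Data.List.Base using (List; []; _∷_; _++_; _ʳ++_; _∷ʳ_; reverse; length)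
  open import Data.List.Membership.Propositional using () renaming (_∈_ to _∈ᴸ_)
  open import Data.List.Properties using (unfold-reverse)
  open import Data.List.Relation.Unary.All as All using (All; []; _∷_)
  import Data.List.Relation.Unary.Any.Properties as Anyₚ
  open import Data.List.Relation.Unary.Any using (Any; here; there)
  open import Data.List.Relation.Unary.Linked as Linked using (Linked)
  open import Data.Nat.Base as ℕ using (ℕ; suc; _≤_; s≤s)
  import Data.Nat.Properties as ℕₚ
  open import Data.Product.Base using (∃-syntax; _×_; _,_; proj₁; proj₂)
  open import Data.Sum.Base using (_⊎_; inj₁; inj₂)
  open import Data.Unit.Base using (tt)
  open import Function.Base using (_∘_)
  import Level
  open import Relation.Binary.PropositionalEquality using (_≡_; refl; cong; cong₂; sym; trans; subst; subst₂)

  -- The new hull grows in fresh memory from `Heap` on, while the old one between `Ds` and `De` is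
  -- still being read.
  rowHead₁ rowHead₂ rowTail : List Instr
  rowHead₁ = moveᴺ Base Heap ∷ loadPoint Ds ++ push
  rowHead₂ = setᴺ Tmp 2 ∷ addᴺ I Tmp Ds ∷ moveᴺ J As ∷ loadᶠ 10 Bs ∷ setᴺ Tmp 1 ∷ addᴺ Adr Tmp Bs ∷ loadᶠ 11 Adr ∷ []
  rowTail  = moveᴺ Ds Base ∷ moveᴺ De Heap ∷ setᴺ Tmp 2 ∷ addᴺ Bs Tmp Bs ∷ []

  rowBody rowsLoop : Cmd
  rowBody  = blk rowHead₁ ⨾ blk rowHead₂ ⨾ scanLoop ⨾ blk rowTail
  rowsLoop = while skip (lt Bs Be) rowBody

  module RowLoops {c ℓ₁ ℓ₂} (K : OrderedField c ℓ₁ ℓ₂) where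
    open OrderedField K using (Carrier; _≤?_; _+_; _*_; _-_; 0#; 1#) renaming (_≤_ to _≤ᶠ_)
    open Hulls K
    open Grids K
    open Machines K
    open Programs K
    open Scans K

    module _ {X : Set} where

      -- Membership that remembers the address, so that the pointers of a pair can be traced to the
      -- points combined.
      data Located : ℕ → List (Point X) → ℕ → Point X → Set c where
        here  : ∀ {a x xs} → Located a (x ∷ xs) a x
        there : ∀ {a x xs i y} → Located (2 ℕ.+ a) xs i y → Located a (x ∷ xs) i y

      located-at : ∀ {s a xs i x} → Segment s a xs → Located a xs i x → PointAt s i x
      located-at (p , _) here      = p
      located-at (_ , s) (there l) = located-at s l

      located-≥ : ∀ {a xs i x} → Located a xs i x → a ≤ i
      located-≥ here = ℕₚ.≤-refl
      located-≥ {a} (there l) = ℕₚ.≤-trans (ℕₚ.m≤n+m a 2) (located-≥ l)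

      located-< : ∀ {a xs i x} → Located a xs i x → 2 ℕ.+ i ≤ end a xs
      located-< {xs = x ∷ xs} here = end-≥ _ xs
      located-< (there l) = located-< l

      located-∈ : ∀ {a xs i x} → Located a xs i x → x ∈ᴸ xs
      located-∈ here      = here refl
      located-∈ (there l) = there (located-∈ l)

      -- Read upwards from its base, the stack lists its points in reverse, so a finished hull
      -- already lies in memory in the order that the next row expects.
      stack⇒segment : ∀ {s base top} (zs : List (Point X)) {acc} → Stack s base top zs → Segment s top acc → Segment s base (zs ʳ++ acc)
      stack⇒segment []       (Level.lift refl)    g = g
      stack⇒segment (z ∷ zs) (b , refl , zᵃ , st) g = stack⇒segment zs st (zᵃ , g)

      stack-end : ∀ {s base top} (zs : List (Point X)) {acc} → Stack s base top zs → end base (zs ʳ++ acc) ≡ end top acc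
      stack-end []       (Level.lift refl)   = refl
      stack-end (z ∷ zs) (b , refl , _ , st) = stack-end zs st

      segment-last : ∀ {s a} (xs : List (Point X)) {t} → Segment s a (xs ∷ʳ t) → PointAt s (end a xs) t × end a (xs ∷ʳ t) ≡ 2 ℕ.+ end a xs
      segment-last []       (tᵃ , _) = tᵃ , refl
      segment-last (x ∷ xs) (_ , g)  = segment-last xs g

      -- The profit is the value at `y = 0`, so the last entry of the list at the root is the
      -- answer.
      Peak : List (Point X) → Set (c Level.⊔ ℓ₂)
      Peak ds = ∃[ xs ] ∃[ t ] (ds ≡ xs ∷ʳ t × All (λ d → profit d ≤ᶠ profit t) ds)

    module _ {X Y : Set} where

      record RowsState (s : Store) (ds : List (Point (X × Y))) (as : List (Point X)) (bs : List (Point Y)) (pa pb : ℕ) : Set c where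
        field
          d     : ℕ
          regDs : rN s Ds ≡ d
          regDe : rN s De ≡ end d ds
          segᵈ  : Segment s d ds
          end≤ᵈ : end d ds ≤ rN s Heap
          regAs : rN s As ≡ pa
          regAe : rN s Ae ≡ end pa as
          segᵃ  : Segment s pa as
          end≤ᵃ : end pa as ≤ rN s Heap
          regBs : rN s Bs ≡ pb
          regBe : rN s Be ≡ end pb bs
          segᵇ  : Segment s pb bs
          end≤ᵇ : end pb bs ≤ rN s Heap

      record Rowed (d₀ : Point (X × Y)) ds as b bs pa pb (s s′ : Store) : Set (c Level.⊔ ℓ₂) where
        field
          {zs}  : List (Point (X × Y))
          scan  : Scan ds (row b pb pa as) (d₀ ∷ []) zs
          after : RowsState s′ (reverse zs) as bs pa (2 ℕ.+ pb)
          same  : Agree (rN s Heap) s s′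
          grow  : rN s Heap ≤ rN s′ Heap
          full  : rN s′ De ≡ rN s′ Heap
          fresh : rN s′ Ds ≡ rN s Heap

      abstract
        row-wp : ∀ {d₀ ds as b bs pa pb s} → RowsState s (d₀ ∷ ds) as (b ∷ bs) pa pb →
          wp rowBody (15 ℕ.+ (7 ℕ.+ (scanTime {X} {Y} (length ds ℕ.+ length as) 1 ℕ.+ 4))) (Rowed d₀ ds as b bs pa pb s) s
        row-wp {d₀} {ds} {as} {b} {bs} {pa} {pb} {s} st =
          wp-⨾ (wp-blk (wp-⨾ (wp-blk (wp-⨾ (wp-post finish (scan-wp ds as b (d₀ ∷ []) {s₂} {h} tt (record
            { profitᵇ = trans (cong (mF s₁) S.regBs) (profitᵃ bᵃ)
            ; missᵇ = trans (cong (λ x → mF s₁ (suc x)) S.regBs) (missᵃ bᵃ)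
            ; regBs = S.regBs
            ; regBase = refl
            ; regI = cong (2 ℕ.+_) S.regDs
            ; regDe = S.regDe
            ; regJ = S.regAs
            ; regAe = S.regAe
            ; segᵈ = segment-agree ds same₂ S.end≤ᵈ (proj₂ S.segᵈ)
            ; segᵃ = segment-agree as same₂ S.end≤ᵃ S.segᵃ
            ; end≤ᵈ = S.end≤ᵈ
            ; end≤ᵃ = S.end≤ᵃ
            ; stack = stack-kept {s = s₁} {s′ = s₂} {zs = d₀ ∷ []} refl refl refl
                (push-stack {base = h} {h} {d₀} {[]} s₀ loaded refl (Level.lift refl)) })))))))
          where
          module S = RowsState st
          h : ℕ
          h = rN s Heap
          s₀ s₁ s₂ : Store
          s₀ = effs (moveᴺ Base Heap ∷ loadPoint Ds) s
          s₁ = effs push s₀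
          s₂ = effs rowHead₂ s₁
          same₁ : Agree h s s₁
          same₁ = agree-trans (agree-≡ {s = s} {s′ = s₀} refl refl) (push-agree s₀)
          same₂ : Agree h s s₂
          same₂ = agree-trans same₁ (agree-≡ {s = s₁} {s′ = s₂} refl refl)
          bᵃ : PointAt s₁ pb b
          bᵃ = pointAt-agree same₁ (ℕₚ.≤-trans (end-≥ (2 ℕ.+ pb) bs) S.end≤ᵇ) (proj₁ S.segᵇ)
          dᵃ : PointAt s (rN s Ds) d₀
          dᵃ = subst (λ x → PointAt s x d₀) (sym S.regDs) (proj₁ S.segᵈ)
          loaded : Loaded s₀ d₀
          loaded = profitᵃ dᵃ , missᵃ dᵃ , leftᵃ dᵃ , rightᵃ dᵃ
          finish : ∀ {s₃} → Preserved scanLoop s₂ s₃ → Scanned ds (row b pb pa as) (d₀ ∷ []) h s₂ s₃ →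
                   wp (blk rowTail) 4 (Rowed d₀ ds as b bs pa pb s) s₃
          finish {s₃} pr (zs , scan , stk , same₃) = wp-blk (record
            { scan = scan
            ; after = record
                { d = h
                ; regDs = Preserved.regᴺ pr Base refl
                ; regDe = sym (stack-end zs stk)
                ; segᵈ = segment-agree (reverse zs) (agree-≡ {s = s₃} {s′ = s₄} refl refl)
                           (ℕₚ.≤-reflexive (stack-end zs stk)) (stack⇒segment zs stk _)
                ; end≤ᵈ = ℕₚ.≤-reflexive (stack-end zs stk)
                ; regAs = trans (Preserved.regᴺ pr As refl) S.regAs
                ; regAe = trans (Preserved.regᴺ pr Ae refl) S.regAe
                ; segᵃ = segment-agree as same₄ S.end≤ᵃ S.segᵃ
                ; end≤ᵃ = ℕₚ.≤-trans S.end≤ᵃ grow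
                ; regBs = cong (2 ℕ.+_) (trans (Preserved.regᴺ pr Bs refl) S.regBs)
                ; regBe = trans (Preserved.regᴺ pr Be refl) S.regBe
                ; segᵇ = segment-agree bs same₄ S.end≤ᵇ (proj₂ S.segᵇ)
                ; end≤ᵇ = ℕₚ.≤-trans S.end≤ᵇ grow }
            ; same = same₄
            ; grow = grow
            ; full = refl
            ; fresh = Preserved.regᴺ pr Base refl })
            where
            s₄ : Store
            s₄ = effs rowTail s₃
            grow : h ≤ rN s₃ Heap
            grow = stack-≥ zs stk
            same₄ : Agree h s s₄
            same₄ = agree-trans same₂ (agree-trans same₃ (agree-≡ {s = s₃} {s′ = s₄} refl refl))

    module _ {X Y : Set} (pa : ℕ) (as : List (Point X)) (pb : ℕ) (bs : List (Point Y)) where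

      record Origin (d : Point (X × Y)) : Set c where
        constructor origin
        field
          {a}     : Point X
          {b}     : Point Y
          locᵃ    : Located pa as (left d) a
          locᵇ    : Located pb bs (right d) b
          choice≡ : choice d ≡ (choice a , choice b)

      row-origins : ∀ {b j} i as′ → (∀ {k x} → Located i as′ k x → Located pa as k x) → Located pb bs j b →
                    All Origin (row b j i as′)
      row-origins i []       f l = []
      row-origins i (a ∷ as′) f l = origin (f here) l refl ∷ row-origins (2 ℕ.+ i) as′ (f ∘ there) l

    module _ {X Y : Set} (rankˣ : X → ℕ) (rankʸ : Y → ℕ) {Nˣ Nʸ : ℕ} (boundˣ : ∀ x → rankˣ x ≤ Nˣ) (boundʸ : ∀ y → rankʸ y ≤ Nʸ)
             {a₀ as b₀ bs} (A : Staircase rankˣ a₀ as) (B : Staircase rankʸ b₀ bs) (pa pb₀ : ℕ)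
             {d₀ : Point (X × Y)} (profit₀ : profit d₀ ≡ profit a₀ + profit b₀) (miss₀ : miss d₀ ≡ miss a₀ * miss b₀) where

      -- The rank bound enters the running time here: a hull has at most `Nˣ + Nʸ` points besides
      -- the corner, and a row has at most `Nˣ + 1`.
      rowTime : ℕ
      rowTime = (15 ℕ.+ (7 ℕ.+ (scanTime {X} {Y} ((Nˣ ℕ.+ Nʸ) ℕ.+ suc Nˣ) 1 ℕ.+ 4))) ℕ.+ 2

      record RowsResult (s s′ : Store) : Set (c Level.⊔ ℓ₁ Level.⊔ ℓ₂) where
        field
          {ds}    : List (Point (X × Y))
          linked  : Linked (Climbs (rankᵖ rankˣ rankʸ)) (d₀ ∷ ds)
          pairs   : All (IsPair (a₀ ∷ as) (b₀ ∷ bs)) (d₀ ∷ ds)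
          origins : All (Origin pa (a₀ ∷ as) pb₀ (b₀ ∷ bs)) (d₀ ∷ ds)
          covers  : ∀ {a b y} → a ∈ᴸ a₀ ∷ as → b ∈ᴸ b₀ ∷ bs → 0# ≤ᶠ y →
                    Any (λ d → (profit a + profit b) + y * (miss a * miss b) ≤ᶠ value y d) (d₀ ∷ ds)
          peak    : Peak (d₀ ∷ ds)
          start   : rN s Heap ≤ rN s′ Ds
          stop    : rN s′ De ≡ end (rN s′ Ds) (d₀ ∷ ds)
          below   : rN s′ De ≤ rN s′ Heap
          segment : Segment s′ (rN s′ Ds) (d₀ ∷ ds)
          same    : Agree (rN s Heap) s s′

      private
        row-length-≤ : ∀ {elems covered ds} → Frontier rankˣ rankʸ (a₀ ∷ as) elems covered (d₀ ∷ ds) →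
                       length ds ℕ.+ length (a₀ ∷ as) ≤ (Nˣ ℕ.+ Nʸ) ℕ.+ suc Nˣ
        row-length-≤ {ds = ds} F = ℕₚ.+-mono-≤
          (ℕₚ.≤-pred (linked-length (rankᵖ rankˣ rankʸ ∘ choice) (Linked.map proj₂ (Frontier.linked F))
            (All.tabulate (λ {d} _ → ℕₚ.+-mono-≤ (boundˣ (proj₁ (choice d))) (boundʸ (proj₂ (choice d)))))))
          (linked-length (rankˣ ∘ choice) (Linked.map proj₂ (Staircase.linked A)) (All.tabulate (λ {a} _ → boundˣ (choice a))))

        rowTime-≤ : ∀ {k} → k ≤ (Nˣ ℕ.+ Nʸ) ℕ.+ suc Nˣ →
          (15 ℕ.+ (7 ℕ.+ (scanTime {X} {Y} k 1 ℕ.+ 4))) ≤ 15 ℕ.+ (7 ℕ.+ (scanTime {X} {Y} ((Nˣ ℕ.+ Nʸ) ℕ.+ suc Nˣ) 1 ℕ.+ 4))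
        rowTime-≤ p = ℕₚ.+-monoʳ-≤ 15 (ℕₚ.+-monoʳ-≤ 7 (ℕₚ.+-monoˡ-≤ 4
          (ℕₚ.+-mono-≤ (ℕₚ.*-monoˡ-≤ 80 (s≤s p)) (ℕₚ.*-monoˡ-≤ popTime (s≤s p)))))

        peak-reverse : ∀ {b : Point (X × Y)} zs → Convex b zs → Peak (reverse zs)
        peak-reverse (t ∷ zs) cvx = reverse zs , t , unfold-reverse t zs ,
          All.tabulate (All.lookup (top-profit zs cvx) ∘ Anyₚ.reverse⁻)

      result-from : ∀ {s s₁ s₂} → Agree (rN s Heap) s s₁ → rN s Heap ≤ rN s₁ Heap → RowsResult s₁ s₂ → RowsResult s s₂
      result-from g l r = record
        { linked = R.linked ; pairs = R.pairs ; origins = R.origins ; covers = R.covers ; peak = R.peak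
        ; start = ℕₚ.≤-trans l R.start ; stop = R.stop ; below = R.below ; segment = R.segment
        ; same = agree-trans g (agree-≤ l R.same) }
        where module R = RowsResult r

      abstract
        -- At each stage the frontier belongs to the grid of the rows in `covered`. Its ranks
        -- increase strictly, so the bound on its length is available for the cost of every row.
        rows-wp : ∀ b bs′ {covered ds s pb} →
          (∀ {b′} → b′ ∈ᴸ b ∷ bs′ → b′ ∈ᴸ b₀ ∷ bs) → (∀ {b′} → b′ ∈ᴸ covered → b′ ∈ᴸ b₀ ∷ bs) →
          (∀ {b′} → b′ ∈ᴸ b₀ ∷ bs → b′ ∈ᴸ b ∷ bs′ ⊎ b′ ∈ᴸ covered) →
          (∀ {k y} → Located pb (b ∷ bs′) k y → Located pb₀ (b₀ ∷ bs) k y) →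
          Frontier rankˣ rankʸ (a₀ ∷ as) (b ∷ covered) covered (d₀ ∷ ds) →
          All (Origin pa (a₀ ∷ as) pb₀ (b₀ ∷ bs)) (d₀ ∷ ds) →
          RowsState s (d₀ ∷ ds) (a₀ ∷ as) (b ∷ bs′) pa pb →
          wp rowsLoop (suc (length bs′) ℕ.* rowTime ℕ.+ 2) (RowsResult s) s
        rows-wp b bs′ {covered} {ds} {s} {pb} rest⊆ cov⊆ split loc F os st =
          wp-≤ (ℕₚ.≤-reflexive (sym (ℕₚ.+-assoc rowTime (length bs′ ℕ.* rowTime) 2)))
            (wp-while-again {τ₁ = 0} {τ₂ = 15 ℕ.+ (7 ℕ.+ (scanTime {X} {Y} ((Nˣ ℕ.+ Nʸ) ℕ.+ suc Nˣ) 1 ℕ.+ 4))} {τ₃ = length bs′ ℕ.* rowTime ℕ.+ 2}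
              (wp-blk (lt-true {Bs} {Be} {s} S.regBs S.regBe (ℕₚ.≤-trans (ℕₚ.n≤1+n (suc pb)) (end-≥ (2 ℕ.+ pb) bs′)) ,
                wp-post (λ {s₁} _ → continue {s₁}) (wp-≤ (rowTime-≤ (row-length-≤ F)) (row-wp {X} {Y} {d₀} {ds} {a₀ ∷ as} {b} {bs′} {pa} {pb} {s} st)))))
          where
          module S = RowsState st
          continue : ∀ {s₁} → Rowed d₀ ds (a₀ ∷ as) b bs′ pa pb s s₁ →
                     wp rowsLoop (length bs′ ℕ.* rowTime ℕ.+ 2) (RowsResult s) s₁
          continue {s₁} r = go bs′ refl
            where
            module R = Rowed r
            sub : ∀ {b′} → b′ ∈ᴸ b ∷ covered → b′ ∈ᴸ b₀ ∷ bs
            sub (here e)  = rest⊆ (here e)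
            sub (there i) = cov⊆ i
            stepped : RowResult rankˣ rankʸ A B d₀ (b ∷ covered) R.zs
            stepped = row-step rankˣ rankʸ A B profit₀ miss₀ sub F R.scan
            module T = RowResult stepped
            module F′ = Frontier T.frontier
            ds′ : List (Point (X × Y))
            ds′ = proj₁ T.bottom
            eq : reverse R.zs ≡ d₀ ∷ ds′
            eq = proj₂ T.bottom
            origins : All (Origin pa (a₀ ∷ as) pb₀ (b₀ ∷ bs)) (reverse R.zs)
            origins = All.tabulate (All.lookup (all-scan R.scan (All.tail os)
              (row-origins pa (a₀ ∷ as) pb₀ (b₀ ∷ bs) pa (a₀ ∷ as) (λ l → l) (loc here)) (All.head os ∷ [])) ∘ Anyₚ.reverse⁻)
            weaken : ∀ {bs₁ bs₂} → (∀ {b′} → b′ ∈ᴸ bs₁ → b′ ∈ᴸ bs₂) → ∀ {d : Point (X × Y)} →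
                     IsPair (a₀ ∷ as) bs₁ d → IsPair (a₀ ∷ as) bs₂ d
            weaken f (isPair a∈ b∈ p m g) = isPair a∈ (f b∈) p m g
            go : ∀ bs″ → bs″ ≡ bs′ → wp rowsLoop (length bs″ ℕ.* rowTime ℕ.+ 2) (RowsResult s) s₁
            go [] refl = wp-while-exit (wp-blk (lt-false {Bs} {Be} {s₁} S′.regBs S′.regBe ℕₚ.≤-refl , record
              { linked = subst (Linked (Climbs (rankᵖ rankˣ rankʸ))) eq F′.linked
              ; pairs = subst (All (IsPair (a₀ ∷ as) (b₀ ∷ bs))) eq (All.map (λ {d} → weaken sub {d}) F′.pairs)
              ; origins = subst (All (Origin pa (a₀ ∷ as) pb₀ (b₀ ∷ bs))) eq origins
              ; covers = λ {a} {b} {y} a∈ b∈ 0≤y → subst (Any (λ d → (profit a + profit b) + y * (miss a * miss b) ≤ᶠ value y d)) eq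
                  (F′.covers a∈ (all-covered b∈) 0≤y)
              ; peak = subst Peak eq (peak-reverse R.zs T.convex)
              ; start = ℕₚ.≤-reflexive (sym R.fresh)
              ; stop = trans S′.regDe (cong₂ end (sym S′.regDs) eq)
              ; below = ℕₚ.≤-reflexive R.full
              ; segment = subst₂ (Segment s₁) (sym S′.regDs) eq S′.segᵈ
              ; same = R.same }))
              where
              module S′ = RowsState R.after
              all-covered : ∀ {b′} → b′ ∈ᴸ b₀ ∷ bs → b′ ∈ᴸ b ∷ covered
              all-covered b∈ with split b∈
              ... | inj₁ (here e) = here e
              ... | inj₂ i        = there i
            go (b′ ∷ bs″) refl = wp-post (λ _ → result-from R.same R.grow)
              (rows-wp b′ bs″ {b ∷ covered} {ds′} {s₁} {2 ℕ.+ pb} (rest⊆ ∘ there) sub split′ (loc ∘ there)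
                (record
                  { linked = subst (Linked (Climbs (rankᵖ rankˣ rankʸ))) eq F′.linked
                  ; pairs = subst (All (IsPair (a₀ ∷ as) (b′ ∷ b ∷ covered))) eq (All.map (λ {d} → weaken there {d}) F′.pairs)
                  ; covers = λ {a} {b} {y} a∈ b∈ 0≤y → subst (Any (λ d → (profit a + profit b) + y * (miss a * miss b) ≤ᶠ value y d)) eq
                      (F′.covers a∈ b∈ 0≤y) })
                (subst (All (Origin pa (a₀ ∷ as) pb₀ (b₀ ∷ bs))) eq origins)
                (subst (λ d → RowsState s₁ d (a₀ ∷ as) (b′ ∷ bs″) pa (2 ℕ.+ pb)) eq R.after))
              where
              split′ : ∀ {b″} → b″ ∈ᴸ b₀ ∷ bs → b″ ∈ᴸ b′ ∷ bs″ ⊎ b″ ∈ᴸ b ∷ covered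
              split′ b∈ with split b∈
              ... | inj₁ (here e)  = inj₂ (here e)
              ... | inj₁ (there i) = inj₁ i
              ... | inj₂ i         = inj₂ (there i)

-- Plans of combination and the lists kept for them.

module Plan where
  open Field
  open Hull
  open Grid
  open Machine
  open Prog
  open Scan
  open Rows
  open import Data.Bool.Base using (Bool; true; false; if_then_else_)
  open import Data.Fin.Base using (Fin; toℕ)
  open import Data.List.Base using (List; []; _∷_; map; length)
  open import Data.List.Membership.Propositional using (find) renaming (_∈_ to _∈ᴸ_)
  open import Data.List.Relation.Unary.All as All using (All; []; _∷_)
  import Data.List.Relation.Unary.All.Properties as Allₚ
  open import Data.List.Relation.Unary.Any as Any using (Any; here; there)
  import Data.List.Relation.Unary.Any.Properties as Anyₚ
  open import Data.List.Relation.Unary.Linked as Linked using (Linked; []; [-]; _∷_)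
  import Data.List.Relation.Unary.Linked.Properties as Linkedₚ
  open import Data.Nat.Base as ℕ using (ℕ; suc; _≤_; _<_; z≤n)
  import Data.Nat.Properties as ℕₚ
  open import Data.Product.Base using (∃-syntax; _×_; _,_; proj₁; proj₂)
  import Level
  open import Relation.Binary.PropositionalEquality as ≡ using (_≡_; cong; cong₂; subst; subst₂)

  infixr 5 _⊗_

  -- The order in which partial solutions are combined:  edge v p  adds the edge above v.
  data Plan (n : ℕ) : Set where
    leaf : Fin n → Plan n
    edge : Fin n → Plan n → Plan n
    _⊗_  : Plan n → Plan n → Plan n

  Choice : ∀ {n} → Plan n → Set
  Choice (leaf v)   = Bool
  Choice (edge v p) = Choice p
  Choice (p ⊗ q)    = Choice p × Choice q

  leaves : ∀ {n} → Plan n → ℕ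
  leaves (leaf v)   = 1
  leaves (edge v p) = leaves p
  leaves (p ⊗ q)    = leaves p ℕ.+ leaves q

  rank : ∀ {n} (p : Plan n) → Choice p → ℕ
  rank (leaf v)   b       = if b then 1 else 0
  rank (edge v p) σ       = rank p σ
  rank (p ⊗ q)    (σ , τ) = rank p σ ℕ.+ rank q τ

  rank-≤ : ∀ {n} (p : Plan n) σ → rank p σ ≤ leaves p
  rank-≤ (leaf v)   true    = ℕₚ.≤-refl
  rank-≤ (leaf v)   false   = z≤n
  rank-≤ (edge v p) σ       = rank-≤ p σ
  rank-≤ (p ⊗ q)    (σ , τ) = ℕₚ.+-mono-≤ (rank-≤ p σ) (rank-≤ q τ)

  leaves-positive : ∀ {n} (p : Plan n) → 1 ≤ leaves p
  leaves-positive (leaf v)   = ℕₚ.≤-refl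
  leaves-positive (edge v p) = leaves-positive p
  leaves-positive (p ⊗ q)    = ℕₚ.≤-trans (leaves-positive p) (ℕₚ.m≤m+n _ _)

  -- left and right of a point are the addresses of the points it combines,
  -- or, for a leaf v, the number v and a bit.
  Denotes : ∀ {n} → (ℕ → ℕ) → ℕ → ℕ → (p : Plan n) → Choice p → ℕ → ℕ → Set
  Denotes m lo hi (leaf v)   b       l r = l ≡ toℕ v × r ≡ (if b then 1 else 0)
  Denotes m lo hi (edge v p) σ       l r = Denotes m lo hi p σ l r
  Denotes m lo hi (p ⊗ q)    (σ , τ) l r =
    (lo ≤ l × 2 ℕ.+ l ≤ hi × Denotes m lo hi p σ (m l) (m (suc l))) ×
    (lo ≤ r × 2 ℕ.+ r ≤ hi × Denotes m lo hi q τ (m r) (m (suc r)))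

  denotes-keep : ∀ {n m m′ lo hi hi′} (p : Plan n) {σ l r} → hi ≤ hi′ → (∀ a → lo ≤ a → a < hi → m′ a ≡ m a) →
                 Denotes m lo hi p σ l r → Denotes m′ lo hi′ p σ l r
  denotes-keep (leaf v)   hi≤ e d = d
  denotes-keep (edge v p) hi≤ e d = denotes-keep p hi≤ e d
  denotes-keep {m = m} {m′} {lo} {hi} {hi′} (p ⊗ q) {σ , τ} {l} {r} hi≤ e ((l≥ , l≤ , dl) , (r≥ , r≤ , dr)) =
    (l≥ , ℕₚ.≤-trans l≤ hi≤ , part p l≥ l≤ dl) , (r≥ , ℕₚ.≤-trans r≤ hi≤ , part q r≥ r≤ dr)
    where
    part : ∀ p {σ l} → lo ≤ l → 2 ℕ.+ l ≤ hi → Denotes m lo hi p σ (m l) (m (suc l)) → Denotes m′ lo hi′ p σ (m′ l) (m′ (suc l))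
    part p {σ} {l} l≥ l≤ d = subst₂ (Denotes m′ lo hi′ p σ)
      (≡.sym (e l l≥ (ℕₚ.≤-trans (ℕₚ.n≤1+n (suc l)) l≤))) (≡.sym (e (suc l) (ℕₚ.m≤n⇒m≤1+n l≥) l≤))
      (denotes-keep p hi≤ e d)

  module Plans {c ℓ₁ ℓ₂} (K : OrderedField c ℓ₁ ℓ₂) {n} (I : Instance K n) where
    open OrderedField K hiding (_≤_; sum; product)
    open OrderedField K using () renaming (_≤_ to _≤ᶠ_)
    open FieldProperties K renaming (_<_ to _<ᵏ_)
    open Hulls K
    open Grids K
    open Machines K
    open Programs K
    open Scans K
    open RowLoops K
    open Instance I

    -- Written out, `edge v` charges the weight times the probability that some chosen node of `p`
    -- requires service, which is the expected cost of the edge.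
    planProfit planMiss : (p : Plan n) → Choice p → Carrier
    planProfit (leaf v)   b       = if b then prize v * probability v else 0#
    planProfit (edge v p) σ       = (planProfit p σ + weight v * planMiss p σ) - weight v
    planProfit (p ⊗ q)    (σ , τ) = planProfit p σ + planProfit q τ
    planMiss   (leaf v)   b       = if b then 1# - probability v else 1#
    planMiss   (edge v p) σ       = planMiss p σ
    planMiss   (p ⊗ q)    (σ , τ) = planMiss p σ * planMiss q τ

    Exact : (p : Plan n) → Point (Choice p) → Set ℓ₁
    Exact p x = profit x ≈ planProfit p (choice x) × miss x ≈ planMiss p (choice x)

    CoversAll : (p : Plan n) → List (Point (Choice p)) → Set (c Level.⊔ ℓ₂)
    CoversAll p xs = ∀ σ {y} → 0# ≤ᶠ y → Any (λ x → planProfit p σ + y * planMiss p σ ≤ᶠ value y x) xs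

    record Chain (p : Plan n) (x₀ : Point (Choice p)) (xs : List (Point (Choice p))) : Set (c Level.⊔ ℓ₁ Level.⊔ ℓ₂) where
      field
        stairs : Staircase (rank p) x₀ xs
        exact  : All (Exact p) (x₀ ∷ xs)
        covers : CoversAll p (x₀ ∷ xs)

      length-≤ : length xs ≤ leaves p
      length-≤ = ℕₚ.≤-pred (linked-length (λ x → rank p (choice x)) (Linked.map proj₂ (Staircase.linked stairs))
        (All.tabulate (λ {x} _ → rank-≤ p (choice x))))

    abstract
      -- Coverage of the shifted list at `y` is coverage of the old list at `y + weight v`.
      -- Nonnegative weights keep this argument in the range where coverage is known.
      chain-shift : ∀ {v p x₀ xs} → 0# ≤ᶠ weight v → Chain p x₀ xs → Chain (edge v p) (shift (weight v) x₀) (map (shift (weight v)) xs)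
      chain-shift {v} {p} {x₀} {xs} 0≤w ch = record
        { stairs = record
            { linked = Linkedₚ.map⁺ (Staircase.linked stairs)
            ; nonNegative = Allₚ.map⁺ (Staircase.nonNegative stairs)
            ; positive = Staircase.positive stairs }
        ; exact = Allₚ.map⁺ (All.map (λ { (e , f) → +-congʳ (+-cong e (*-congˡ f)) , f }) exact)
        ; covers = λ σ {y} 0≤y → Anyₚ.map⁺ (Any.map (λ {x} → shifted σ y x) (covers σ (+-nonNegative 0≤y 0≤w))) }
        where
        open Chain ch
        w : Carrier
        w = weight v
        shifted : ∀ σ y (x : Point (Choice p)) → planProfit p σ + (y + w) * planMiss p σ ≤ᶠ value (y + w) x →
                  ((planProfit p σ + w * planMiss p σ) - w) + y * planMiss p σ ≤ᶠ value y (shift w x)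
        shifted σ y x bound = ≤-by (x≤y⇒0≤y-x bound)
          (solve 6 (λ c q c′ q′ y w →
              (((c′ :+ w :* q′) :- w) :+ y :* q′) :- (((c :+ w :* q) :- w) :+ y :* q) :=
              (c′ :+ (y :+ w) :* q′) :- (c :+ (y :+ w) :* q))
            refl (planProfit p σ) (planMiss p σ) (profit x) (miss x) y w)

      miss≤1 : ∀ v → (1# - probability v) ≤ᶠ 1#
      miss≤1 v = ≤-by (proj₁ (probability>0 v)) (solve 2 (λ o p → o :- (o :- p) := p) refl 1# (probability v))

      planMiss-nonNegative : ∀ p σ → 0# ≤ᶠ planMiss p σ
      planMiss-nonNegative (leaf v)   true    = x≤y⇒0≤y-x (probability≤1 v)
      planMiss-nonNegative (leaf v)   false   = 0≤1
      planMiss-nonNegative (edge v p) σ       = planMiss-nonNegative p σ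
      planMiss-nonNegative (p ⊗ q)    (σ , τ) = *-nonNegative (planMiss-nonNegative p σ) (planMiss-nonNegative q τ)

      -- One component is replaced at a time: the first against the fixed second one, with reward
      -- `y * Qτ`, and then the second against the new first one, with reward `y * qa`.
      exchange : ∀ {Pσ Pτ Qσ Qτ ca cb qa qb y} → Pσ + (y * Qτ) * Qσ ≤ᶠ ca + (y * Qτ) * qa →
                 Pτ + (y * qa) * Qτ ≤ᶠ cb + (y * qa) * qb → (Pσ + Pτ) + y * (Qσ * Qτ) ≤ᶠ (ca + cb) + y * (qa * qb)
      exchange {Pσ} {Pτ} {Qσ} {Qτ} {ca} {cb} {qa} {qb} {y} la lb = ≤-by (+-nonNegative (x≤y⇒0≤y-x la) (x≤y⇒0≤y-x lb))
        (trans (+-cong (+-congˡ (moved y qa qb)) (-‿cong (+-congˡ (trans (*-congˡ (*-comm Qσ Qτ)) (moved y Qτ Qσ)))))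
          (trans (solve 6 (λ Pσ Pτ ca cb Y Z → ((ca :+ cb) :+ Y) :- ((Pσ :+ Pτ) :+ Z) := (ca :- (Pσ :+ Z)) :+ ((cb :+ Y) :- Pτ)) refl
                   Pσ Pτ ca cb ((y * qa) * qb) ((y * Qτ) * Qσ))
            (trans (solve 6 (λ Pτ ca Z R cb′ U → (ca :- Z) :+ (cb′ :- Pτ) := ((ca :+ R) :- Z) :+ (cb′ :- (Pτ :+ R))) refl
                     Pτ ca (Pσ + (y * Qτ) * Qσ) ((y * Qτ) * qa) (cb + (y * qa) * qb) y)
              (+-congˡ (+-congˡ (-‿cong (+-congˡ (solve 3 (λ y q a → (y :* q) :* a := (y :* a) :* q) refl y Qτ qa))))))))
        where
        moved : ∀ y a b → y * (a * b) ≈ (y * a) * b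
        moved y a b = sym (*-assoc y a b)

      chain-⊗ : ∀ {p q a₀ as b₀ bs d₀ ds} → Chain p a₀ as → Chain q b₀ bs →
        Linked (Climbs (rank (p ⊗ q))) (d₀ ∷ ds) → All (IsPair (a₀ ∷ as) (b₀ ∷ bs)) (d₀ ∷ ds) →
        miss d₀ ≡ miss a₀ * miss b₀ →
        (∀ {a b y} → a ∈ᴸ a₀ ∷ as → b ∈ᴸ b₀ ∷ bs → 0# ≤ᶠ y →
          Any (λ d → (profit a + profit b) + y * (miss a * miss b) ≤ᶠ value y d) (d₀ ∷ ds)) →
        Chain (p ⊗ q) d₀ ds
      chain-⊗ {p} {q} {a₀} {as} {b₀} {bs} {d₀} {ds} A B linked pairs m₀ cov = record
        { stairs = record
            { linked = linked
            ; nonNegative = All.map (λ {d} → nonNeg {d}) pairs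
            ; positive = subst (0# <ᵏ_) (≡.sym m₀) (*-positive (Staircase.positive A.stairs) (Staircase.positive B.stairs)) }
        ; exact = All.map (λ {d} → exact {d}) pairs
        ; covers = covers }
        where
        module A = Chain A
        module B = Chain B
        nonNeg : ∀ {d} → IsPair (a₀ ∷ as) (b₀ ∷ bs) d → 0# ≤ᶠ miss d
        nonNeg (isPair a∈ b∈ _ m _) = subst (0# ≤ᶠ_) (≡.sym m)
          (*-nonNegative (All.lookup (Staircase.nonNegative A.stairs) a∈) (All.lookup (Staircase.nonNegative B.stairs) b∈))
        exact : ∀ {d} → IsPair (a₀ ∷ as) (b₀ ∷ bs) d → Exact (p ⊗ q) d
        exact {d} (isPair {a} {b} a∈ b∈ c m g) =
          ( trans (reflexive c) (trans (+-cong (proj₁ ea) (proj₁ eb))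
              (reflexive (cong₂ (λ σ τ → planProfit p σ + planProfit q τ) (≡.sym (cong proj₁ g)) (≡.sym (cong proj₂ g))))))
          , trans (reflexive m) (trans (*-cong (proj₂ ea) (proj₂ eb))
              (reflexive (cong₂ (λ σ τ → planMiss p σ * planMiss q τ) (≡.sym (cong proj₁ g)) (≡.sym (cong proj₂ g)))))
          where
          ea : Exact p a
          ea = All.lookup A.exact a∈
          eb : Exact q b
          eb = All.lookup B.exact b∈
        covers : CoversAll (p ⊗ q) (d₀ ∷ ds)
        covers (σ , τ) {y} 0≤y = extend (find (A.covers σ {y * planMiss q τ} (*-nonNegative 0≤y (planMiss-nonNegative q τ))))
          where
          extend : ∃[ a ] (a ∈ᴸ a₀ ∷ as × planProfit p σ + (y * planMiss q τ) * planMiss p σ ≤ᶠ value (y * planMiss q τ) a) →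
                   Any (λ d → planProfit (p ⊗ q) (σ , τ) + y * planMiss (p ⊗ q) (σ , τ) ≤ᶠ value y d) (d₀ ∷ ds)
          extend (a , a∈ , la) = combine (find (B.covers τ {y * miss a} (*-nonNegative 0≤y (All.lookup (Staircase.nonNegative A.stairs) a∈))))
            where
            combine : ∃[ b ] (b ∈ᴸ b₀ ∷ bs × planProfit q τ + (y * miss a) * planMiss q τ ≤ᶠ value (y * miss a) b) →
                      Any (λ d → planProfit (p ⊗ q) (σ , τ) + y * planMiss (p ⊗ q) (σ , τ) ≤ᶠ value y d) (d₀ ∷ ds)
            combine (b , b∈ , lb) = Any.map (≤-trans (exchange la lb)) (cov a∈ b∈ 0≤y)

      private
        leaf-nonNegative : ∀ v → 0# ≤ᶠ planMiss (leaf v) true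
        leaf-nonNegative v = x≤y⇒0≤y-x (probability≤1 v)

      -- Serving `v` would gain nothing and only lower the miss probability, so for every `y ≥ 0`
      -- the empty choice is as good.
      chain-leaf-empty : ∀ {v l r} → prize v * probability v ≤ᶠ 0# → Chain (leaf v) (point 0# 1# l r false) []
      chain-leaf-empty {v} p≤0 = record
        { stairs = record { linked = [-] ; nonNegative = 0≤1 ∷ [] ; positive = 0<1 }
        ; exact = (refl , refl) ∷ []
        ; covers = λ { false 0≤y → here ≤-refl
                     ; true {y} 0≤y → here (+-mono-≤ p≤0 (*-monoˡ-≤ 0≤y (miss≤1 v))) } }

      -- Strict positivity of the probability makes the miss probability really drop when `v` is
      -- served.
      chain-leaf-both : ∀ {v l r l′ r′} → Chain (leaf v) (point 0# 1# l r false) (point (prize v * probability v) (1# - probability v) l′ r′ true ∷ [])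
      chain-leaf-both {v} = record
        { stairs = record { linked = (miss<1 , ℕₚ.≤-refl) ∷ [-] ; nonNegative = 0≤1 ∷ leaf-nonNegative v ∷ [] ; positive = 0<1 }
        ; exact = (refl , refl) ∷ (refl , refl) ∷ []
        ; covers = λ { false 0≤y → here ≤-refl ; true 0≤y → there (here ≤-refl) } }
        where
        miss<1 : (1# - probability v) <ᵏ 1#
        miss<1 = <-by (≤∧≉⇒< (proj₁ (probability>0 v)) (proj₂ (probability>0 v)))
          (solve 2 (λ o p → o :- (o :- p) := p) refl 1# (probability v))

-- Merging the tree of a node into the tree of its parent.

module Merge where
  open Field
  open Hull
  open Grid
  open Machine
  open Prog
  open Scan
  open Rows
  open Plan
  open import Data.Fin.Base using (Fin; toℕ)
  open import Data.List.Base using (List; []; _∷_; _++_; map; length)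
  open import Data.List.Relation.Unary.All as All using (All; []; _∷_)
  import Data.List.Relation.Unary.All.Properties as Allₚ
  open import Data.List.Relation.Unary.Any using (here)
  open import Data.List.Relation.Unary.Linked using ([]; [-]; _∷_)
  open import Data.Nat.Base as ℕ using (ℕ; suc; _≤_; _<_; s≤s)
  import Data.Nat.Properties as ℕₚ
  open import Data.Nat.Solver using (module +-*-Solver)
  open import Data.Product.Base using (Σ; _×_; _,_; proj₁; proj₂)
  open import Data.Sum.Base using (inj₁)
  open import Data.Unit.Base using (tt)
  import Level
  import Data.Fin.Properties as Finₚ
  open import Relation.Binary.PropositionalEquality using (_≡_; _≢_; refl; sym; trans; cong; cong₂; subst; subst₂)
  open import Relation.Nullary using (Dec; yes; no)

  cornerLoad copyBody swap : List Instr
  cornerLoad = loadᶠ 3 As ∷ loadᶠ 4 Bs ∷ addᶠ 1 3 4 ∷ setᴺ Tmp 1 ∷ addᴺ Adr Tmp As ∷ loadᶠ 3 Adr ∷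
               addᴺ Adr Tmp Bs ∷ loadᶠ 4 Adr ∷ mulᶠ 2 3 4 ∷ moveᴺ L As ∷ moveᴺ R Bs ∷ moveᴺ Ds Heap ∷ []
  copyBody = loadPoint I ++ mulᶠ 3 12 2 ∷ addᶠ 1 1 3 ∷ subᶠ 1 1 12 ∷ push ++ setᴺ Tmp 2 ∷ addᴺ I Tmp I ∷ []
  swap = moveᴺ Tmp As ∷ moveᴺ As Bs ∷ moveᴺ Bs Tmp ∷ moveᴺ Tmp Ae ∷ moveᴺ Ae Be ∷ moveᴺ Be Tmp ∷ []

  cornerRows copyLoop combine : Cmd
  cornerRows = blk (cornerLoad ++ push ++ moveᴺ De Heap ∷ []) ⨾ rowsLoop
  copyLoop   = while skip (lt I De) (blk copyBody)
  -- Making the shorter list the list of rows keeps the cost proportional to the product of the two lengths.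
  combine    = blk (moveᴺ Be Heap ∷ subᴺ Tmp Ae As ∷ subᴺ Adr Be Bs ∷ []) ⨾ cond (lt Tmp Adr) (blk swap) skip ⨾ cornerRows

  -- The left side is the time for `m` rows. A row costs 109, which is 80 + 29, for each of
  -- `2 a + b + 2` points, and 28 besides. As the sizes are positive, `m` is at most twice either of
  -- them, so every term turns into a multiple of `a * b`; the coefficients add up to 1180.
  combineTime-≤ : ∀ a b m → 1 ≤ a → 1 ≤ b → m ≤ suc a → m ≤ suc b →
    (246 ℕ.+ 218 ℕ.* a ℕ.+ 109 ℕ.* b) ℕ.* m ℕ.+ 34 ≤ 1200 ℕ.* (a ℕ.* b)
  combineTime-≤ a b m 1≤a 1≤b m≤a m≤b = begin
    (246 ℕ.+ 218 ℕ.* a ℕ.+ 109 ℕ.* b) ℕ.* m ℕ.+ 34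
      ≡⟨ solve 3 (λ a b m → (con 246 :+ con 218 :* a :+ con 109 :* b) :* m :+ con 34
                         := con 246 :* m :+ con 218 :* (a :* m) :+ con 109 :* (m :* b) :+ con 34) refl a b m ⟩
    246 ℕ.* m ℕ.+ 218 ℕ.* (a ℕ.* m) ℕ.+ 109 ℕ.* (m ℕ.* b) ℕ.+ 34
      ≤⟨ ℕₚ.+-mono-≤ (ℕₚ.+-mono-≤ (ℕₚ.+-mono-≤ (ℕₚ.*-monoʳ-≤ 246 m≤2ab) (ℕₚ.*-monoʳ-≤ 218 (ℕₚ.*-monoʳ-≤ a m≤2b)))
                                 (ℕₚ.*-monoʳ-≤ 109 (ℕₚ.*-monoˡ-≤ b m≤2a))) (ℕₚ.*-monoʳ-≤ 34 1≤ab) ⟩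
    246 ℕ.* (2 ℕ.* (a ℕ.* b)) ℕ.+ 218 ℕ.* (a ℕ.* (2 ℕ.* b)) ℕ.+ 109 ℕ.* ((2 ℕ.* a) ℕ.* b) ℕ.+ 34 ℕ.* (a ℕ.* b)
      ≡⟨ solve 2 (λ a b → con 246 :* (con 2 :* (a :* b)) :+ con 218 :* (a :* (con 2 :* b)) :+ con 109 :* ((con 2 :* a) :* b) :+ con 34 :* (a :* b)
                       := con 1180 :* (a :* b)) refl a b ⟩
    1180 ℕ.* (a ℕ.* b)
      ≤⟨ ℕₚ.*-monoˡ-≤ (a ℕ.* b) (ℕₚ.≤ᵇ⇒≤ 1180 1200 tt) ⟩
    1200 ℕ.* (a ℕ.* b) ∎
    where
    open ℕₚ.≤-Reasoning
    open +-*-Solver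
    double : ∀ {x} → 1 ≤ x → m ≤ suc x → m ≤ 2 ℕ.* x
    double {x} 1≤x p = ℕₚ.≤-trans p (ℕₚ.≤-trans (ℕₚ.+-monoˡ-≤ x 1≤x) (ℕₚ.+-monoʳ-≤ x (ℕₚ.≤-reflexive (sym (ℕₚ.+-identityʳ x)))))
    m≤2a : m ≤ 2 ℕ.* a
    m≤2a = double 1≤a m≤a
    m≤2b : m ≤ 2 ℕ.* b
    m≤2b = double 1≤b m≤b
    1≤ab : 1 ≤ a ℕ.* b
    1≤ab = ℕₚ.*-mono-≤ 1≤a 1≤b
    m≤2ab : m ≤ 2 ℕ.* (a ℕ.* b)
    m≤2ab = ℕₚ.≤-trans m≤2b (ℕₚ.*-monoʳ-≤ 2 (ℕₚ.≤-trans (ℕₚ.≤-reflexive (sym (ℕₚ.*-identityˡ b))) (ℕₚ.*-monoˡ-≤ b 1≤a)))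

  mergeHead mergeTail : List Instr
  mergeHead = loadᴺ U V ∷ addᴺ Adr N U ∷ loadᴺ As Adr ∷ addᴺ Adr N Adr ∷ loadᴺ Ae Adr ∷
              addᴺ Adr N V ∷ loadᴺ I Adr ∷ addᴺ Adr N Adr ∷ loadᴺ De Adr ∷ loadᶠ 12 V ∷ moveᴺ Bs Heap ∷ []
  mergeTail = addᴺ Adr N U ∷ storeᴺ Adr Ds ∷ addᴺ Adr N Adr ∷ storeᴺ Adr De ∷ []

  mergeCmd : Cmd
  mergeCmd = blk mergeHead ⨾ copyLoop ⨾ combine ⨾ blk mergeTail

  module Cores {c ℓ₁ ℓ₂} (K : OrderedField c ℓ₁ ℓ₂) where
    open OrderedField K using (Carrier; _≤?_; _+_; _*_; _-_; 0#; 1#) renaming (_≤_ to _≤ᶠ_)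
    open Hulls K
    open Grids K
    open Machines K
    open Programs K
    open Scans K
    open RowLoops K

    end-+ : ∀ {X} a (xs : List (Point X)) → end a xs ≡ a ℕ.+ length xs ℕ.* 2
    end-+ a []       = sym (ℕₚ.+-identityʳ a)
    end-+ a (x ∷ xs) = trans (end-+ (2 ℕ.+ a) xs) (solve 2 (λ a l → (con 2 :+ a) :+ l := a :+ (con 2 :+ l)) refl a (length xs ℕ.* 2))
      where open +-*-Solver

    record Holds (s : Store) (i j : Register) {X : Set} (xs : List (Point X)) : Set c where
      field
        segment : Segment s (rN s i) xs
        stop    : rN s j ≡ end (rN s i) xs
        below   : rN s j ≤ rN s Heap

    module _ {X Y : Set} (rankˣ : X → ℕ) (rankʸ : Y → ℕ) {Nˣ Nʸ : ℕ} (boundˣ : ∀ x → rankˣ x ≤ Nˣ) (boundʸ : ∀ y → rankʸ y ≤ Nʸ)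
             {a₀ as b₀ bs} (A : Staircase rankˣ a₀ as) (B : Staircase rankʸ b₀ bs) where

      abstract
        cornerRows-wp : ∀ {s} → Holds s As Ae (a₀ ∷ as) → Holds s Bs Be (b₀ ∷ bs) →
          wp cornerRows (21 ℕ.+ (suc (length bs) ℕ.* rowTime rankˣ rankʸ boundˣ boundʸ A B (rN s As) (rN s Bs) {pair a₀ b₀ (rN s As) (rN s Bs)} refl refl ℕ.+ 2))
            (RowsResult rankˣ rankʸ boundˣ boundʸ A B (rN s As) (rN s Bs) {pair a₀ b₀ (rN s As) (rN s Bs)} refl refl s) s
        cornerRows-wp {s} HA HB = wp-⨾ (wp-blk (wp-post
            (λ _ → result-from rankˣ rankʸ boundˣ boundʸ A B pa pb {d₀} refl refl {s} {s₁} same (ℕₚ.m≤n+m h 2))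
            (rows-wp rankˣ rankʸ boundˣ boundʸ A B pa pb {d₀} refl refl b₀ bs {[]} {[]} {s₁} {pb} (λ i → i) (λ ()) inj₁ (λ l → l)
              (record { linked = [-] ; pairs = isPair (here refl) (here refl) refl refl refl ∷ [] ; covers = λ _ () })
              (origin here here refl ∷ [])
              (record
                { d = h ; regDs = refl ; regDe = refl
                ; segᵈ = pointAt-agree (agree-≡ {s = effs push s₀} {s′ = s₁} refl refl) ℕₚ.≤-refl (push-point {p = d₀} s₀ loaded) , _
                ; end≤ᵈ = ℕₚ.≤-refl
                ; regAs = refl ; regAe = A′.stop
                ; segᵃ = segment-agree (a₀ ∷ as) same (subst (_≤ h) A′.stop A′.below) A′.segment
                ; end≤ᵃ = ℕₚ.≤-trans (subst (_≤ h) A′.stop A′.below) (ℕₚ.m≤n+m h 2)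
                ; regBs = refl ; regBe = B′.stop
                ; segᵇ = segment-agree (b₀ ∷ bs) same (subst (_≤ h) B′.stop B′.below) B′.segment
                ; end≤ᵇ = ℕₚ.≤-trans (subst (_≤ h) B′.stop B′.below) (ℕₚ.m≤n+m h 2) }))))
          where
          module A′ = Holds HA
          module B′ = Holds HB
          h pa pb : ℕ
          h = rN s Heap
          pa = rN s As
          pb = rN s Bs
          d₀ : Point (X × Y)
          d₀ = pair a₀ b₀ pa pb
          s₀ s₁ : Store
          s₀ = effs cornerLoad s
          s₁ = effs (cornerLoad ++ push ++ moveᴺ De Heap ∷ []) s
          loaded : Loaded s₀ d₀
          loaded = cong₂ _+_ (profitᵃ (proj₁ A′.segment)) (profitᵃ (proj₁ B′.segment)) ,
                   cong₂ _*_ (missᵃ (proj₁ A′.segment)) (missᵃ (proj₁ B′.segment)) , refl , refl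
          same : Agree h s s₁
          same = agree-trans (agree-≡ {s = s} {s′ = s₀} refl refl)
            (agree-trans (push-agree s₀) (agree-≡ {s = effs push s₀} {s′ = s₁} refl refl))

    module _ {X : Set} where

      record Copied (w : Carrier) (xs : List (Point X)) (s s′ : Store) : Set c where
        field
          segment : Segment s′ (rN s Heap) (map (shift w) xs)
          stop    : rN s′ Heap ≡ end (rN s Heap) (map (shift w) xs)
          same    : Agree (rN s Heap) s s′

      abstract
        copyLoop-wp : ∀ {w} xs {s i} → rF s 12 ≡ w → rN s I ≡ i → rN s De ≡ end i xs → Segment s i xs → end i xs ≤ rN s Heap →
          wp copyLoop (length xs ℕ.* 21 ℕ.+ 2) (Copied w xs s) s
        copyLoop-wp [] {s} ew ei ed _ _ = wp-while-exit (wp-blk (lt-false {I} {De} {s} ei ed ℕₚ.≤-refl ,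
          record { segment = _ ; stop = refl ; same = agree-≡ {s = s} {s′ = s} refl refl }))
        copyLoop-wp {w} (x@(point cx qx lx rx gx) ∷ xs) {s} {i} ew refl ed (xᵃ , seg) e≤ =
          wp-while-again {τ₁ = 0} {τ₂ = 19} {τ₃ = length xs ℕ.* 21 ℕ.+ 2} (wp-blk (lt-true {I} {De} {s} refl ed
              (ℕₚ.≤-trans (ℕₚ.n≤1+n (suc i)) (end-≥ (2 ℕ.+ i) xs)) ,
            wp-blk (wp-post (λ {s″} _ r → grown r) (copyLoop-wp xs {s₁} {2 ℕ.+ i} ew refl ed
              (segment-agree xs same₁ e≤ seg) (ℕₚ.≤-trans e≤ (ℕₚ.m≤n+m (rN s Heap) 2))))))
          where
          s₀ s₁ : Store
          s₀ = effs (loadPoint I ++ mulᶠ 3 12 2 ∷ addᶠ 1 1 3 ∷ subᶠ 1 1 12 ∷ []) s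
          s₁ = effs copyBody s
          loaded : Loaded s₀ (shift w x)
          loaded = cong₂ _-_ (cong₂ _+_ (profitᵃ xᵃ) (cong₂ _*_ ew (missᵃ xᵃ))) ew , missᵃ xᵃ , leftᵃ xᵃ , rightᵃ xᵃ
          same₁ : Agree (rN s Heap) s s₁
          same₁ = agree-trans (agree-≡ {s = s} {s′ = s₀} refl refl)
            (agree-trans (push-agree s₀) (agree-≡ {s = effs push s₀} {s′ = s₁} refl refl))
          grown : ∀ {s″} → Copied w xs s₁ s″ → Copied w (x ∷ xs) s s″
          grown r = record
            { segment = pointAt-agree (agree-trans (agree-≡ {s = effs push s₀} {s′ = s₁} refl refl) R.same) ℕₚ.≤-refl
                          (push-point {p = shift w x} s₀ loaded) , R.segment
            ; stop = R.stop
            ; same = agree-trans same₁ (agree-≤ (ℕₚ.m≤n+m (rN s Heap) 2) R.same) }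
            where module R = Copied r

  module Merges {c ℓ₁ ℓ₂} (K : OrderedField c ℓ₁ ℓ₂) {n} (inst : Instance K n) where
    open OrderedField K using (Carrier; _≤?_; _+_; _*_; _-_; 0#; 1#) renaming (_≤_ to _≤ᶠ_)
    open Hulls K
    open Grids K
    open Machines K
    open Programs K
    open Scans K
    open RowLoops K
    open Cores K
    open Plans K inst

    record Held (s : Store) (lo a b : ℕ) (p : Plan n) : Set (c Level.⊔ ℓ₁ Level.⊔ ℓ₂) where
      field
        {x₀}    : Point (Choice p)
        {xs}    : List (Point (Choice p))
        chain   : Chain p x₀ xs
        segment : Segment s a (x₀ ∷ xs)
        stop    : b ≡ end a (x₀ ∷ xs)
        below   : b ≤ rN s Heap
        low     : lo ≤ a
        denotes : All (λ x → Denotes (mN s) lo (rN s Heap) p (choice x) (left x) (right x)) (x₀ ∷ xs)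

    Crowned : Store → ℕ → ℕ → ℕ → Plan n → Set (c Level.⊔ ℓ₁ Level.⊔ ℓ₂)
    Crowned s lo a b p = Σ (Held s lo a b p) λ H → Peak (Held.x₀ H ∷ Held.xs H)

    segment-keep : ∀ {X} {s s′ lo a} (xs : List (Point X)) {hi} →
      (∀ k → lo ≤ k → k < hi → mN s′ k ≡ mN s k × mF s′ k ≡ mF s k) →
      lo ≤ a → end a xs ≤ hi → Segment s a xs → Segment s′ a xs
    segment-keep []       f l e _ = _
    segment-keep {a = a} (x ∷ xs) f l e (pointAt p m x₁ x₂ , seg) =
      pointAt (trans (proj₂ (f a l a<)) p) (trans (proj₂ (f (suc a) l′ a<′)) m)
              (trans (proj₁ (f a l a<)) x₁) (trans (proj₁ (f (suc a) l′ a<′)) x₂) ,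
      segment-keep xs f (ℕₚ.≤-trans l (ℕₚ.m≤n+m a 2)) e seg
      where
      l′ = ℕₚ.m≤n⇒m≤1+n l
      a<′ = ℕₚ.≤-trans (end-≥ (2 ℕ.+ a) xs) e
      a< = ℕₚ.≤-trans (ℕₚ.n≤1+n (suc a)) a<′

    -- Agreement is asked only from `lo` up to the heap, so that the tables below `lo` may be
    -- updated.
    held-keep : ∀ {s s′ lo a b p} → (∀ k → lo ≤ k → k < rN s Heap → mN s′ k ≡ mN s k × mF s′ k ≡ mF s k) →
                rN s Heap ≤ rN s′ Heap → Held s lo a b p → Held s′ lo a b p
    held-keep {p = p} f h≤ H = record
      { chain = chain
      ; segment = segment-keep (x₀ ∷ xs) f low (subst (_≤ _) stop below) segment
      ; stop = stop
      ; below = ℕₚ.≤-trans below h≤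
      ; low = low
      ; denotes = All.map (denotes-keep p h≤ (λ k l h → proj₁ (f k l h))) denotes }
      where open Held H

    abstract
      held-⊗ : ∀ {s s′ lo p q pa ea pb eb} (A : Held s lo pa ea p) (B : Held s lo pb eb q) →
        RowsResult (rank p) (rank q) (rank-≤ p) (rank-≤ q) (Chain.stairs (Held.chain A)) (Chain.stairs (Held.chain B)) pa pb
          {pair (Held.x₀ A) (Held.x₀ B) pa pb} refl refl s s′ →
        rN s Heap ≤ rN s′ Heap × Crowned s′ lo (rN s′ Ds) (rN s′ De) (p ⊗ q)
      held-⊗ {s} {s′} {lo} {p} {q} {pa} {ea} {pb} {eb} A B R = heap≤ , (record
        { chain = chain-⊗ A.chain B.chain R.linked R.pairs refl R.covers
        ; segment = R.segment
        ; stop = R.stop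
        ; below = R.below
        ; low = ℕₚ.≤-trans A.low (ℕₚ.≤-trans (ℕₚ.≤-trans (end-≥ pa (A.x₀ ∷ A.xs)) (subst (_≤ rN s Heap) A.stop A.below)) R.start)
        ; denotes = All.map (λ {d} → denotes {d}) R.origins } , R.peak)
        where
        module A = Held A
        module B = Held B
        module R = RowsResult R
        heap≤ : rN s Heap ≤ rN s′ Heap
        heap≤ = ℕₚ.≤-trans R.start (ℕₚ.≤-trans (end-≥ (rN s′ Ds) (pair A.x₀ B.x₀ pa pb ∷ R.ds)) (subst (_≤ rN s′ Heap) R.stop R.below))
        part : ∀ {r a b} (H : Held s lo a b r) {i x} → Located a (Held.x₀ H ∷ Held.xs H) i x →
               lo ≤ i × 2 ℕ.+ i ≤ rN s′ Heap × Denotes (mN s′) lo (rN s′ Heap) r (choice x) (mN s′ i) (mN s′ (suc i))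
        part {r} H {i} {x} loc = ℕₚ.≤-trans H.low (located-≥ loc) , ℕₚ.≤-trans i≤ heap≤ ,
          subst₂ (Denotes (mN s′) lo (rN s′ Heap) r (choice x)) (sym (leftᵃ xᵃ)) (sym (rightᵃ xᵃ))
            (denotes-keep r heap≤ (λ k _ k< → proj₁ (on R.same k k<)) (All.lookup H.denotes (located-∈ loc)))
          where
          module H = Held H
          i≤ : 2 ℕ.+ i ≤ rN s Heap
          i≤ = ℕₚ.≤-trans (located-< loc) (subst (_≤ rN s Heap) H.stop H.below)
          xᵃ : PointAt s′ i x
          xᵃ = pointAt-agree R.same i≤ (located-at H.segment loc)
        denotes : ∀ {d} → Origin pa (A.x₀ ∷ A.xs) pb (B.x₀ ∷ B.xs) d →
                  Denotes (mN s′) lo (rN s′ Heap) (p ⊗ q) (choice d) (left d) (right d)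
        denotes {d} (origin {a} {b} la lb g) = subst (λ σ → Denotes (mN s′) lo (rN s′ Heap) (p ⊗ q) σ (left d) (right d)) (sym g)
          (part A la , part B lb)

    -- Which list supplies the rows depends on lengths found at run time, and the choices of `p ⊗ q`
    -- and `q ⊗ p` have different types. Hence the two outcomes are kept apart.
    data Combined (s : Store) (lo : ℕ) (p q : Plan n) : Set (c Level.⊔ ℓ₁ Level.⊔ ℓ₂) where
      straight : Crowned s lo (rN s Ds) (rN s De) (p ⊗ q) → Combined s lo p q
      swapped  : Crowned s lo (rN s Ds) (rN s De) (q ⊗ p) → Combined s lo p q

    private
      held-holds : ∀ {s lo i j p} (H : Held s lo (rN s i) (rN s j) p) → Holds s i j (Held.x₀ H ∷ Held.xs H)
      held-holds H = record { segment = segment ; stop = stop ; below = below } where open Held H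

      held-width : ∀ {s lo a b p} (H : Held s lo a b p) → b ℕ.∸ a ≡ suc (length (Held.xs H)) ℕ.* 2
      held-width {a = a} H = trans (cong (ℕ._∸ a) (trans stop (end-+ a (x₀ ∷ xs)))) (ℕₚ.m+n∸m≡n a _)
        where open Held H

      held-length : ∀ {s lo a b p} (H : Held s lo a b p) → suc (length (Held.xs H)) ≤ suc (leaves p)
      held-length H = s≤s (Chain.length-≤ (Held.chain H))

    abstract
      -- The 11 steps held back are those of `combine` ahead of `cornerRows`: 3 for the widths of
      -- the lists and 8 for the conditional swap.
      core-wp : ∀ {s lo p q} (A : Held s lo (rN s As) (rN s Ae) p) (B : Held s lo (rN s Bs) (rN s Be) q) →
        suc (length (Held.xs B)) ≤ suc (length (Held.xs A)) →
        wp cornerRows (1200 ℕ.* (leaves p ℕ.* leaves q) ℕ.∸ 11)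
          (λ s′ → Agree (rN s Heap) s s′ × rN s Heap ≤ rN s′ Heap × Crowned s′ lo (rN s′ Ds) (rN s′ De) (p ⊗ q)) s
      core-wp {s} {lo} {p} {q} A B B≤A = wp-≤ bound (wp-post (λ _ R → RowsResult.same R , held-⊗ A B R)
        (cornerRows-wp (rank p) (rank q) (rank-≤ p) (rank-≤ q) (Chain.stairs (Held.chain A)) (Chain.stairs (Held.chain B))
          (held-holds {i = As} {Ae} A) (held-holds {i = Bs} {Be} B)))
        where
        a b m : ℕ
        a = leaves p
        b = leaves q
        m = suc (length (Held.xs B))
        bound : 21 ℕ.+ (m ℕ.* ((15 ℕ.+ (7 ℕ.+ ((suc ((a ℕ.+ b) ℕ.+ suc a) ℕ.* 80 ℕ.+ (1 ℕ.+ ((a ℕ.+ b) ℕ.+ suc a)) ℕ.* 29) ℕ.+ 4))) ℕ.+ 2) ℕ.+ 2)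
                ≤ 1200 ℕ.* (a ℕ.* b) ℕ.∸ 11
        bound = ℕₚ.m+n≤o⇒m≤o∸n _ (ℕₚ.≤-trans (ℕₚ.≤-reflexive (solve 3 (λ a b m →
            (con 21 :+ (m :* ((con 15 :+ (con 7 :+ (((con 1 :+ ((a :+ b) :+ (con 1 :+ a))) :* con 80 :+ (con 1 :+ ((a :+ b) :+ (con 1 :+ a))) :* con 29) :+ con 4))) :+ con 2) :+ con 2)) :+ con 11
            := (con 246 :+ con 218 :* a :+ con 109 :* b) :* m :+ con 34) refl a b m))
          (combineTime-≤ a b m (leaves-positive p) (leaves-positive q) (ℕₚ.≤-trans B≤A (held-length A)) (held-length B)))
          where open +-*-Solver

      combine-wp : ∀ {s lo p q} → Held s lo (rN s As) (rN s Ae) p → Held s lo (rN s Bs) (rN s Heap) q →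
        wp combine (1200 ℕ.* (leaves p ℕ.* leaves q))
          (λ s′ → Agree (rN s Heap) s s′ × rN s Heap ≤ rN s′ Heap × Combined s′ lo p q) s
      combine-wp {s} {lo} {p} {q} A B = wp-≤ bound (wp-⨾ (wp-blk (wp-⨾ (decide (lenA ℕₚ.<? lenB)))))
        where
        lenA lenB : ℕ
        lenA = suc (length (Held.xs A))
        lenB = suc (length (Held.xs B))
        τ : ℕ
        τ = 1200 ℕ.* (leaves p ℕ.* leaves q) ℕ.∸ 11
        bound : 3 ℕ.+ (8 ℕ.+ τ) ≤ 1200 ℕ.* (leaves p ℕ.* leaves q)
        bound = ℕₚ.≤-reflexive (ℕₚ.m+[n∸m]≡n {11} (ℕₚ.≤-trans (≤! 11 1200)
          (ℕₚ.*-monoʳ-≤ 1200 (ℕₚ.*-mono-≤ (leaves-positive p) (leaves-positive q)))))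
        s₀ s₁ : Store
        s₀ = effs (moveᴺ Be Heap ∷ subᴺ Tmp Ae As ∷ subᴺ Adr Be Bs ∷ []) s
        s₁ = effs swap s₀
        keep₀ : ∀ {a b r} → Held s lo a b r → Held s₀ lo a b r
        keep₀ = held-keep {s} {s₀} (λ k _ _ → refl , refl) ℕₚ.≤-refl
        keep₁ : ∀ {a b r} → Held s lo a b r → Held s₁ lo a b r
        keep₁ = held-keep {s} {s₁} (λ k _ _ → refl , refl) ℕₚ.≤-refl
        Post : Store → Set (c Level.⊔ ℓ₁ Level.⊔ ℓ₂)
        Post s′ = Agree (rN s Heap) s s′ × rN s Heap ≤ rN s′ Heap × Combined s′ lo p q
        decide : Dec (lenA < lenB) → wp (cond (lt Tmp Adr) (blk swap) skip) 8 (wp cornerRows τ Post) s₀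
        decide (yes A<B) = wp-cond-true (lt-true {Tmp} {Adr} {s₀} (held-width A) (held-width B) (ℕₚ.*-monoˡ-< 2 A<B))
          (wp-blk {Q = wp cornerRows τ Post} after)
          where
          after : wp cornerRows τ Post s₁
          after = subst (λ t → wp cornerRows t Post s₁) (cong (λ x → 1200 ℕ.* x ℕ.∸ 11) (ℕₚ.*-comm (leaves q) (leaves p)))
            (wp-post (λ { {s′} _ (same , h≤ , H) → agree-trans (agree-≡ {s = s} {s′ = s₁} refl refl) same , h≤ , swapped H })
              (core-wp {s₁} {lo} {q} {p} (keep₁ B) (keep₁ A) (ℕₚ.<⇒≤ A<B)))
        decide (no A≮B) = wp-≤ (≤! 2 8) (wp-cond-false
          (lt-false {Tmp} {Adr} {s₀} (held-width A) (held-width B) (ℕₚ.*-monoˡ-≤ 2 (ℕₚ.≮⇒≥ A≮B)))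
          (wp-blk {Q = wp cornerRows τ Post} after))
          where
          after : wp cornerRows τ Post s₀
          after = wp-post (λ { {s′} _ (same , h≤ , H) → agree-trans (agree-≡ {s = s} {s′ = s₀} refl refl) same , h≤ , straight H })
            (core-wp {s₀} {lo} {p} {q} (keep₀ A) (keep₀ B) (ℕₚ.≮⇒≥ A≮B))

    crowned-keep : ∀ {s s′ lo a b p} → (∀ k → lo ≤ k → k < rN s Heap → mN s′ k ≡ mN s k × mF s′ k ≡ mF s k) →
                   rN s Heap ≤ rN s′ Heap → Crowned s lo a b p → Crowned s′ lo a b p
    crowned-keep f h≤ (H , pk) = held-keep f h≤ H , pk

    -- Below `lo`, natural memory holds four tables of length `n`: the parents, the start and the
    -- end of the list of each node, and the depths. All points lie at `lo` or above, so a pointer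
    -- is never mistaken for the number of a node.
    lo : ℕ
    lo = n ℕ.+ (n ℕ.+ (n ℕ.+ n))

    data Grafted (s : Store) (a b : ℕ) (v : Fin n) (p q : Plan n) : Set (c Level.⊔ ℓ₁ Level.⊔ ℓ₂) where
      straight : Crowned s lo a b (p ⊗ edge v q) → Grafted s a b v p q
      swapped  : Crowned s lo a b (edge v q ⊗ p) → Grafted s a b v p q

    record Merged (u v : Fin n) (p q : Plan n) (s s′ : Store) : Set (c Level.⊔ ℓ₁ Level.⊔ ℓ₂) where
      field
        grafted : Grafted s′ (mN s′ (n ℕ.+ toℕ u)) (mN s′ (n ℕ.+ (n ℕ.+ toℕ u))) v p q
        grow    : rN s Heap ≤ rN s′ Heap
        sameᴺ   : ∀ k → k < rN s Heap → k ≢ n ℕ.+ toℕ u → k ≢ n ℕ.+ (n ℕ.+ toℕ u) → mN s′ k ≡ mN s k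
        sameᶠ   : ∀ k → k < rN s Heap → mF s′ k ≡ mF s k

    open Instance inst using (weight)

    private
      -- Copies keep the pointers of the originals, and `edge v q` has the same choices as `q`; the
      -- points further down are shared.
      held-copied : ∀ {s s′ v q a b} (H : Held s lo a b q) → 0# ≤ᶠ weight v → lo ≤ rN s Heap →
        Copied (weight v) (Held.x₀ H ∷ Held.xs H) s s′ → rN s Heap ≤ rN s′ Heap × Held s′ lo (rN s Heap) (rN s′ Heap) (edge v q)
      held-copied {s} {s′} {v} {q} H 0≤w lo≤ C = h≤ , record
        { chain = chain-shift 0≤w chain
        ; segment = C.segment
        ; stop = C.stop
        ; below = ℕₚ.≤-refl
        ; low = lo≤
        ; denotes = Allₚ.map⁺ (All.map (denotes-keep q h≤ (λ k _ k< → proj₁ (on C.same k k<))) denotes) }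
        where
        open Held H
        module C = Copied C
        h≤ : rN s Heap ≤ rN s′ Heap
        h≤ = subst (rN s Heap ≤_) (sym C.stop) (end-≥ (rN s Heap) (map (shift (weight v)) (x₀ ∷ xs)))

    abstract
      -- Copying is linear in the list of `v` and thus in `leaves p * leaves q`, both factors being
      -- positive. This and the fixed overhead fit between 1200 and 1300.
      merge-wp : ∀ {s u v p q} → rN s N ≡ n → rN s V ≡ toℕ v → mN s (toℕ v) ≡ toℕ u → mF s (toℕ v) ≡ weight v →
        0# ≤ᶠ weight v → lo ≤ rN s Heap →
        Held s lo (mN s (n ℕ.+ toℕ u)) (mN s (n ℕ.+ (n ℕ.+ toℕ u))) p →
        Held s lo (mN s (n ℕ.+ toℕ v)) (mN s (n ℕ.+ (n ℕ.+ toℕ v))) q →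
        wp mergeCmd (1300 ℕ.* (leaves p ℕ.* leaves q)) (Merged u v p q s) s
      merge-wp {s} {u} {v} {p} {q} eN eV eU eW 0≤w lo≤ P Q = wp-≤ bound
        (wp-⨾ (wp-blk (wp-⨾ (wp-post (λ {s₂} pr C → afterCopy {s₂} pr C)
          (copyLoop-wp (Held.x₀ Q ∷ Held.xs Q) {s₁} {mN s (n ℕ.+ toℕ v)} eW′ eI eDe Q₁.segment (subst (_≤ rN s Heap) Q₁.stop Q₁.below))))))
        where
        s₁ : Store
        s₁ = effs mergeHead s
        eU′ : mN s (rN s V) ≡ toℕ u
        eU′ = trans (cong (mN s) eV) eU
        eW′ : mF s (rN s V) ≡ weight v
        eW′ = trans (cong (mF s) eV) eW
        eI : mN s (rN s N ℕ.+ rN s V) ≡ mN s (n ℕ.+ toℕ v)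
        eI = cong (mN s) (cong₂ ℕ._+_ eN eV)
        eAs : mN s (rN s N ℕ.+ mN s (rN s V)) ≡ mN s (n ℕ.+ toℕ u)
        eAs = cong (mN s) (cong₂ ℕ._+_ eN eU′)
        eAe : mN s (rN s N ℕ.+ (rN s N ℕ.+ mN s (rN s V))) ≡ mN s (n ℕ.+ (n ℕ.+ toℕ u))
        eAe = cong (mN s) (cong₂ ℕ._+_ eN (cong₂ ℕ._+_ eN eU′))
        Q₁ : Held s₁ lo (mN s (n ℕ.+ toℕ v)) (mN s (n ℕ.+ (n ℕ.+ toℕ v))) q
        Q₁ = held-keep {s} {s₁} (λ _ _ _ → refl , refl) ℕₚ.≤-refl Q
        module Q₁ = Held Q₁
        P₁ : Held s₁ lo (rN s₁ As) (rN s₁ Ae) p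
        P₁ = subst₂ (λ a b → Held s₁ lo a b p) (sym eAs) (sym eAe) (held-keep {s} {s₁} (λ _ _ _ → refl , refl) ℕₚ.≤-refl P)
        eDe : mN s (rN s N ℕ.+ (rN s N ℕ.+ rN s V)) ≡ end (mN s (n ℕ.+ toℕ v)) (Held.x₀ Q ∷ Held.xs Q)
        eDe = trans (cong (mN s) (cong₂ ℕ._+_ eN (cong₂ ℕ._+_ eN eV))) Q₁.stop
        bound : 11 ℕ.+ (suc (length (Held.xs Q)) ℕ.* 21 ℕ.+ 2 ℕ.+ (1200 ℕ.* (leaves p ℕ.* leaves q) ℕ.+ 4)) ≤ 1300 ℕ.* (leaves p ℕ.* leaves q)
        bound = begin
          11 ℕ.+ (suc l ℕ.* 21 ℕ.+ 2 ℕ.+ (1200 ℕ.* ab ℕ.+ 4))   ≡⟨ solve 2 (λ l x → con 11 :+ ((con 1 :+ l) :* con 21 :+ con 2 :+ (con 1200 :* x :+ con 4))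
                                                                   := con 38 :+ con 21 :* l :+ con 1200 :* x) refl l ab ⟩
          38 ℕ.+ 21 ℕ.* l ℕ.+ 1200 ℕ.* ab                        ≤⟨ ℕₚ.+-monoˡ-≤ (1200 ℕ.* ab) (ℕₚ.+-mono-≤ (ℕₚ.*-monoʳ-≤ 38 1≤ab) (ℕₚ.*-monoʳ-≤ 21 l≤ab)) ⟩
          38 ℕ.* ab ℕ.+ 21 ℕ.* ab ℕ.+ 1200 ℕ.* ab                ≡⟨ solve 1 (λ x → con 38 :* x :+ con 21 :* x :+ con 1200 :* x := con 1259 :* x) refl ab ⟩
          1259 ℕ.* ab                                            ≤⟨ ℕₚ.*-monoˡ-≤ ab (≤! 1259 1300) ⟩
          1300 ℕ.* ab                                            ∎
          where
          open ℕₚ.≤-Reasoning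
          open +-*-Solver
          l ab : ℕ
          l = length (Held.xs Q)
          ab = leaves p ℕ.* leaves q
          1≤ab : 1 ≤ ab
          1≤ab = ℕₚ.*-mono-≤ (leaves-positive p) (leaves-positive q)
          l≤ab : l ≤ ab
          l≤ab = ℕₚ.≤-trans (Chain.length-≤ (Held.chain Q)) (ℕₚ.≤-trans (ℕₚ.≤-reflexive (sym (ℕₚ.*-identityˡ (leaves q))))
                   (ℕₚ.*-monoˡ-≤ (leaves q) (leaves-positive p)))
        afterCopy : ∀ {s₂} → Preserved copyLoop s₁ s₂ → Copied (weight v) (Held.x₀ Q ∷ Held.xs Q) s₁ s₂ →
                    wp (combine ⨾ blk mergeTail) (1200 ℕ.* (leaves p ℕ.* leaves q) ℕ.+ 4) (Merged u v p q s) s₂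
        afterCopy {s₂} pr C = wp-⨾ (wp-post (λ {s₃} pr′ (same , h≤ , C′) → wp-blk (finish pr′ same h≤ C′))
            (combine-wp {s₂} {lo} {p} {edge v q} P₂ Q₂))
          where
          module C = Copied C
          heap : rN s Heap ≤ rN s₂ Heap × Held s₂ lo (rN s Heap) (rN s₂ Heap) (edge v q)
          heap = held-copied {s₁} {s₂} {v} {q} Q₁ 0≤w lo≤ C
          P₂ : Held s₂ lo (rN s₂ As) (rN s₂ Ae) p
          P₂ = subst₂ (λ a b → Held s₂ lo a b p) (sym (Preserved.regᴺ pr As refl)) (sym (Preserved.regᴺ pr Ae refl))
                 (held-keep (λ k _ k< → on C.same k k<) (proj₁ heap) P₁)
          Q₂ : Held s₂ lo (rN s₂ Bs) (rN s₂ Heap) (edge v q)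
          Q₂ = subst (λ a → Held s₂ lo a (rN s₂ Heap) (edge v q)) (sym (Preserved.regᴺ pr Bs refl)) (proj₂ heap)
          finish : ∀ {s₃} → Preserved combine s₂ s₃ → Agree (rN s₂ Heap) s₂ s₃ → rN s₂ Heap ≤ rN s₃ Heap → Combined s₃ lo p (edge v q) →
                   Merged u v p q s (effs mergeTail s₃)
          finish {s₃} pr′ same h≤ C′ = record
            { grafted = graft C′
            ; grow = ℕₚ.≤-trans (proj₁ heap) h≤
            ; sameᴺ = λ k k< ≢₁ ≢₂ → trans (untouched k ≢₁ ≢₂) (trans (proj₁ (on same k (ℕₚ.≤-trans k< (proj₁ heap)))) (proj₁ (on C.same k k<)))
            ; sameᶠ = λ k k< → trans (proj₂ (on same k (ℕₚ.≤-trans k< (proj₁ heap)))) (proj₂ (on C.same k k<)) }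
            where
            s₄ : Store
            s₄ = effs mergeTail s₃
            adr₁ : rN s₃ N ℕ.+ rN s₃ U ≡ n ℕ.+ toℕ u
            adr₁ = cong₂ ℕ._+_ (trans (Preserved.regᴺ pr′ N refl) (trans (Preserved.regᴺ pr N refl) eN))
                               (trans (Preserved.regᴺ pr′ U refl) (trans (Preserved.regᴺ pr U refl) eU′))
            adr₂ : rN s₃ N ℕ.+ (rN s₃ N ℕ.+ rN s₃ U) ≡ n ℕ.+ (n ℕ.+ toℕ u)
            adr₂ = cong₂ ℕ._+_ (trans (Preserved.regᴺ pr′ N refl) (trans (Preserved.regᴺ pr N refl) eN)) adr₁
            mem₄ : ∀ k → mN s₄ k ≡ ((mN s₃ [ n ℕ.+ toℕ u ≔ rN s₃ Ds ]) [ n ℕ.+ (n ℕ.+ toℕ u) ≔ rN s₃ De ]) k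
            mem₄ k = cong₂ (λ a b → ((mN s₃ [ a ≔ rN s₃ Ds ]) [ b ≔ rN s₃ De ]) k) adr₁ adr₂
            untouched : ∀ k → k ≢ n ℕ.+ toℕ u → k ≢ n ℕ.+ (n ℕ.+ toℕ u) → mN s₄ k ≡ mN s₃ k
            untouched k ≢₁ ≢₂ = trans (mem₄ k) (trans (≔-other (mN s₃ [ n ℕ.+ toℕ u ≔ rN s₃ Ds ]) {n ℕ.+ (n ℕ.+ toℕ u)} {rN s₃ De} {k} ≢₂) (≔-other (mN s₃) {n ℕ.+ toℕ u} {rN s₃ Ds} {k} ≢₁))
            u<n : toℕ u < n
            u<n = Finₚ.toℕ<n u
            first< : n ℕ.+ toℕ u < n ℕ.+ (n ℕ.+ toℕ u)
            first< = ℕₚ.+-monoʳ-< n (ℕₚ.≤-trans u<n (ℕₚ.m≤m+n n (toℕ u)))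
            second< : n ℕ.+ (n ℕ.+ toℕ u) < lo
            second< = ℕₚ.+-monoʳ-< n (ℕₚ.+-monoʳ-< n (ℕₚ.≤-trans u<n (ℕₚ.m≤m+n n n)))
            read₁ : mN s₄ (n ℕ.+ toℕ u) ≡ rN s₃ Ds
            read₁ = trans (mem₄ (n ℕ.+ toℕ u)) (trans (≔-other (mN s₃ [ n ℕ.+ toℕ u ≔ rN s₃ Ds ]) {n ℕ.+ (n ℕ.+ toℕ u)} {rN s₃ De} {n ℕ.+ toℕ u} (ℕₚ.<⇒≢ first<))
                      (≔-same (mN s₃) (n ℕ.+ toℕ u) (rN s₃ Ds)))
            read₂ : mN s₄ (n ℕ.+ (n ℕ.+ toℕ u)) ≡ rN s₃ De
            read₂ = trans (mem₄ (n ℕ.+ (n ℕ.+ toℕ u))) (≔-same (mN s₃ [ n ℕ.+ toℕ u ≔ rN s₃ Ds ]) (n ℕ.+ (n ℕ.+ toℕ u)) (rN s₃ De))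
            store-keep : ∀ {r} → Crowned s₃ lo (rN s₃ Ds) (rN s₃ De) r → Crowned s₄ lo (mN s₄ (n ℕ.+ toℕ u)) (mN s₄ (n ℕ.+ (n ℕ.+ toℕ u))) r
            store-keep {r} H = subst₂ (λ a b → Crowned s₄ lo a b r) (sym read₁) (sym read₂)
              (crowned-keep {s₃} {s₄} (λ k lo≤k _ → untouched k (ℕₚ.>⇒≢ (ℕₚ.≤-trans (ℕₚ.<-trans first< second<) lo≤k)) (ℕₚ.>⇒≢ (ℕₚ.≤-trans second< lo≤k)) , refl)
                ℕₚ.≤-refl H)
            graft : Combined s₃ lo p (edge v q) → Grafted s₄ (mN s₄ (n ℕ.+ toℕ u)) (mN s₄ (n ℕ.+ (n ℕ.+ toℕ u))) v p q
            graft (straight H) = straight (store-keep H)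
            graft (swapped H)  = swapped (store-keep H)

-- Depths in a rooted tree and sums over its nodes.

module Tree where
  open import Data.Bool.Base using (if_then_else_)
  open import Data.Empty using (⊥-elim)
  open import Data.Fin.Base as Fin using (Fin; toℕ)
  import Data.Fin.Properties as Finₚ
  open import Data.Nat.Base using (ℕ; zero; suc; _≤_; _<_; z≤n; s≤s; _+_; _*_)
  import Data.Nat.Properties as ℕₚ
  open import Data.Nat.GeneralisedArithmetic using (iterate)
  open import Data.Nat.Solver using (module +-*-Solver)
  open import Data.Product.Base using (∃-syntax; _×_; _,_; proj₁; proj₂)
  open import Function.Base using (_∘_)
  open import Relation.Binary.PropositionalEquality as ≡ using (_≡_; _≢_; refl; sym; trans; cong; cong₂; subst)
  open import Relation.Nullary using (¬_; yes; no; does)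
  open import Relation.Nullary.Decidable using (dec-true; dec-false)

  module Depths {n} (tree : RootedTree n) where
    open RootedTree tree

    private
      -- The first argument is fuel, taken from `reachesRoot`; by `go-≡` any sufficient amount gives
      -- the same depth.
      go : ℕ → Fin n → ℕ
      go zero    v = 0
      go (suc k) v with v Finₚ.≟ root
      ... | yes _ = 0
      ... | no  _ = suc (go k (parent v))

      go-≡ : ∀ k l v → iterate parent v k ≡ root → iterate parent v l ≡ root → go k v ≡ go l v
      go-≡ zero    zero    v p q = refl
      go-≡ zero    (suc l) v p q with v Finₚ.≟ root
      ... | yes _ = refl
      ... | no ≢r = ⊥-elim (≢r p)
      go-≡ (suc k) zero    v p q with v Finₚ.≟ root
      ... | yes _ = refl
      ... | no ≢r = ⊥-elim (≢r q)
      go-≡ (suc k) (suc l) v p q with v Finₚ.≟ root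
      ... | yes _ = refl
      ... | no  _ = cong suc (go-≡ k l (parent v) p q)

    depth : Fin n → ℕ
    depth v = go (proj₁ (reachesRoot v)) v

    depth-root : depth root ≡ 0
    depth-root with proj₁ (reachesRoot root)
    ... | zero = refl
    ... | suc k with root Finₚ.≟ root
    ...   | yes _ = refl
    ...   | no ≢r = ⊥-elim (≢r refl)

    depth-suc : ∀ {v} → v ≢ root → depth v ≡ suc (depth (parent v))
    depth-suc {v} ≢r = trans (lemma (proj₁ (reachesRoot v)) (proj₂ (reachesRoot v))) refl
      where
      lemma : ∀ k → iterate parent v k ≡ root → go k v ≡ suc (depth (parent v))
      lemma zero    p = ⊥-elim (≢r p)
      lemma (suc k) p with v Finₚ.≟ root
      ... | yes e = ⊥-elim (≢r e)
      ... | no  _ = cong suc (go-≡ k (proj₁ (reachesRoot (parent v))) (parent v) p (proj₂ (reachesRoot (parent v))))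

    depth≡0⇒root : ∀ {v} → depth v ≡ 0 → v ≡ root
    depth≡0⇒root {v} e with v Finₚ.≟ root
    ... | yes v≡r = v≡r
    ... | no  v≢r with trans (sym e) (depth-suc v≢r)
    ...   | ()

    positive⇒≢root : ∀ {v} → 1 ≤ depth v → v ≢ root
    positive⇒≢root 1≤ refl with subst (1 ≤_) depth-root 1≤
    ... | ()

    depth-iterate : ∀ k {v} → k ≤ depth v → depth (iterate parent v k) + k ≡ depth v
    depth-iterate zero    {v} _ = ℕₚ.+-identityʳ _
    depth-iterate (suc k) {v} k< = trans (ℕₚ.+-suc _ k) (trans (cong suc (depth-iterate k
      (ℕₚ.≤-pred (subst (suc k ≤_) e k<)))) (sym e))
      where
      e : depth v ≡ suc (depth (parent v))
      e = depth-suc (positive⇒≢root (ℕₚ.≤-trans (s≤s z≤n) k<))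

    depth-iterate-≤ : ∀ k v → depth (iterate parent v k) ≤ depth v
    depth-iterate-≤ zero    v = ℕₚ.≤-refl
    depth-iterate-≤ (suc k) v with v Finₚ.≟ root
    ... | yes refl = ℕₚ.≤-trans (depth-iterate-≤ k (parent v)) (ℕₚ.≤-reflexive (cong depth parent-root))
    ... | no  v≢r  = ℕₚ.≤-trans (depth-iterate-≤ k (parent v)) (ℕₚ.≤-trans (ℕₚ.n≤1+n _) (ℕₚ.≤-reflexive (sym (depth-suc v≢r))))

    -- On the way to the root the depth falls with each step, so a node deeper than `n` would have
    -- `n + 1` different nodes on its path.
    depth-≤ : ∀ v → depth v ≤ n
    depth-≤ v with depth v ℕₚ.≤? n
    ... | yes p = p
    ... | no ¬p = ⊥-elim (distinct (Finₚ.pigeonhole (ℕₚ.n<1+n n) (λ i → iterate parent v (toℕ i))))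
      where
      n<d : n < depth v
      n<d = ℕₚ.≰⇒> ¬p
      distinct : ¬ (∃[ i ] ∃[ j ] (i Fin.< j × iterate parent v (toℕ i) ≡ iterate parent v (toℕ j)))
      distinct (i , j , i<j , e) = ℕₚ.<⇒≢ i<j (ℕₚ.+-cancelˡ-≡ (depth (iterate parent v (toℕ i))) _ _
        (trans (depth-iterate (toℕ i) (bound i)) (trans (sym (depth-iterate (toℕ j) (bound j))) (cong (λ u → depth u + toℕ j) (sym e)))))
        where
        bound : ∀ (k : Fin (suc n)) → toℕ k ≤ depth v
        bound k = ℕₚ.≤-trans (ℕₚ.≤-pred (Finₚ.toℕ<n k)) (ℕₚ.<⇒≤ n<d)

    -- A positive depth of `u` keeps the walk away from the root, where it could linger for any
    -- number of steps.
    depth-<-iterate : ∀ k {v u} → iterate parent v k ≡ u → 1 ≤ depth u → depth v ≡ depth u + k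
    depth-<-iterate zero    refl _ = sym (ℕₚ.+-identityʳ _)
    depth-<-iterate (suc k) {v} {u} e 1≤ = trans (depth-suc v≢r) (trans (cong suc (depth-<-iterate k e 1≤)) (sym (ℕₚ.+-suc _ k)))
      where
      v≢r : v ≢ root
      v≢r refl = ℕₚ.n≮0 (ℕₚ.≤-trans 1≤ (ℕₚ.≤-trans (ℕₚ.≤-reflexive (cong depth (sym e)))
        (ℕₚ.≤-trans (depth-iterate-≤ (suc k) root) (ℕₚ.≤-reflexive depth-root))))

  iterate-+ : ∀ {a} {A : Set a} (f : A → A) x i j → iterate f x (i + j) ≡ iterate f (iterate f x i) j
  iterate-+ f x zero    j = refl
  iterate-+ f x (suc i) j = iterate-+ f (f x) i j

  iterate-suc : ∀ {a} {A : Set a} (f : A → A) x i → iterate f x (suc i) ≡ f (iterate f x i)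
  iterate-suc f x zero    = refl
  iterate-suc f x (suc i) = iterate-suc f (f x) i

  total : ∀ {n} → (Fin n → ℕ) → ℕ
  total {zero}  f = 0
  total {suc n} f = f Fin.zero + total (f ∘ Fin.suc)

  _⟨_⟩≔_ : ∀ {a} {A : Set a} {n} → (Fin n → A) → Fin n → A → Fin n → A
  (f ⟨ u ⟩≔ x) z = if does (z Finₚ.≟ u) then x else f z

  ⟨⟩≔-same : ∀ {a} {A : Set a} {n} (f : Fin n → A) u x → (f ⟨ u ⟩≔ x) u ≡ x
  ⟨⟩≔-same f u x rewrite dec-true (u Finₚ.≟ u) refl = refl

  ⟨⟩≔-other : ∀ {a} {A : Set a} {n} (f : Fin n → A) {u x z} → z ≢ u → (f ⟨ u ⟩≔ x) z ≡ f z
  ⟨⟩≔-other f {u} {x} {z} z≢u rewrite dec-false (z Finₚ.≟ u) z≢u = refl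

  total-cong : ∀ {n} {f g : Fin n → ℕ} → (∀ z → f z ≡ g z) → total f ≡ total g
  total-cong {zero}  e = refl
  total-cong {suc n} e = cong₂ _+_ (e Fin.zero) (total-cong (e ∘ Fin.suc))

  -- Having sums on both sides avoids truncated subtraction. With the identity and the square as
  -- `h`, it follows the sizes and their squares through a merge.
  total-update : ∀ {n} (h : ℕ → ℕ) (f : Fin n → ℕ) u x → total (h ∘ (f ⟨ u ⟩≔ x)) + h (f u) ≡ total (h ∘ f) + h x
  total-update {suc n} h f Fin.zero x = trans
    (cong (λ t → h x + t + h (f Fin.zero)) (total-cong {f = λ z → h ((f ⟨ Fin.zero ⟩≔ x) (Fin.suc z))} (λ z → refl)))
    (solve 3 (λ a b c → a :+ b :+ c := c :+ b :+ a) refl (h x) (total (h ∘ f ∘ Fin.suc)) (h (f Fin.zero)))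
    where open +-*-Solver
  total-update {suc n} h f (Fin.suc u) x = trans
    (cong (λ t → h (f Fin.zero) + t + h (f (Fin.suc u)))
      (total-cong {f = λ z → h ((f ⟨ Fin.suc u ⟩≔ x) (Fin.suc z))} {g = λ z → h (((f ∘ Fin.suc) ⟨ u ⟩≔ x) z)} (λ z → refl)))
    (trans (ℕₚ.+-assoc (h (f Fin.zero)) _ _) (trans (cong (h (f Fin.zero) +_) (total-update h (f ∘ Fin.suc) u x))
      (sym (ℕₚ.+-assoc (h (f Fin.zero)) _ _))))

  total-merge : ∀ {n} (h : ℕ → ℕ) (f : Fin n → ℕ) {u v} → u ≢ v → ∀ x y →
                total (h ∘ ((f ⟨ v ⟩≔ y) ⟨ u ⟩≔ x)) + (h (f u) + h (f v)) ≡ total (h ∘ f) + (h x + h y)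
  total-merge h f {u} {v} u≢v x y = begin
    total (h ∘ (g ⟨ u ⟩≔ x)) + (h (f u) + h (f v))     ≡⟨ cong (λ t → total (h ∘ (g ⟨ u ⟩≔ x)) + (h t + h (f v))) (sym (⟨⟩≔-other f u≢v)) ⟩
    total (h ∘ (g ⟨ u ⟩≔ x)) + (h (g u) + h (f v))     ≡⟨ sym (ℕₚ.+-assoc _ (h (g u)) (h (f v))) ⟩
    total (h ∘ (g ⟨ u ⟩≔ x)) + h (g u) + h (f v)       ≡⟨ cong (_+ h (f v)) (total-update h g u x) ⟩
    total (h ∘ g) + h x + h (f v)                      ≡⟨ solve 3 (λ a b c → a :+ b :+ c := (a :+ c) :+ b) refl (total (h ∘ g)) (h x) (h (f v)) ⟩
    total (h ∘ g) + h (f v) + h x                      ≡⟨ cong (_+ h x) (total-update h f v y) ⟩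
    total (h ∘ f) + h y + h x                          ≡⟨ solve 3 (λ a b c → a :+ b :+ c := a :+ (c :+ b)) refl (total (h ∘ f)) (h y) (h x) ⟩
    total (h ∘ f) + (h x + h y)                        ∎
    where
    open ≡.≡-Reasoning
    open +-*-Solver
    g = f ⟨ v ⟩≔ y

  -- The cross terms of the square are nonnegative. As the sizes add up to `n`, the potential never
  -- exceeds `n * n`.
  total-squares : ∀ {n} (f : Fin n → ℕ) → total (λ z → f z * f z) ≤ total f * total f
  total-squares {zero}  f = z≤n
  total-squares {suc n} f = ℕₚ.≤-trans (ℕₚ.+-monoʳ-≤ (x * x) (total-squares (f ∘ Fin.suc)))
    (ℕₚ.≤-trans (ℕₚ.m≤m+n (x * x + t * t) (2 * (x * t)))
      (ℕₚ.≤-reflexive (solve 2 (λ x t → x :* x :+ t :* t :+ con 2 :* (x :* t) := (x :+ t) :* (x :+ t)) refl x t)))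
    where
    open +-*-Solver
    x = f Fin.zero
    t = total (f ∘ Fin.suc)

  total-ones : ∀ n → total {n} (λ _ → 1) ≡ n
  total-ones zero    = refl
  total-ones (suc n) = cong suc (total-ones n)

-- The expected profit as a sum over nodes and edges.

module Bridge where
  open Field
  open Plan
  import Algebra.Properties.CommutativeMonoid.Sum as MonoidSum
  open import Algebra.Bundles using (CommutativeMonoid)
  open import Data.Bool.Base using (Bool; true; false; if_then_else_; _∨_; _∧_)
  open import Data.Bool.Properties using (∨-comm)
  open import Data.Empty using (⊥; ⊥-elim)
  open import Data.Fin.Base as Fin using (Fin)
  import Data.Fin.Properties as Finₚ
  open import Data.Fin.Subset using (Subset; inside; outside; _∩_) renaming (_∈_ to _∈ˢ_)
  open import Data.List.Base using (List; []; _∷_; _++_; map; foldr)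
  open import Data.Nat.Base using (zero; suc)
  open import Data.Product.Base using (_×_; _,_; proj₁)
  open import Data.Unit.Base using (⊤)
  open import Data.Vec.Base using ([]; _∷_; lookup)
  open import Data.Vec.Properties using (lookup-zipWith; []=⇒lookup; lookup⇒[]=)
  open import Function.Base using (_∘_)
  import Level
  import Relation.Binary.Reasoning.Setoid as SetoidReasoning
  open import Relation.Binary.PropositionalEquality as ≡ using (_≡_; cong; cong₂)
  open import Relation.Nullary using (¬_; Dec; does; yes; no)
  open import Relation.Nullary.Decidable using (dec-true; dec-false)

  inPlan : ∀ {n} → Plan n → Fin n → Bool
  inPlan (leaf v)   z = does (z Finₚ.≟ v)
  inPlan (edge v p) z = inPlan p z
  inPlan (p ⊗ q)    z = inPlan p z ∨ inPlan q z

  Distinct : ∀ {n} → Plan n → Set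
  Distinct (leaf v)   = ⊤
  Distinct (edge v p) = Distinct p
  Distinct (p ⊗ q)    = (∀ z → inPlan p z ≡ true → inPlan q z ≡ true → ⊥) × Distinct p × Distinct q

  restrict : ∀ {n} → Subset n → (p : Plan n) → Choice p
  restrict S (leaf v)   = lookup S v
  restrict S (edge v p) = restrict S p
  restrict S (p ⊗ q)    = restrict S p , restrict S q

  does⇒ : ∀ {a} {A : Set a} (d : Dec A) → does d ≡ true → A
  does⇒ (yes p) _ = p

  module SumProperties {c ℓ} (M : CommutativeMonoid c ℓ) where
    open CommutativeMonoid M
    open MonoidSum M
    open SetoidReasoning setoid

    sum-ε : ∀ {n} {f : Fin n → Carrier} → (∀ z → f z ≈ ε) → sum f ≈ ε
    sum-ε {n} e = trans (sum-cong-≋ e) (sum-replicate-zero n)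

    sum-single : ∀ {n} (f : Fin n → Carrier) v → sum (λ z → if does (z Finₚ.≟ v) then f z else ε) ≈ f v
    sum-single {suc n} f Fin.zero    = trans (∙-congˡ (sum-ε {n} {λ _ → ε} (λ z → refl))) (identityʳ _)
    sum-single f (Fin.suc v) = trans (identityˡ _) (sum-single (f ∘ Fin.suc) v)

    if-∨ : ∀ a b {x y z} → (a ≡ true → b ≡ true → ⊥) → (a ≡ true → x ≈ y) → (b ≡ true → x ≈ z) →
           (if a ∨ b then x else ε) ≈ (if a then y else ε) ∙ (if b then z else ε)
    if-∨ true  true  d f g = ⊥-elim (d ≡.refl ≡.refl)
    if-∨ true  false d f g = trans (f ≡.refl) (sym (identityʳ _))
    if-∨ false true  d f g = trans (g ≡.refl) (sym (identityˡ _))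
    if-∨ false false d f g = sym (identityˡ _)

    sum-∨ : ∀ {n} {a b : Fin n → Bool} {f g h : Fin n → Carrier} → (∀ z → a z ≡ true → b z ≡ true → ⊥) →
            (∀ z → a z ≡ true → f z ≈ g z) → (∀ z → b z ≡ true → f z ≈ h z) →
            sum (λ z → if a z ∨ b z then f z else ε) ≈ sum (λ z → if a z then g z else ε) ∙ sum (λ z → if b z then h z else ε)
    sum-∨ {a = a} {b} {f} {g} {h} d e e′ = trans
      (sum-cong-≋ {x = λ z → if a z ∨ b z then f z else ε} {y = λ z → (if a z then g z else ε) ∙ (if b z then h z else ε)}
        (λ z → if-∨ (a z) (b z) (d z) (e z) (e′ z)))
      (∑-distrib-+ (λ z → if a z then g z else ε) (λ z → if b z then h z else ε))

  module Bridges {c ℓ₁ ℓ₂} (K : OrderedField c ℓ₁ ℓ₂) {n} (I : Instance K n) where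
    open OrderedField K hiding (sum; product)
    open FieldProperties K
    open Instance I
    open Plans K I
    open SetoidReasoning setoid

    private
      module Σ⁺ = MonoidSum +-commutativeMonoid
      module Π* = MonoidSum *-commutativeMonoid
      module S⁺ = SumProperties +-commutativeMonoid
      module S* = SumProperties *-commutativeMonoid
      open OrderedField K using (sum; product)

    listSum : ∀ {a} {A : Set a} → List A → (A → Carrier) → Carrier
    listSum xs f = foldr _+_ 0# (map f xs)

    private
      listSum-cong : ∀ {a} {A : Set a} (xs : List A) {f g : A → Carrier} → (∀ x → f x ≈ g x) → listSum xs f ≈ listSum xs g
      listSum-cong []       e = refl
      listSum-cong (x ∷ xs) e = +-cong (e x) (listSum-cong xs e)

      listSum-++ : ∀ {a} {A : Set a} (xs ys : List A) f → listSum (xs ++ ys) f ≈ listSum xs f + listSum ys f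
      listSum-++ []       ys f = sym (+-identityˡ _)
      listSum-++ (x ∷ xs) ys f = trans (+-congˡ (listSum-++ xs ys f)) (sym (+-assoc _ _ _))

      listSum-map : ∀ {a b} {A : Set a} {B : Set b} (g : A → B) xs f → listSum (map g xs) f ≈ listSum xs (f ∘ g)
      listSum-map g []       f = refl
      listSum-map g (x ∷ xs) f = +-congˡ (listSum-map g xs f)

      listSum-* : ∀ {a} {A : Set a} (xs : List A) k f → listSum xs (λ x → k * f x) ≈ k * listSum xs f
      listSum-* []       k f = sym (zeroʳ k)
      listSum-* (x ∷ xs) k f = trans (+-congˡ (listSum-* xs k f)) (sym (distribˡ k _ _))

      listSum-minus : ∀ {a} {A : Set a} (xs : List A) f g → listSum xs (λ x → f x - g x) ≈ listSum xs f - listSum xs g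
      listSum-minus []       f g = sym (-‿inverseʳ 0#)
      listSum-minus (x ∷ xs) f g = trans (+-congˡ (listSum-minus xs f g))
        (solve 4 (λ a b c d → (a :- b) :+ (c :- d) := (a :+ c) :- (b :+ d)) refl (f x) (g x) (listSum xs f) (listSum xs g))

      listSum-sum : ∀ {a} {A : Set a} (xs : List A) {m} (f : A → Fin m → Carrier) →
                    listSum xs (λ x → sum (f x)) ≈ sum (λ e → listSum xs (λ x → f x e))
      listSum-sum []       {m} f = sym (S⁺.sum-ε {m} {λ _ → 0#} (λ e → refl))
      listSum-sum (x ∷ xs) f = trans (+-congˡ (listSum-sum xs f)) (sym (Σ⁺.∑-distrib-+ (f x) (λ e → listSum xs (λ x → f x e))))

      sum-* : ∀ {m} k (f : Fin m → Carrier) → k * sum f ≈ sum (λ e → k * f e)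
      sum-* {zero}  k f = zeroʳ k
      sum-* {suc m} k f = trans (distribˡ k _ _) (+-congˡ (sum-* k (f ∘ Fin.suc)))

      product-zero : ∀ {m} (f : Fin m → Carrier) v → f v ≈ 0# → product f ≈ 0#
      product-zero f Fin.zero    e = trans (*-congʳ e) (zeroˡ _)
      product-zero f (Fin.suc v) e = trans (*-congˡ (product-zero (f ∘ Fin.suc) v e)) (zeroʳ _)

      -- This is where the independence of the nodes enters.
      factorise : ∀ m (h : Fin m → Bool → Carrier) →
                  listSum (subsets m) (λ ω → product (λ v → h v (lookup ω v))) ≈ product (λ v → h v true + h v false)
      factorise zero    h = +-identityʳ 1#
      factorise (suc m) h = begin
        listSum (map (inside ∷_) (subsets m) ++ map (outside ∷_) (subsets m)) F
          ≈⟨ listSum-++ (map (inside ∷_) (subsets m)) _ F ⟩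
        listSum (map (inside ∷_) (subsets m)) F + listSum (map (outside ∷_) (subsets m)) F
          ≈⟨ +-cong (listSum-map (inside ∷_) (subsets m) F) (listSum-map (outside ∷_) (subsets m) F) ⟩
        listSum (subsets m) (λ ω → h Fin.zero true * R ω) + listSum (subsets m) (λ ω → h Fin.zero false * R ω)
          ≈⟨ +-cong (listSum-* (subsets m) _ R) (listSum-* (subsets m) _ R) ⟩
        h Fin.zero true * listSum (subsets m) R + h Fin.zero false * listSum (subsets m) R
          ≈⟨ distribʳ _ _ _ ⟨
        (h Fin.zero true + h Fin.zero false) * listSum (subsets m) R
          ≈⟨ *-congˡ (factorise m (h ∘ Fin.suc)) ⟩
        (h Fin.zero true + h Fin.zero false) * product (λ v → h (Fin.suc v) true + h (Fin.suc v) false) ∎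
        where
        F : Subset (suc m) → Carrier
        F ω = product (λ v → h v (lookup ω v))
        R : Subset m → Carrier
        R ω = product (λ v → h (Fin.suc v) (lookup ω v))

    opaque
      onPath : Fin n → Fin n → Bool
      onPath z e = does (onPathTo? z e)

      onPath-true : ∀ {z e} → OnPathTo z e → onPath z e ≡ true
      onPath-true {z} {e} p = dec-true (onPathTo? z e) p

      onPath-false : ∀ {z e} → ¬ OnPathTo z e → onPath z e ≡ false
      onPath-false {z} {e} p = dec-false (onPathTo? z e) p

      onPath⇒ : ∀ {z e} → onPath z e ≡ true → OnPathTo z e
      onPath⇒ {z} {e} q = does⇒ (onPathTo? z e) q

    gain factor cost missOn : Subset n → Fin n → Carrier
    gain   S z = if lookup S z then prize z * probability z else 0#
    factor S z = if lookup S z then 1# - probability z else 1#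
    missOn S e = product (λ z → if onPath z e then factor S z else 1#)
    cost   S e = weight e * (1# - missOn S e)

    private
      -- The product of `hit` over all nodes is the indicator that no present node of `S` lies below
      -- `e`. As a product, it has an expectation that factors over the nodes.
      hit : Subset n → Fin n → Fin n → Bool → Carrier
      hit S e v b = if b ∧ (onPath v e ∧ lookup S v) then 0# else 1#

      none : Subset n → Fin n → Subset n → Carrier
      none S e ω = product (λ v → hit S e v (lookup ω v))

      chance : Fin n → Bool → Carrier
      chance v b = if b then probability v else (1# - probability v)

      lookup-∩ : ∀ (S ω : Subset n) v → lookup (S ∩ ω) v ≡ lookup S v ∧ lookup ω v
      lookup-∩ S ω v = lookup-zipWith _∧_ v S ω

      weighted : ∀ {a} {A : Set a} (d : Dec A) {w m} → (A → m ≈ 0#) → (¬ A → m ≈ 1#) → (if does d then w else 0#) ≈ w * (1# - m)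
      weighted (yes p) {w} f g = sym (trans (*-congˡ (+-congˡ (-‿cong (f p)))) (solve 1 (λ w → w :* (:1 :- :0) := w) refl w))
      weighted (no ¬p) {w} f g = sym (trans (*-congˡ (+-congˡ (-‿cong (g ¬p)))) (solve 1 (λ w → w :* (:1 :- :1) := :0) refl w))

      crossed : ∀ S ω e → (if does (onPathToSome? (S ∩ ω) e) then weight e else 0#) ≈ weight e * (1# - none S e ω)
      crossed S ω e = weighted (onPathToSome? (S ∩ ω) e)
        (λ { (v , v∈ , on) → product-zero (λ v → hit S e v (lookup ω v)) v (zeroed v v∈ on) })
        (λ ¬p → S*.sum-ε {f = λ v → hit S e v (lookup ω v)} (ones ¬p))
        where
        zeroed : ∀ v → v ∈ˢ S ∩ ω → OnPathTo v e → hit S e v (lookup ω v) ≈ 0#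
        zeroed v v∈ on with lookup S v | lookup ω v | ≡.trans (≡.sym (lookup-∩ S ω v)) ([]=⇒lookup v∈)
        ... | true  | true  | _ rewrite onPath-true on = refl
        ... | true  | false | ()
        ... | false | _     | ()
        ones : ¬ OnPathToSome (S ∩ ω) e → ∀ v → hit S e v (lookup ω v) ≈ 1#
        ones ¬p v with lookup ω v in eω | onPath v e in eo | lookup S v in eS
        ... | false | _     | _     = refl
        ... | true  | false | _     = refl
        ... | true  | true  | false = refl
        ... | true  | true  | true  = ⊥-elim (¬p (v , lookup⇒[]= v (S ∩ ω) (≡.trans (lookup-∩ S ω v) (cong₂ _∧_ eS eω)) , onPath⇒ eo))

      average : ∀ S e v → chance v true * hit S e v true + chance v false * hit S e v false ≈
                (if onPath v e then factor S v else 1#)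
      average S e v with onPath v e | lookup S v
      ... | false | _     = solve 1 (λ p → p :* :1 :+ (:1 :- p) :* :1 := :1) refl (probability v)
      ... | true  | false = solve 1 (λ p → p :* :1 :+ (:1 :- p) :* :1 := :1) refl (probability v)
      ... | true  | true  = solve 1 (λ p → p :* :0 :+ (:1 :- p) :* :1 := :1 :- p) refl (probability v)

      total-probability : listSum (subsets n) Pr ≈ 1#
      total-probability = trans (factorise n chance) (S*.sum-ε {f = λ v → probability v + (1# - probability v)}
        (λ v → solve 1 (λ p → p :+ (:1 :- p) := :1) refl (probability v)))

      -- `Pr` and the indicator are both products over the nodes, so `factorise` applies to their
      -- product.
      miss-probability : ∀ S e → listSum (subsets n) (λ ω → Pr ω * none S e ω) ≈ missOn S e
      miss-probability S e = begin
        listSum (subsets n) (λ ω → Pr ω * none S e ω)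
          ≈⟨ listSum-cong (subsets n) (λ ω → sym (Π*.∑-distrib-+ (λ v → chance v (lookup ω v)) (λ v → hit S e v (lookup ω v)))) ⟩
        listSum (subsets n) (λ ω → product (λ v → chance v (lookup ω v) * hit S e v (lookup ω v)))
          ≈⟨ factorise n (λ v b → chance v b * hit S e v b) ⟩
        product (λ v → chance v true * hit S e v true + chance v false * hit S e v false)
          ≈⟨ Π*.sum-cong-≋ (average S e) ⟩
        missOn S e ∎

    expected-cost : ∀ S → 𝔼 (λ ω → W (S ∩ ω)) ≈ sum (cost S)
    expected-cost S = begin
      listSum (subsets n) (λ ω → Pr ω * W (S ∩ ω))
        ≈⟨ listSum-cong (subsets n) (λ ω → trans (*-congˡ (Σ⁺.sum-cong-≋ (crossed S ω)))
             (trans (sum-* (Pr ω) (λ e → weight e * (1# - none S e ω))) (Σ⁺.sum-cong-≋ (λ e →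
               solve 3 (λ p w m → p :* (w :* (:1 :- m)) := w :* (p :- p :* m)) refl (Pr ω) (weight e) (none S e ω))))) ⟩
      listSum (subsets n) (λ ω → sum (λ e → weight e * (Pr ω - Pr ω * none S e ω)))
        ≈⟨ listSum-sum (subsets n) (λ ω e → weight e * (Pr ω - Pr ω * none S e ω)) ⟩
      sum (λ e → listSum (subsets n) (λ ω → weight e * (Pr ω - Pr ω * none S e ω)))
        ≈⟨ Σ⁺.sum-cong-≋ (λ e → trans (listSum-* (subsets n) (weight e) (λ ω → Pr ω - Pr ω * none S e ω))
             (*-congˡ (trans (listSum-minus (subsets n) Pr (λ ω → Pr ω * none S e ω))
               (+-cong total-probability (-‿cong (miss-probability S e)))))) ⟩
      sum (cost S) ∎

    -- No path uses an edge at the root, so its miss probability is an empty product, and whatever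
    -- number stands as the weight of the root is multiplied by 0.
    cost-root : ∀ S → cost S root ≈ 0#
    cost-root S = trans (*-congˡ (+-congˡ (-‿cong (S*.sum-ε {f = λ z → if onPath z root then factor S z else 1#} ones))))
                    (solve 1 (λ w → w :* (:1 :- :1) := :0) refl (weight root))
      where
      ones : ∀ z → (if onPath z root then factor S z else 1#) ≈ 1#
      ones z rewrite onPath-false {z} {root} (λ p → proj₁ p ≡.refl) = refl

    -- The part of the profit below and at u, without the edge above u.
    share : Subset n → Fin n → Fin n → Carrier
    share S u z = gain S z - (if does (z Finₚ.≟ u) then 0# else cost S z)

    record Measures (u : Fin n) (p : Plan n) : Set (c Level.⊔ ℓ₁) where
      field
        profits : ∀ S → planProfit p (restrict S p) ≈ sum (λ z → if inPlan p z then share S u z else 0#)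
        misses  : ∀ S → planMiss p (restrict S p) ≈ product (λ z → if inPlan p z then factor S z else 1#)

    abstract
      measures-leaf : ∀ v → Measures v (leaf v)
      measures-leaf v = record
        { profits = λ S → sym (trans (S⁺.sum-single (share S v) v) (trans (+-congˡ (-‿cong (reflexive (cost≡0 S))))
            (solve 1 (λ g → g :- :0 := g) refl (gain S v))))
        ; misses = λ S → sym (S*.sum-single (factor S) v) }
        where
        cost≡0 : ∀ S → (if does (v Finₚ.≟ v) then 0# else cost S v) ≡ 0#
        cost≡0 S rewrite dec-true (v Finₚ.≟ v) ≡.refl = ≡.refl

      G≈planProfit : ∀ {p} → Measures root p → (∀ z → inPlan p z ≡ true) → ∀ S → G S 0# ≈ planProfit p (restrict S p)
      G≈planProfit {p} M all S = begin
        (sum (gain S) - 𝔼 (λ ω → W (S ∩ ω))) + 0# * P S     ≈⟨ +-cong (+-congˡ (-‿cong (expected-cost S))) (zeroˡ _) ⟩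
        (sum (gain S) - sum (cost S)) + 0#                  ≈⟨ +-identityʳ _ ⟩
        sum (gain S) - sum (cost S)                         ≈⟨ minus (gain S) (cost S) ⟨
        sum (λ z → gain S z - cost S z)                     ≈⟨ Σ⁺.sum-cong-≋ shared ⟩
        sum (λ z → if inPlan p z then share S root z else 0#) ≈⟨ Measures.profits M S ⟨
        planProfit p (restrict S p)                         ∎
        where
        minus : ∀ {m} (f g : Fin m → Carrier) → sum (λ z → f z - g z) ≈ sum f - sum g
        minus {zero}  f g = sym (-‿inverseʳ 0#)
        minus {suc m} f g = trans (+-congˡ (minus (f ∘ Fin.suc) (g ∘ Fin.suc)))
          (solve 4 (λ a b c d → (a :- b) :+ (c :- d) := (a :+ c) :- (b :+ d)) refl _ _ _ _)
        shared : ∀ z → gain S z - cost S z ≈ (if inPlan p z then share S root z else 0#)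
        shared z rewrite all z with z Finₚ.≟ root
        ... | yes ≡.refl = +-congˡ (-‿cong (cost-root S))
        ... | no  _      = refl

      measures-⊗ : ∀ {u v p q} → Measures u p → Measures v q → (∀ z → inPlan p z ≡ true → inPlan q z ≡ true → ⊥) →
                   (∀ z → inPlan q z ≡ onPath z v) → inPlan q v ≡ true → inPlan q u ≡ false → Measures u (p ⊗ edge v q)
      measures-⊗ {u} {v} {p} {q} Mp Mq disjoint below v∈q u∉q = record
        { profits = λ S → trans (+-cong (Measures.profits Mp S) (edge-profit S))
            (sym (S⁺.sum-∨ {f = share S u} {share S u} {λ z → gain S z - cost S z} disjoint (λ _ _ → refl) (outside-u S)))
        ; misses = λ S → trans (*-cong (Measures.misses Mp S) (Measures.misses Mq S))
            (sym (S*.sum-∨ {f = factor S} {factor S} {factor S} disjoint (λ _ _ → refl) (λ _ _ → refl))) }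
        where
        outside-u : ∀ S z → inPlan q z ≡ true → share S u z ≈ gain S z - cost S z
        outside-u S z z∈q with z Finₚ.≟ u
        ... | no _ = refl
        ... | yes ≡.refl with ≡.trans (≡.sym z∈q) u∉q
        ...   | ()
        miss≈ : ∀ S → planMiss q (restrict S q) ≈ missOn S v
        miss≈ S = trans (Measures.misses Mq S) (Π*.sum-cong-≋ (λ z → reflexive (cong (λ b → if b then factor S z else 1#) (below z))))
        at-v : ∀ S z → (if inPlan q z then gain S z - cost S z else 0#) + (if does (z Finₚ.≟ v) then cost S z else 0#) ≈
               (if inPlan q z then share S v z else 0#)
        at-v S z with z Finₚ.≟ v
        ... | yes ≡.refl rewrite v∈q = solve 2 (λ g k → (g :- k) :+ k := g :- :0) refl (gain S z) (cost S z)
        ... | no  _      = +-identityʳ _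
        edge-profit : ∀ S → planProfit (edge v q) (restrict S q) ≈ sum (λ z → if inPlan q z then gain S z - cost S z else 0#)
        edge-profit S = begin
          (planProfit q (restrict S q) + weight v * planMiss q (restrict S q)) - weight v
            ≈⟨ +-congʳ (+-cong (Measures.profits Mq S) (*-congˡ (miss≈ S))) ⟩
          (sum (λ z → if inPlan q z then share S v z else 0#) + weight v * missOn S v) - weight v
            ≈⟨ +-congʳ (+-congʳ (trans (sym (Σ⁺.sum-cong-≋ (at-v S))) (trans (Σ⁺.∑-distrib-+ X Y) (+-congˡ (S⁺.sum-single (cost S) v))))) ⟩
          ((sum X + weight v * (1# - missOn S v)) + weight v * missOn S v) - weight v
            ≈⟨ solve 3 (λ x w m → ((x :+ w :* (:1 :- m)) :+ w :* m) :- w := x) refl (sum X) (weight v) (missOn S v) ⟩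
          sum X ∎
          where
          X Y : Fin n → Carrier
          X z = if inPlan q z then gain S z - cost S z else 0#
          Y z = if does (z Finₚ.≟ v) then cost S z else 0#

      measures-swap : ∀ {u p q} → Measures u (p ⊗ q) → Measures u (q ⊗ p)
      measures-swap {u} {p} {q} M = record
        { profits = λ S → trans (+-comm _ _) (trans (Measures.profits M S)
            (Σ⁺.sum-cong-≋ (λ z → reflexive (cong (λ b → if b then share S u z else 0#) (∨-comm (inPlan p z) (inPlan q z))))))
        ; misses = λ S → trans (*-comm _ _) (trans (Measures.misses M S)
            (Π*.sum-cong-≋ (λ z → reflexive (cong (λ b → if b then factor S z else 1#) (∨-comm (inPlan p z) (inPlan q z)))))) }

-- The forest of partial solutions and one merge in it.

module Grove where
  open Field
  open Machine
  open Prog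
  open Scan
  open Plan
  open Merge
  open Tree
  open Bridge
  open import Data.Bool.Base using (true; false; _∨_)
  open import Data.Bool.Properties using (∨-zeroʳ)
  open import Data.Empty using (⊥)
  open import Data.Fin.Base using (Fin; toℕ)
  import Data.Fin.Properties as Finₚ
  open import Data.List.Base using (List; []; _∷_)
  open import Data.Nat.Base as ℕ using (ℕ; suc; _≤_; _<_; z≤n; s≤s)
  open import Data.Nat.GeneralisedArithmetic using (iterate)
  import Data.Nat.Properties as ℕₚ
  open import Data.Nat.Solver using (module +-*-Solver)
  open import Data.Product.Base using (∃-syntax; _×_; _,_; proj₁; proj₂)
  open import Data.Sum.Base using (_⊎_; inj₁; inj₂; [_,_]′)
  open import Function.Base using (_∘_; id)
  import Level
  open import Relation.Binary.Definitions using (tri<; tri≈; tri>)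
  open import Relation.Binary.PropositionalEquality using (_≡_; _≢_; refl; sym; trans; cong; cong₂; subst; subst₂)
  open import Relation.Nullary using (¬_; yes; no)

  depthLoad : List Instr
  depthLoad = addᴺ Adr N V ∷ addᴺ Adr N Adr ∷ addᴺ Adr N Adr ∷ loadᴺ Aux Adr ∷ []

  -- For each level all nodes are tested for their depth. These `n * n` tests fit into the time
  -- allowed, so the nodes are not sorted.
  mergeAtLevel levelLoop mergeLoop : Cmd
  mergeAtLevel = cond (lt Aux Lev) skip (cond (lt Lev Aux) skip mergeCmd)
  levelLoop    = while skip (lt V N) (blk depthLoad ⨾ mergeAtLevel ⨾ blk (setᴺ Tmp 1 ∷ addᴺ V Tmp V ∷ []))
  mergeLoop    = while (blk (setᴺ Tmp 0 ∷ [])) (lt Tmp Lev)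
                   (blk (setᴺ V 0 ∷ []) ⨾ levelLoop ⨾ blk (setᴺ Tmp 1 ∷ subᴺ Lev Lev Tmp ∷ []))

  module Forests {c ℓ₁ ℓ₂} (K : OrderedField c ℓ₁ ℓ₂) {n} (inst : Instance K n) where
    open OrderedField K using (Carrier; 0#) renaming (_≤_ to _≤ᶠ_)
    open Machines K
    open Programs K
    open Plans K inst
    open Merges K inst
    open Bridges K inst
    open Instance inst
    open Depths tree

    startAt stopAt depthAt : Fin n → ℕ
    startAt z = n ℕ.+ toℕ z
    stopAt  z = n ℕ.+ (n ℕ.+ toℕ z)
    depthAt z = n ℕ.+ (n ℕ.+ (n ℕ.+ toℕ z))

    -- If `u` itself is unmerged, this makes it the root of the current tree that contains `z`.
    Climb : (Fin n → Set) → Fin n → Fin n → Set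
    Climb M z u = ∃[ k ] (iterate parent z k ≡ u × (∀ i → i < k → M (iterate parent z i)))

    -- M is the set of nodes already merged into their parents; ρ is the
    -- potential that pays for the remaining merges.
    record Forest (s : Store) (M : Fin n → Set) (ρ : ℕ) : Set (c Level.⊔ ℓ₁ Level.⊔ ℓ₂) where
      field
        regN      : rN s N ≡ n
        regRoot   : rN s Root ≡ toℕ root
        memParent : ∀ z → mN s (toℕ z) ≡ toℕ (parent z)
        memWeight : ∀ z → mF s (toℕ z) ≡ weight z
        memDepth  : ∀ z → mN s (depthAt z) ≡ depth z
        heap≥     : lo ≤ rN s Heap
        plan      : Fin n → Plan n
        extent    : Fin n → ℕ
        held      : ∀ u → ¬ M u → Crowned s lo (mN s (startAt u)) (mN s (stopAt u)) (plan u)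
        measures  : ∀ u → ¬ M u → Measures u (plan u)
        distinct  : ∀ u → ¬ M u → Distinct (plan u)
        climbs    : ∀ u → ¬ M u → ∀ z → inPlan (plan u) z ≡ true → Climb M z u
        covered   : ∀ z → ∃[ u ] (¬ M u × inPlan (plan u) z ≡ true)
        extents   : ∀ u → ¬ M u → extent u ≡ leaves (plan u)
        total≡    : total extent ≡ n
        squares   : total (λ z → extent z ℕ.* extent z) ℕ.+ ρ ≡ n ℕ.* n

    climb-mono : ∀ {M M′ : Fin n → Set} {z u} → (∀ z → M z → M′ z) → Climb M z u → Climb M′ z u
    climb-mono f (k , e , below) = k , e , λ i i<k → f _ (below i i<k)

    abstract
      -- Sets of merged nodes are predicates, so the change from one description of a set to another
      -- takes two inclusions.
      forest-move : ∀ {s s′ M M′ ρ} → rN s′ N ≡ rN s N → rN s′ Root ≡ rN s Root → rN s′ Heap ≡ rN s Heap →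
                    mN s′ ≡ mN s → mF s′ ≡ mF s → (∀ z → M z → M′ z) → (∀ z → M′ z → M z) → Forest s M ρ → Forest s′ M′ ρ
      forest-move {s} {s′} eN eR eH refl refl to from F = record
        { regN = trans eN regN ; regRoot = trans eR regRoot
        ; memParent = memParent ; memWeight = memWeight ; memDepth = memDepth
        ; heap≥ = subst (lo ≤_) (sym eH) heap≥
        ; plan = plan ; extent = extent
        ; held = λ u ¬M → crowned-keep {s} {s′} (λ _ _ _ → refl , refl) (ℕₚ.≤-reflexive (sym eH)) (held u (¬M ∘ to u))
        ; measures = λ u ¬M → measures u (¬M ∘ to u)
        ; distinct = λ u ¬M → distinct u (¬M ∘ to u)
        ; climbs = λ u ¬M z z∈ → climb-mono to (climbs u (¬M ∘ to u) z z∈)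
        ; covered = λ z → let u , ¬M , z∈ = covered z in u , (¬M ∘ from u) , z∈
        ; extents = λ u ¬M → extents u (¬M ∘ to u)
        ; total≡ = total≡ ; squares = squares }
        where open Forest F

    start≢ : ∀ {w u} → w ≢ u → startAt w ≢ startAt u
    start≢ w≢u e = w≢u (Finₚ.toℕ-injective (ℕₚ.+-cancelˡ-≡ n _ _ e))

    stop≢ : ∀ {w u} → w ≢ u → stopAt w ≢ stopAt u
    stop≢ w≢u e = start≢ w≢u (ℕₚ.+-cancelˡ-≡ n _ _ e)

    node<start : ∀ (z u : Fin n) → toℕ z < startAt u
    node<start z u = ℕₚ.≤-trans (Finₚ.toℕ<n z) (ℕₚ.m≤m+n n (toℕ u))

    start<stop : ∀ (w u : Fin n) → startAt w < stopAt u
    start<stop w u = ℕₚ.+-monoʳ-< n (node<start w u)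

    stop<depth : ∀ (w u : Fin n) → stopAt w < depthAt u
    stop<depth w u = ℕₚ.+-monoʳ-< n (start<stop w u)

    depth<lo : ∀ (z : Fin n) → depthAt z < lo
    depth<lo z = ℕₚ.+-monoʳ-< n (ℕₚ.+-monoʳ-< n (ℕₚ.+-monoʳ-< n (Finₚ.toℕ<n z)))

    module _ {s M ρ} (F : Forest s M ρ) {v} (v≢r : v ≢ root) (¬Mv : ¬ M v) (¬Mu : ¬ M (parent v))
             (deeper : ∀ z → depth v < depth z → M z) where
      open Forest F

      private
        u : Fin n
        u = parent v
        p q : Plan n
        p = plan u
        q = plan v

        depth≡ : depth v ≡ suc (depth u)
        depth≡ = depth-suc v≢r

        1≤depth : 1 ≤ depth v
        1≤depth = subst (1 ≤_) (sym depth≡) (s≤s z≤n)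

        u≢v : u ≢ v
        u≢v e = ℕₚ.1+n≢n (trans (sym depth≡) (cong depth (sym e)))

        abstract
          -- Two climbs from `z` follow the same path. The shorter one would end at an unmerged node
          -- that the longer one passes as merged, and climbs of equal length end at the same node.
          disjoint : ∀ z → inPlan p z ≡ true → inPlan q z ≡ true → ⊥
          disjoint z z∈p z∈q with climbs u ¬Mu z z∈p | climbs v ¬Mv z z∈q
          ... | k , ek , bk | j , ej , bj with ℕₚ.<-cmp k j
          ...   | tri< k<j _ _ = ¬Mu (subst M ek (bj k k<j))
          ...   | tri≈ _ refl _ = u≢v (trans (sym ek) ej)
          ...   | tri> _ _ j<k = ¬Mv (subst M ej (bk j j<k))

          -- If `v` is an ancestor of `z`, the root `w` of the tree of `z` is on the same path.
          -- Above `v` it would make `v` merged; below `v` it would be deeper and therefore merged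
          -- itself.
          below : ∀ z → inPlan q z ≡ onPath z v
          below z with inPlan q z in e
          ... | true = sym (onPath-true (v≢r , proj₁ (climbs v ¬Mv z e) , proj₁ (proj₂ (climbs v ¬Mv z e))))
          ... | false = sym (onPath-false λ { (_ , k , ek) → absurd k ek (covered z) })
            where
            absurd : ∀ k → iterate parent z k ≡ v → ∃[ w ] (¬ M w × inPlan (plan w) z ≡ true) → ⊥
            absurd k ek (w , ¬Mw , z∈w) with climbs w ¬Mw z z∈w
            ... | j , ej , bj with ℕₚ.<-cmp k j
            ...   | tri< k<j _ _ = ¬Mv (subst M ek (bj k k<j))
            ...   | tri≈ _ refl _ with trans (sym e) (trans (cong (λ x → inPlan (plan x) z) (trans (sym ek) ej)) z∈w)
            ...     | ()
            absurd k ek (w , ¬Mw , z∈w) | j , ej , bj | tri> _ _ j<k = ¬Mw (deeper w (subst (depth v <_)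
              (sym (depth-<-iterate (k ℕ.∸ j) (trans (cong (λ x → iterate parent x (k ℕ.∸ j)) (sym ej))
                (trans (sym (iterate-+ parent z j (k ℕ.∸ j))) (trans (cong (iterate parent z) (ℕₚ.m+[n∸m]≡n (ℕₚ.<⇒≤ j<k))) ek))) 1≤depth))
              (ℕₚ.m<m+n (depth v) (ℕₚ.m<n⇒0<n∸m j<k))))

          v∈q : inPlan q v ≡ true
          v∈q = trans (below v) (onPath-true (v≢r , 0 , refl))

          u∉q : inPlan q u ≡ false
          u∉q = trans (below u) (onPath-false λ { (_ , k , e) → ℕₚ.<⇒≢ (ℕₚ.≤-trans (ℕₚ.≤-reflexive (sym depth≡)) (ℕₚ.m≤m+n (depth v) k))
                  (depth-<-iterate k e 1≤depth) })

        module _ {s′} (R : Merged u v p q s s′) {M′ : Fin n → Set} (to : ∀ z → M z → M′ z) (from : ∀ z → M′ z → M z ⊎ z ≡ v) (atv : M′ v)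
                 (eN : rN s′ N ≡ rN s N) (eR : rN s′ Root ≡ rN s Root) where
          private
            module R = Merged R

            a b : ℕ
            a = leaves p
            b = leaves q

            record Grown (r : Plan n) : Set (c Level.⊔ ℓ₁ Level.⊔ ℓ₂) where
              field
                crowned   : Crowned s′ lo (mN s′ (startAt u)) (mN s′ (stopAt u)) r
                measured  : Measures u r
                distinct′ : Distinct r
                split     : ∀ z → inPlan r z ≡ true → inPlan p z ≡ true ⊎ inPlan q z ≡ true
                joinˡ     : ∀ z → inPlan p z ≡ true → inPlan r z ≡ true
                joinʳ     : ∀ z → inPlan q z ≡ true → inPlan r z ≡ true
                size≡     : leaves r ≡ a ℕ.+ b

            ∨-split : ∀ x y → x ∨ y ≡ true → x ≡ true ⊎ y ≡ true
            ∨-split true  y e = inj₁ refl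
            ∨-split false y e = inj₂ e

            grown : ∃[ r ] Grown r
            grown with R.grafted
            ... | straight C = p ⊗ edge v q , record
              { crowned = C
              ; measured = measures-⊗ (measures u ¬Mu) (measures v ¬Mv) disjoint below v∈q u∉q
              ; distinct′ = disjoint , distinct u ¬Mu , distinct v ¬Mv
              ; split = λ z → ∨-split (inPlan p z) (inPlan q z)
              ; joinˡ = λ z e → cong (_∨ inPlan q z) e
              ; joinʳ = λ z e → trans (cong (inPlan p z ∨_) e) (∨-zeroʳ (inPlan p z))
              ; size≡ = refl }
            ... | swapped C = edge v q ⊗ p , record
              { crowned = C
              ; measured = measures-swap {u} {p} {edge v q} (measures-⊗ (measures u ¬Mu) (measures v ¬Mv) disjoint below v∈q u∉q)
              ; distinct′ = (λ z z∈q z∈p → disjoint z z∈p z∈q) , distinct v ¬Mv , distinct u ¬Mu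
              ; split = λ z e → [ inj₂ , inj₁ ]′ (∨-split (inPlan q z) (inPlan p z) e)
              ; joinˡ = λ z e → trans (cong (inPlan q z ∨_) e) (∨-zeroʳ (inPlan q z))
              ; joinʳ = λ z e → cong (_∨ inPlan p z) e
              ; size≡ = ℕₚ.+-comm b a }

            r : Plan n
            r = proj₁ grown
            module G = Grown (proj₂ grown)

            plan′ : Fin n → Plan n
            plan′ = plan ⟨ u ⟩≔ r

            -- The merged `v` gets extent 0, so that the extents still add up to `n`.
            extent′ : Fin n → ℕ
            extent′ = (extent ⟨ v ⟩≔ 0) ⟨ u ⟩≔ (a ℕ.+ b)

            -- The plans change only at `u`, and `v` is now merged; all other roots carry over.
            everywhere : ∀ {x} (P : Fin n → Plan n → Set x) → P u r → (∀ w → w ≢ u → w ≢ v → ¬ M w → P w (plan w)) →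
                         ∀ w → ¬ M′ w → P w (plan′ w)
            everywhere P Pu Pw w ¬M′w with w Finₚ.≟ u
            ... | yes refl = Pu
            ... | no  w≢u  = Pw w w≢u (λ { refl → ¬M′w atv }) (¬M′w ∘ to w)

            start-same : ∀ w → w ≢ u → mN s′ (startAt w) ≡ mN s (startAt w)
            start-same w w≢u = R.sameᴺ _ (ℕₚ.≤-trans (ℕₚ.<-trans (start<stop w w) (ℕₚ.<-trans (stop<depth w w) (depth<lo w))) heap≥)
              (start≢ w≢u) (ℕₚ.<⇒≢ (start<stop w u))

            stop-same : ∀ w → w ≢ u → mN s′ (stopAt w) ≡ mN s (stopAt w)
            stop-same w w≢u = R.sameᴺ _ (ℕₚ.≤-trans (ℕₚ.<-trans (stop<depth w w) (depth<lo w)) heap≥)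
              (ℕₚ.>⇒≢ (start<stop u w)) (stop≢ w≢u)

            held′ : ∀ w → w ≢ u → w ≢ v → ¬ M w → Crowned s′ lo (mN s′ (startAt w)) (mN s′ (stopAt w)) (plan w)
            held′ w w≢u _ ¬Mw = subst₂ (λ x y → Crowned s′ lo x y (plan w)) (sym (start-same w w≢u)) (sym (stop-same w w≢u))
              (crowned-keep (λ k lo≤k k< → R.sameᴺ k k<
                  (ℕₚ.>⇒≢ (ℕₚ.≤-trans (ℕₚ.<-trans (start<stop u u) (ℕₚ.<-trans (stop<depth u u) (depth<lo u))) lo≤k))
                  (ℕₚ.>⇒≢ (ℕₚ.≤-trans (ℕₚ.<-trans (stop<depth u u) (depth<lo u)) lo≤k)) , R.sameᶠ k k<)
                R.grow (held w ¬Mw))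

            -- With `v` merged, the nodes of its tree climb one step further, to the parent.
            climb-step : ∀ {z} → Climb M z v → Climb M′ z u
            climb-step {z} (k , e , bk) = suc k , trans (iterate-suc parent z k) (cong parent e) , upto
              where
              upto : ∀ i → i < suc k → M′ (iterate parent z i)
              upto i i<1+k with ℕₚ.m≤n⇒m<n∨m≡n (ℕₚ.≤-pred i<1+k)
              ... | inj₁ i<k  = to _ (bk i i<k)
              ... | inj₂ refl = subst M′ (sym e) atv

            ¬M′u : ¬ M′ u
            ¬M′u m = [ ¬Mu , u≢v ]′ (from u m)

            covered′ : ∀ z → ∃[ w ] (¬ M′ w × inPlan (plan′ w) z ≡ true)
            covered′ z with covered z
            ... | w , ¬Mw , z∈ with w Finₚ.≟ u | w Finₚ.≟ v
            ...   | yes refl | _ = u , ¬M′u , trans (cong (λ x → inPlan x z) (⟨⟩≔-same plan u r)) (G.joinˡ z z∈)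
            ...   | no _ | yes refl = u , ¬M′u , trans (cong (λ x → inPlan x z) (⟨⟩≔-same plan u r)) (G.joinʳ z z∈)
            ...   | no w≢u | no w≢v = w , (λ m → [ ¬Mw , w≢v ]′ (from w m)) , trans (cong (λ x → inPlan x z) (⟨⟩≔-other plan w≢u)) z∈

            total′ : total extent′ ≡ n
            total′ = trans (ℕₚ.+-cancelʳ-≡ (a ℕ.+ b) _ _ (trans (cong (total extent′ ℕ.+_) (sym (cong₂ ℕ._+_ (extents u ¬Mu) (extents v ¬Mv))))
              (trans (total-merge id extent u≢v (a ℕ.+ b) 0) (cong (total extent ℕ.+_) (ℕₚ.+-identityʳ (a ℕ.+ b)))))) total≡

            sq : ℕ → ℕ
            sq x = x ℕ.* x

            squares₁ : total (sq ∘ extent′) ≡ total (sq ∘ extent) ℕ.+ 2 ℕ.* (a ℕ.* b)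
            squares₁ = ℕₚ.+-cancelʳ-≡ (sq a ℕ.+ sq b) _ _ (trans
              (cong (total (sq ∘ extent′) ℕ.+_) (sym (cong₂ (λ x y → sq x ℕ.+ sq y) (extents u ¬Mu) (extents v ¬Mv))))
              (trans (total-merge sq extent u≢v (a ℕ.+ b) 0)
                (solve 3 (λ t a b → t :+ ((a :+ b) :* (a :+ b) :+ con 0) := (t :+ con 2 :* (a :* b)) :+ (a :* a :+ b :* b)) refl (total (sq ∘ extent)) a b)))
              where open +-*-Solver

            -- A true difference, since the squares add up to at most the square of the total `n`.
            ρ′ : ℕ
            ρ′ = n ℕ.* n ℕ.∸ total (sq ∘ extent′)

            squares′ : total (sq ∘ extent′) ℕ.+ ρ′ ≡ n ℕ.* n
            squares′ = ℕₚ.m+[n∸m]≡n (ℕₚ.≤-trans (total-squares extent′) (ℕₚ.≤-reflexive (cong₂ ℕ._*_ total′ total′)))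

            paid : ρ ≡ 2 ℕ.* (a ℕ.* b) ℕ.+ ρ′
            paid = ℕₚ.+-cancelˡ-≡ (total (sq ∘ extent)) _ _ (trans squares (trans (sym squares′)
              (trans (cong (ℕ._+ ρ′) squares₁) (ℕₚ.+-assoc (total (sq ∘ extent)) _ ρ′))))

          forest-grow : ∃[ ρ′ ] (ρ ≡ 2 ℕ.* (a ℕ.* b) ℕ.+ ρ′ × Forest s′ M′ ρ′)
          forest-grow = ρ′ , paid , record
            { regN = trans eN regN ; regRoot = trans eR regRoot
            ; memParent = λ z → trans (R.sameᴺ _ (ℕₚ.≤-trans (ℕₚ.<-trans (node<start z z) (ℕₚ.<-trans (start<stop z z) (ℕₚ.<-trans (stop<depth z z) (depth<lo z)))) heap≥)
                (ℕₚ.<⇒≢ (node<start z u)) (ℕₚ.<⇒≢ (ℕₚ.<-trans (node<start z u) (start<stop u u)))) (memParent z)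
            ; memWeight = λ z → trans (R.sameᶠ _ (ℕₚ.≤-trans (ℕₚ.<-trans (node<start z z) (ℕₚ.<-trans (start<stop z z) (ℕₚ.<-trans (stop<depth z z) (depth<lo z)))) heap≥)) (memWeight z)
            ; memDepth = λ z → trans (R.sameᴺ _ (ℕₚ.≤-trans (depth<lo z) heap≥)
                (ℕₚ.>⇒≢ (ℕₚ.<-trans (start<stop u z) (stop<depth z z))) (ℕₚ.>⇒≢ (stop<depth u z))) (memDepth z)
            ; heap≥ = ℕₚ.≤-trans heap≥ R.grow
            ; plan = plan′ ; extent = extent′
            ; held = everywhere (λ w x → Crowned s′ lo (mN s′ (startAt w)) (mN s′ (stopAt w)) x) G.crowned held′
            ; measures = everywhere Measures G.measured (λ w _ _ ¬Mw → measures w ¬Mw)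
            ; distinct = everywhere (λ _ → Distinct) G.distinct′ (λ w _ _ ¬Mw → distinct w ¬Mw)
            ; climbs = everywhere (λ w x → ∀ z → inPlan x z ≡ true → Climb M′ z w)
                (λ z z∈ → [ (λ z∈p → climb-mono to (climbs u ¬Mu z z∈p)) , (λ z∈q → climb-step (climbs v ¬Mv z z∈q)) ]′ (G.split z z∈))
                (λ w _ _ ¬Mw z z∈ → climb-mono to (climbs w ¬Mw z z∈))
            ; covered = covered′
            ; extents = everywhere (λ w x → extent′ w ≡ leaves x)
                (trans (⟨⟩≔-same (extent ⟨ v ⟩≔ 0) u (a ℕ.+ b)) (sym G.size≡))
                (λ w w≢u w≢v ¬Mw → trans (⟨⟩≔-other (extent ⟨ v ⟩≔ 0) w≢u) (trans (⟨⟩≔-other extent w≢v) (extents w ¬Mw)))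
            ; total≡ = total′ ; squares = squares′ }

      abstract
        forest-merge : ∀ {M′ : Fin n → Set} → (∀ z → M z → M′ z) → (∀ z → M′ z → M z ⊎ z ≡ v) → M′ v → rN s V ≡ toℕ v →
          wp mergeCmd (1300 ℕ.* (leaves (plan (parent v)) ℕ.* leaves (plan v)))
            (λ s′ → ∃[ ρ′ ] (ρ ≡ 2 ℕ.* (leaves (plan (parent v)) ℕ.* leaves (plan v)) ℕ.+ ρ′ × Forest s′ M′ ρ′)) s
        forest-merge to from atv eV = wp-post (λ {s′} pr R → forest-grow R to from atv (Preserved.regᴺ pr N refl) (Preserved.regᴺ pr Root refl))
          (merge-wp regN eV (memParent v) (memWeight v) (weight≥0 v v≢r) heap≥ (proj₁ (held u ¬Mu)) (proj₁ (held v ¬Mv)))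

-- Merging level by level.

module Levels where
  open Machine
  open Prog
  open Plan
  open Merge
  open Tree
  open Grove
  open import Data.Empty using (⊥-elim)
  open import Data.Fin.Base using (Fin; toℕ; fromℕ<)
  import Data.Fin.Properties as Finₚ
  open import Data.List.Base using ([]; _∷_)
  open import Data.Nat.Base as ℕ using (ℕ; zero; suc; _≤_; _<_; z≤n; s≤s)
  import Data.Nat.Properties as ℕₚ
  open import Data.Nat.Solver using (module +-*-Solver)
  open import Data.Product.Base using (∃-syntax; _×_; _,_)
  open import Data.Sum.Base using (_⊎_; inj₁; inj₂; [_,_]′)
  open import Function.Base using (id)
  import Level
  open import Relation.Binary.Definitions using (tri<; tri≈; tri>)
  open import Relation.Binary.PropositionalEquality using (_≡_; _≢_; refl; sym; trans; cong; cong₂; subst)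
  open import Relation.Nullary using (¬_)

  module LevelLoops {c ℓ₁ ℓ₂} (K : OrderedField c ℓ₁ ℓ₂) {n} (inst : Instance K n) where
    open Machines K
    open Programs K
    open Merges K inst
    open Forests K inst
    open Instance inst
    open Depths tree

    -- The running time may depend on the outcome, which the potential accounts for.
    Timed : ∀ {a} → Cmd → (ℕ → Store → Set a) → Store → Set (c Level.⊔ a)
    Timed cmd Q s = ∃[ t ] wp cmd t (Q t) s

    timed-⨾ : ∀ {a b} {P : ℕ → Store → Set a} {Q : ℕ → Store → Set b} {x y s} → Timed x P s →
              (∀ {s′} t → Preserved x s s′ → P t s′ → Timed y (λ t′ → Q (t ℕ.+ t′)) s′) → Timed (x ⨾ y) Q s
    timed-⨾ (t , mk s₁ e p post) f = let t′ , w = f t p post in t ℕ.+ t′ , wp-⨾ (mk s₁ e p w)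

    Stage : ℕ → ℕ → Fin n → Set
    Stage d k z = d < depth z ⊎ (depth z ≡ d × toℕ z < k)

    Above : ℕ → Fin n → Set
    Above d z = d < depth z

    -- A merge of sizes `a` and `b` takes at most `1300 a b` steps and lowers the potential by
    -- `2 a b`, so each unit of potential pays for 650 steps.
    Outcome : (Fin n → Set) → ℕ → ℕ → ℕ → Store → Set (c Level.⊔ ℓ₁ Level.⊔ ℓ₂)
    Outcome M base ρ t s = ∃[ ρ′ ] (t ℕ.+ 650 ℕ.* ρ′ ≤ base ℕ.+ 650 ℕ.* ρ × Forest s M ρ′)

    private
      stage-suc : ∀ {d k} z → Stage d k z → Stage d (suc k) z
      stage-suc z (inj₁ p)       = inj₁ p
      stage-suc z (inj₂ (e , p)) = inj₂ (e , ℕₚ.m<n⇒m<1+n p)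

      stage-pred : ∀ {d k} z → Stage d (suc k) z → Stage d k z ⊎ (depth z ≡ d × toℕ z ≡ k)
      stage-pred z (inj₁ p) = inj₁ (inj₁ p)
      stage-pred z (inj₂ (e , p)) with ℕₚ.m≤n⇒m<n∨m≡n (ℕₚ.≤-pred p)
      ... | inj₁ z<k = inj₁ (inj₂ (e , z<k))
      ... | inj₂ z≡k = inj₂ (e , z≡k)

    abstract
      merge-at-level : ∀ {d v ρ s} → 1 ≤ d → rN s V ≡ toℕ v → rN s Lev ≡ d → rN s Aux ≡ depth v → Forest s (Stage d (toℕ v)) ρ →
        Timed mergeAtLevel (Outcome (Stage d (suc (toℕ v))) 4 ρ) s
      merge-at-level {d} {v} {ρ} {s} 1≤d eV eL eD F with ℕₚ.<-cmp (depth v) d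
      ... | tri< dv<d ≢ _ = 4 , wp-≤ (≤! 2 4) (wp-cond-true (lt-true {Aux} {Lev} {s} eD eL dv<d)
              (wp-blk (ρ , ℕₚ.≤-refl , forest-move {s} {s} refl refl refl refl refl stage-suc
                (λ z m → [ id , (λ { (e , k) → ⊥-elim (≢ (trans (cong depth (sym (Finₚ.toℕ-injective k))) e)) }) ]′ (stage-pred z m)) F)))
      ... | tri> _ ≢ d<dv = 4 , wp-cond-false (lt-false {Aux} {Lev} {s} eD eL (ℕₚ.<⇒≤ d<dv))
              (wp-cond-true (lt-true {Lev} {Aux} {s} eL eD d<dv)
              (wp-blk (ρ , ℕₚ.≤-refl , forest-move {s} {s} refl refl refl refl refl stage-suc
                (λ z m → [ id , (λ { (e , k) → ⊥-elim (≢ (trans (cong depth (sym (Finₚ.toℕ-injective k))) e)) }) ]′ (stage-pred z m)) F)))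
      ... | tri≈ _ dv≡d _ = 4 ℕ.+ 1300 ℕ.* ab , wp-cond-false (lt-false {Aux} {Lev} {s} eD eL (ℕₚ.≤-reflexive (sym dv≡d)))
              (wp-cond-false (lt-false {Lev} {Aux} {s} eL eD (ℕₚ.≤-reflexive dv≡d))
                (wp-post (λ { _ (ρ′ , paid , F′) → ρ′ , bound ρ′ paid , F′ })
                  (forest-merge F v≢r ¬Mv ¬Mu (λ z p → inj₁ (subst (_< depth z) dv≡d p))
                    stage-suc (λ z m → [ inj₁ , (λ { (_ , k) → inj₂ (Finₚ.toℕ-injective k) }) ]′ (stage-pred z m))
                    (inj₂ (dv≡d , ℕₚ.≤-refl)) eV)))
        where
        v≢r : v ≢ root
        v≢r = positive⇒≢root (subst (1 ≤_) (sym dv≡d) 1≤d)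
        ¬Mv : ¬ Stage d (toℕ v) v
        ¬Mv (inj₁ p)       = ℕₚ.<⇒≢ p (sym dv≡d)
        ¬Mv (inj₂ (_ , p)) = ℕₚ.<⇒≢ p refl
        du<d : depth (parent v) < d
        du<d = ℕₚ.≤-reflexive (trans (sym (depth-suc v≢r)) dv≡d)
        ¬Mu : ¬ Stage d (toℕ v) (parent v)
        ¬Mu (inj₁ p)       = ℕₚ.<-asym p du<d
        ¬Mu (inj₂ (e , _)) = ℕₚ.<⇒≢ du<d e
        ab : ℕ
        ab = leaves (Forest.plan F (parent v)) ℕ.* leaves (Forest.plan F v)
        bound : ∀ ρ′ → ρ ≡ 2 ℕ.* ab ℕ.+ ρ′ → (4 ℕ.+ 1300 ℕ.* ab) ℕ.+ 650 ℕ.* ρ′ ≤ 4 ℕ.+ 650 ℕ.* ρ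
        bound ρ′ paid = ℕₚ.≤-reflexive (trans (solve 2 (λ x r → (con 4 :+ con 1300 :* x) :+ con 650 :* r := con 4 :+ con 650 :* (con 2 :* x :+ r)) refl ab ρ′)
          (cong (λ x → 4 ℕ.+ 650 ℕ.* x) (sym paid)))
          where open +-*-Solver

      -- Besides merges, each node takes 4 steps to load its depth, 4 to compare it, 2 to advance
      -- and 2 for the loop.
      level-wp : ∀ r k {d ρ s} → k ℕ.+ r ≡ n → 1 ≤ d → rN s V ≡ k → rN s Lev ≡ d → Forest s (Stage d k) ρ →
        Timed levelLoop (Outcome (Stage d n) (r ℕ.* 12 ℕ.+ 2) ρ) s
      level-wp zero k {s = s} e 1≤d eV eL F = 2 , wp-while-exit (wp-blk
        (lt-false {V} {N} {s} eV (Forest.regN F) (ℕₚ.≤-reflexive (sym k≡n)) , _ , ℕₚ.≤-refl , subst (λ k → Forest s (Stage _ k) _) k≡n F))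
        where
        k≡n : k ≡ n
        k≡n = trans (sym (ℕₚ.+-identityʳ k)) e
      level-wp (suc r) k {d} {ρ} {s} e 1≤d eV eL F = again body
        where
        k<n : k < n
        k<n = subst (k <_) e (ℕₚ.m<m+n k (s≤s z≤n))
        v : Fin n
        v = fromℕ< k<n
        v≡k : toℕ v ≡ k
        v≡k = Finₚ.toℕ-fromℕ< k<n
        bodyCmd : Cmd
        bodyCmd = blk depthLoad ⨾ mergeAtLevel ⨾ blk (setᴺ Tmp 1 ∷ addᴺ V Tmp V ∷ [])
        s₁ : Store
        s₁ = effs depthLoad s
        F₁ : Forest s₁ (Stage d (toℕ v)) ρ
        F₁ = forest-move {s} {s₁} refl refl refl refl refl (λ z m → subst (λ k → Stage d k z) (sym v≡k) m)
               (λ z m → subst (λ k → Stage d k z) v≡k m) F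
        address : rN s N ℕ.+ (rN s N ℕ.+ (rN s N ℕ.+ rN s V)) ≡ depthAt v
        address = cong₂ ℕ._+_ (Forest.regN F) (cong₂ ℕ._+_ (Forest.regN F) (cong₂ ℕ._+_ (Forest.regN F) (trans eV (sym v≡k))))
        Body : ℕ → Store → Set (c Level.⊔ ℓ₁ Level.⊔ ℓ₂)
        Body t s′ = Outcome (Stage d (suc k)) 10 ρ t s′ × rN s′ V ≡ suc k × rN s′ Lev ≡ d
        body : Timed bodyCmd Body s
        body = timed-⨾ {P = λ t s′ → s′ ≡ s₁ × t ≡ 4} (4 , wp-blk (refl , refl)) λ { {s′} .4 _ (refl , refl) →
          timed-⨾ (merge-at-level {d} {v} {ρ} {s₁} 1≤d (trans eV (sym v≡k)) eL (trans (cong (mN s) address) (Forest.memDepth F v)) F₁)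
            λ { {s₂} t pr (ρ′ , le′ , F₂) → 2 , wp-blk ((ρ′ , bound t ρ′ le′ ,
              forest-move {s₂} {effs (setᴺ Tmp 1 ∷ addᴺ V Tmp V ∷ []) s₂} refl refl refl refl refl
                (λ z m → subst (λ k → Stage d (suc k) z) v≡k m) (λ z m → subst (λ k → Stage d (suc k) z) (sym v≡k) m) F₂) ,
              cong suc (trans (Preserved.regᴺ pr V refl) eV) , trans (Preserved.regᴺ pr Lev refl) eL) } }
          where
          bound : ∀ t ρ′ → t ℕ.+ 650 ℕ.* ρ′ ≤ 4 ℕ.+ 650 ℕ.* ρ → (4 ℕ.+ (t ℕ.+ 2)) ℕ.+ 650 ℕ.* ρ′ ≤ 10 ℕ.+ 650 ℕ.* ρ
          bound t ρ′ p = ℕₚ.≤-trans (ℕₚ.≤-reflexive (solve 2 (λ t x → (con 4 :+ (t :+ con 2)) :+ x := con 6 :+ (t :+ x)) refl t (650 ℕ.* ρ′)))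
            (ℕₚ.+-monoʳ-≤ 6 p)
            where open +-*-Solver
        again : Timed bodyCmd Body s → Timed levelLoop (Outcome (Stage d n) (suc r ℕ.* 12 ℕ.+ 2) ρ) s
        again (t , mk s′ ex pr ((ρ₁ , le₁ , F′) , eV′ , eL′)) =
          let t′ , w = level-wp r (suc k) (trans (sym (ℕₚ.+-suc k r)) e) 1≤d eV′ eL′ F′ in
          (t ℕ.+ 2) ℕ.+ t′ , wp-while-again {τ₁ = 0} {τ₂ = t} {τ₃ = t′} (wp-blk (lt-true {V} {N} {s} eV (Forest.regN F) k<n ,
            mk s′ ex pr (wp-post (λ { _ (ρ′ , le′ , F″) → ρ′ , bound t t′ ρ₁ ρ′ le₁ le′ , F″ }) w)))
          where
          bound : ∀ t t′ ρ₁ ρ′ → t ℕ.+ 650 ℕ.* ρ₁ ≤ 10 ℕ.+ 650 ℕ.* ρ → t′ ℕ.+ 650 ℕ.* ρ′ ≤ (r ℕ.* 12 ℕ.+ 2) ℕ.+ 650 ℕ.* ρ₁ →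
                  ((t ℕ.+ 2) ℕ.+ t′) ℕ.+ 650 ℕ.* ρ′ ≤ (suc r ℕ.* 12 ℕ.+ 2) ℕ.+ 650 ℕ.* ρ
          bound t t′ ρ₁ ρ′ p q = begin
            ((t ℕ.+ 2) ℕ.+ t′) ℕ.+ 650 ℕ.* ρ′             ≡⟨ ℕₚ.+-assoc (t ℕ.+ 2) t′ _ ⟩
            (t ℕ.+ 2) ℕ.+ (t′ ℕ.+ 650 ℕ.* ρ′)             ≤⟨ ℕₚ.+-monoʳ-≤ (t ℕ.+ 2) q ⟩
            (t ℕ.+ 2) ℕ.+ ((r ℕ.* 12 ℕ.+ 2) ℕ.+ 650 ℕ.* ρ₁) ≡⟨ solve 3 (λ t x y → (t :+ con 2) :+ (x :+ y) := (con 2 :+ x) :+ (t :+ y)) refl t (r ℕ.* 12 ℕ.+ 2) (650 ℕ.* ρ₁) ⟩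
            (2 ℕ.+ (r ℕ.* 12 ℕ.+ 2)) ℕ.+ (t ℕ.+ 650 ℕ.* ρ₁) ≤⟨ ℕₚ.+-monoʳ-≤ (2 ℕ.+ (r ℕ.* 12 ℕ.+ 2)) p ⟩
            (2 ℕ.+ (r ℕ.* 12 ℕ.+ 2)) ℕ.+ (10 ℕ.+ 650 ℕ.* ρ) ≡⟨ solve 2 (λ x y → (con 2 :+ (x :+ con 2)) :+ (con 10 :+ y) := ((con 12 :+ x) :+ con 2) :+ y) refl (r ℕ.* 12) (650 ℕ.* ρ) ⟩
            (suc r ℕ.* 12 ℕ.+ 2) ℕ.+ 650 ℕ.* ρ            ∎
            where
            open ℕₚ.≤-Reasoning
            open +-*-Solver

      -- The pass over level `suc d` leads from `Above (suc d)` to `Above d`, and under `Above 0`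
      -- only the root is unmerged.
      mergeLoop-wp : ∀ d {ρ s} → rN s Lev ≡ d → Forest s (Above d) ρ →
        Timed mergeLoop (Outcome (Above 0) (d ℕ.* (n ℕ.* 12 ℕ.+ 8) ℕ.+ 3) ρ) s
      mergeLoop-wp zero {s = s} eL F = 3 , wp-while-exit (wp-blk (lt-false {Tmp} {Lev} {s₀} refl eL z≤n , _ , ℕₚ.≤-refl ,
        forest-move {s} {s₀} refl refl refl refl refl (λ _ → id) (λ _ → id) F))
        where
        s₀ : Store
        s₀ = effs (setᴺ Tmp 0 ∷ []) s
      mergeLoop-wp (suc d) {ρ} {s} eL F = again body
        where
        s₀ s₁ : Store
        s₀ = effs (setᴺ Tmp 0 ∷ []) s
        s₁ = effs (setᴺ V 0 ∷ []) s₀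
        bodyCmd : Cmd
        bodyCmd = blk (setᴺ V 0 ∷ []) ⨾ levelLoop ⨾ blk (setᴺ Tmp 1 ∷ subᴺ Lev Lev Tmp ∷ [])
        Body : ℕ → Store → Set (c Level.⊔ ℓ₁ Level.⊔ ℓ₂)
        Body t s′ = Outcome (Above d) (n ℕ.* 12 ℕ.+ 5) ρ t s′ × rN s′ Lev ≡ d
        body : Timed bodyCmd Body s₀
        body = timed-⨾ {P = λ t s′ → s′ ≡ s₁ × t ≡ 1} (1 , wp-blk (refl , refl)) λ { {s′} .1 _ (refl , refl) →
          timed-⨾ (level-wp n 0 {suc d} {ρ} {s₁} refl (s≤s z≤n) refl eL
              (forest-move {s} {s₁} refl refl refl refl refl (λ _ → inj₁) (λ { _ (inj₁ p) → p ; _ (inj₂ (_ , ())) }) F))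
            λ { {s₂} t pr (ρ′ , le′ , F₂) → 2 , wp-blk ((ρ′ , bound t ρ′ le′ ,
              forest-move {s₂} {effs (setᴺ Tmp 1 ∷ subᴺ Lev Lev Tmp ∷ []) s₂} refl refl refl refl refl
                (λ { _ (inj₁ p) → ℕₚ.<-trans (ℕₚ.n<1+n d) p ; _ (inj₂ (e , _)) → ℕₚ.≤-reflexive (sym e) })
                (λ z p → [ inj₁ , (λ e → inj₂ (sym e , Finₚ.toℕ<n z)) ]′ (ℕₚ.m≤n⇒m<n∨m≡n p)) F₂) ,
              cong (ℕ._∸ 1) (trans (Preserved.regᴺ pr Lev refl) eL)) } }
          where
          bound : ∀ t ρ′ → t ℕ.+ 650 ℕ.* ρ′ ≤ (n ℕ.* 12 ℕ.+ 2) ℕ.+ 650 ℕ.* ρ → (1 ℕ.+ (t ℕ.+ 2)) ℕ.+ 650 ℕ.* ρ′ ≤ (n ℕ.* 12 ℕ.+ 5) ℕ.+ 650 ℕ.* ρ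
          bound t ρ′ p = ℕₚ.≤-trans (ℕₚ.≤-reflexive (solve 2 (λ t x → (con 1 :+ (t :+ con 2)) :+ x := con 3 :+ (t :+ x)) refl t (650 ℕ.* ρ′)))
            (ℕₚ.≤-trans (ℕₚ.+-monoʳ-≤ 3 p) (ℕₚ.≤-reflexive (solve 2 (λ x y → con 3 :+ ((x :+ con 2) :+ y) := (x :+ con 5) :+ y) refl (n ℕ.* 12) (650 ℕ.* ρ))))
            where open +-*-Solver
        again : Timed bodyCmd Body s₀ → Timed mergeLoop (Outcome (Above 0) (suc d ℕ.* (n ℕ.* 12 ℕ.+ 8) ℕ.+ 3) ρ) s
        again (t , mk s′ ex pr ((ρ₁ , le₁ , F′) , eL′)) =
          let t′ , w = mergeLoop-wp d eL′ F′ in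
          (1 ℕ.+ t ℕ.+ 2) ℕ.+ t′ , wp-while-again {τ₁ = 1} {τ₂ = t} {τ₃ = t′} (wp-blk (lt-true {Tmp} {Lev} {s₀} refl eL (s≤s z≤n) ,
            mk s′ ex pr (wp-post (λ { _ (ρ′ , le′ , F″) → ρ′ , bound t t′ ρ₁ ρ′ le₁ le′ , F″ }) w)))
          where
          bound : ∀ t t′ ρ₁ ρ′ → t ℕ.+ 650 ℕ.* ρ₁ ≤ (n ℕ.* 12 ℕ.+ 5) ℕ.+ 650 ℕ.* ρ → t′ ℕ.+ 650 ℕ.* ρ′ ≤ (d ℕ.* (n ℕ.* 12 ℕ.+ 8) ℕ.+ 3) ℕ.+ 650 ℕ.* ρ₁ →
                  ((1 ℕ.+ t ℕ.+ 2) ℕ.+ t′) ℕ.+ 650 ℕ.* ρ′ ≤ (suc d ℕ.* (n ℕ.* 12 ℕ.+ 8) ℕ.+ 3) ℕ.+ 650 ℕ.* ρ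
          bound t t′ ρ₁ ρ′ p q = begin
            ((1 ℕ.+ t ℕ.+ 2) ℕ.+ t′) ℕ.+ 650 ℕ.* ρ′   ≡⟨ ℕₚ.+-assoc (1 ℕ.+ t ℕ.+ 2) t′ _ ⟩
            (1 ℕ.+ t ℕ.+ 2) ℕ.+ (t′ ℕ.+ 650 ℕ.* ρ′)   ≤⟨ ℕₚ.+-monoʳ-≤ (1 ℕ.+ t ℕ.+ 2) q ⟩
            (1 ℕ.+ t ℕ.+ 2) ℕ.+ (x ℕ.+ 650 ℕ.* ρ₁)    ≡⟨ solve 3 (λ t x y → (con 1 :+ t :+ con 2) :+ (x :+ y) := (con 3 :+ x) :+ (t :+ y)) refl t x (650 ℕ.* ρ₁) ⟩
            (3 ℕ.+ x) ℕ.+ (t ℕ.+ 650 ℕ.* ρ₁)          ≤⟨ ℕₚ.+-monoʳ-≤ (3 ℕ.+ x) p ⟩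
            (3 ℕ.+ x) ℕ.+ ((n ℕ.* 12 ℕ.+ 5) ℕ.+ 650 ℕ.* ρ)
              ≡⟨ solve 3 (λ y m z → (con 3 :+ (y :+ con 3)) :+ ((m :+ con 5) :+ z) := (((m :+ con 8) :+ y) :+ con 3) :+ z) refl (d ℕ.* (n ℕ.* 12 ℕ.+ 8)) (n ℕ.* 12) (650 ℕ.* ρ) ⟩
            (suc d ℕ.* (n ℕ.* 12 ℕ.+ 8) ℕ.+ 3) ℕ.+ 650 ℕ.* ρ ∎
            where
            open ℕₚ.≤-Reasoning
            open +-*-Solver
            x : ℕ
            x = d ℕ.* (n ℕ.* 12 ℕ.+ 8) ℕ.+ 3

-- Reading off an optimal set and its value.

module Output where
  open Field
  open Hull
  open Machine
  open Prog
  open Scan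
  open Rows
  open Plan
  open Merge
  open Tree
  open Bridge
  open Grove
  open import Data.Bool.Base using (Bool; true; false; if_then_else_; _∨_)
  open import Data.Empty using (⊥; ⊥-elim)
  open import Data.Fin.Base as Fin using (Fin; toℕ)
  import Data.Fin.Properties as Finₚ
  open import Data.Fin.Subset using (Subset)
  open import Data.List.Base using (List; []; _∷_; _∷ʳ_)
  open import Data.List.Membership.Propositional using (find) renaming (_∈_ to _∈ᴸ_)
  open import Data.List.Membership.Propositional.Properties using (∈-++⁺ʳ)
  open import Data.List.Relation.Unary.All as All using (All; []; _∷_)
  open import Data.List.Relation.Unary.Any using (here)
  open import Data.Nat.Base as ℕ using (ℕ; zero; suc; _≤_; _<_; s≤s)
  import Data.Nat.Properties as ℕₚ
  open import Data.Nat.Solver using (module +-*-Solver)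
  open import Data.Product.Base using (_×_; _,_; proj₁; proj₂)
  open import Data.Vec.Base using (lookup; tabulate)
  open import Data.Vec.Properties using (lookup∘tabulate)
  open import Function.Base using (_∘_)
  import Level
  open import Relation.Binary.PropositionalEquality as ≡ using (_≡_; refl; sym; trans; cong; cong₂; subst; subst₂)
  open import Relation.Nullary using (¬_; does)
  open import Relation.Nullary.Decidable using (dec-true)

  popItem pushItems outHead : List Instr
  popItem   = setᴺ Tmp 1 ∷ subᴺ Heap Heap Tmp ∷ loadᴺ Adr Heap ∷ loadᴺ L Adr ∷ addᴺ Adr Tmp Adr ∷ loadᴺ R Adr ∷ []
  pushItems = storeᴺ Heap L ∷ addᴺ Heap Tmp Heap ∷ storeᴺ Heap R ∷ addᴺ Heap Tmp Heap ∷ []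
  outHead   = addᴺ Adr N Root ∷ addᴺ Adr N Adr ∷ loadᴺ Adr Adr ∷ setᴺ Tmp 2 ∷ subᴺ Adr Adr Tmp ∷ loadᶠ 0 Adr ∷
              moveᴺ Base Heap ∷ storeᴺ Heap Adr ∷ setᴺ Tmp 1 ∷ addᴺ Heap Tmp Heap ∷ []

  -- A traversal with a worklist of addresses kept above `Base`. A first component below `n` marks a
  -- leaf, as pointers are at least `lo`. The bits overwrite the parent array, which is no longer
  -- read.
  outLoop outCmd : Cmd
  outLoop = while skip (lt Base Heap) (blk popItem ⨾ cond (lt L N) (blk (storeᴺ L R ∷ [])) (blk pushItems))
  outCmd  = blk outHead ⨾ outLoop

  visits : ∀ {n} → Plan n → ℕ
  visits (leaf v)   = 1
  visits (edge v p) = visits p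
  visits (p ⊗ q)    = suc (visits q ℕ.+ visits p)

  -- A binary tree has one inner node less than it has leaves.
  visits-≤ : ∀ {n} (p : Plan n) → suc (visits p) ≤ 2 ℕ.* leaves p
  visits-≤ (leaf v)   = ℕₚ.≤-refl
  visits-≤ (edge v p) = visits-≤ p
  visits-≤ (p ⊗ q)    = ℕₚ.≤-trans (ℕₚ.≤-reflexive (solve 2 (λ x y → con 1 :+ (con 1 :+ (y :+ x)) := (con 1 :+ x) :+ (con 1 :+ y)) refl (visits p) (visits q)))
    (ℕₚ.≤-trans (ℕₚ.+-mono-≤ (visits-≤ p) (visits-≤ q)) (ℕₚ.≤-reflexive (sym (ℕₚ.*-distribˡ-+ 2 (leaves p) (leaves q)))))
    where open +-*-Solver

  -- For nodes outside the plan the bit is arbitrary.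
  pick : ∀ {n} (p : Plan n) → Choice p → Fin n → Bool
  pick (leaf v)   b       z = b
  pick (edge v p) σ       z = pick p σ z
  pick (p ⊗ q)    (σ , τ) z = if inPlan p z then pick p σ z else pick q τ z

  restrict-pick : ∀ {n} (S : Subset n) (p : Plan n) σ → Distinct p → (∀ z → inPlan p z ≡ true → lookup S z ≡ pick p σ z) → restrict S p ≡ σ
  restrict-pick S (leaf v)   b       _ f = f v (dec-true (v Finₚ.≟ v) refl)
  restrict-pick S (edge v p) σ       d f = restrict-pick S p σ d f
  restrict-pick S (p ⊗ q)    (σ , τ) (disjoint , dp , dq) f = cong₂ _,_
    (restrict-pick S p σ dp λ z z∈ → trans (f z (cong (_∨ inPlan q z) z∈)) (cong (λ b → if b then pick p σ z else pick q τ z) z∈))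
    (restrict-pick S q τ dq λ z z∈ → trans (f z (trans (cong (_∨ inPlan q z) (outside z z∈)) z∈))
       (cong (λ b → if b then pick p σ z else pick q τ z) (outside z z∈)))
    where
    outside : ∀ z → inPlan q z ≡ true → inPlan p z ≡ false
    outside z z∈ with inPlan p z in e
    ... | true  = ⊥-elim (disjoint z e z∈)
    ... | false = refl

  module Outputs {c ℓ₁ ℓ₂} (K : OrderedField c ℓ₁ ℓ₂) {n} (inst : Instance K n) where
    open Machines K
    open Programs K
    open Merges K inst

    private
      bit : Bool → ℕ
      bit b = if b then 1 else 0

      node<lo : ∀ (v : Fin n) → toℕ v < lo
      node<lo v = ℕₚ.≤-trans (Finₚ.toℕ<n v) (ℕₚ.m≤m+n n _)

    -- One item of the worklist, at address h, has been processed.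
    record Visited (p : Plan n) (σ : Choice p) (h : ℕ) (s s′ : Store) : Set c where
      field
        regHeap : rN s′ Heap ≡ h
        regBase : rN s′ Base ≡ rN s Base
        regN    : rN s′ N ≡ rN s N
        result  : rF s′ 0 ≡ rF s 0
        kept    : ∀ a → lo ≤ a → a < h → mN s′ a ≡ mN s a
        written : ∀ z → inPlan p z ≡ true → mN s′ (toℕ z) ≡ bit (pick p σ z)
        unread  : ∀ z → inPlan p z ≡ false → mN s′ (toℕ z) ≡ mN s (toℕ z)

    abstract
      -- `m` is the memory before the output. The loop writes only below `lo` and, for its worklist,
      -- from `base` on, so pointers may be followed in `m`. The rest of the loop is a continuation
      -- with time `τ`, which lets the proof recurse on the plan although the loop sees only a
      -- stack.
      visit-wp : ∀ {a} {Q : Store → Set a} (p : Plan n) {σ : Choice p} {m : ℕ → ℕ} {base h x τ s} →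
        Denotes m lo base p σ (m x) (m (suc x)) → lo ≤ x → 2 ℕ.+ x ≤ base → base ≤ h →
        rN s N ≡ n → rN s Base ≡ base → rN s Heap ≡ suc h → mN s h ≡ x → (∀ a → lo ≤ a → a < base → mN s a ≡ m a) →
        (∀ {s′} → Visited p σ h s s′ → wp outLoop τ Q s′) → wp outLoop (visits p ℕ.* 14 ℕ.+ τ) Q s
      visit-wp (edge v p) d lo≤ ≤base b≤h eN eB eH ex same continue =
        visit-wp p d lo≤ ≤base b≤h eN eB eH ex same (λ V → continue record
          { regHeap = Visited.regHeap V ; regBase = Visited.regBase V ; regN = Visited.regN V ; result = Visited.result V
          ; kept = Visited.kept V ; written = Visited.written V ; unread = Visited.unread V })
      visit-wp {Q = Q} (leaf v) {σ} {m} {base} {h} {x} {τ} {s} (dl , dr) lo≤ ≤base b≤h eN eB eH ex same continue =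
        wp-≤ (ℕₚ.+-monoˡ-≤ τ (≤! 11 14)) (wp-while-again {τ₁ = 0} {τ₂ = 9} {τ₃ = τ} (wp-blk (lt-true {Base} {Heap} {s} eB eH (s≤s b≤h) ,
          wp-⨾ (wp-blk (wp-cond-true (lt-true {L} {N} {s₁} eL eN (Finₚ.toℕ<n v)) (wp-blk (continue visited)))))))
        where
        s₁ s₂ : Store
        s₁ = effs popItem s
        s₂ = effs (storeᴺ L R ∷ []) s₁
        eItem : mN s (rN s Heap ℕ.∸ 1) ≡ x
        eItem = trans (cong (λ k → mN s (k ℕ.∸ 1)) eH) ex
        eL : mN s (mN s (rN s Heap ℕ.∸ 1)) ≡ toℕ v
        eL = trans (cong (mN s) eItem) (trans (same x lo≤ (ℕₚ.≤-trans (ℕₚ.n≤1+n (suc x)) ≤base)) dl)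
        eR : mN s (suc (mN s (rN s Heap ℕ.∸ 1))) ≡ bit σ
        eR = trans (cong (λ k → mN s (suc k)) eItem) (trans (same (suc x) (ℕₚ.m≤n⇒m≤1+n lo≤) ≤base) dr)
        mem : ∀ k → mN s₂ k ≡ (mN s [ toℕ v ≔ bit σ ]) k
        mem k = cong₂ (λ a b → (mN s [ a ≔ b ]) k) eL eR
        visited : Visited (leaf v) σ h s s₂
        visited = record
          { regHeap = cong (ℕ._∸ 1) eH ; regBase = refl ; regN = refl ; result = refl
          ; kept = λ a lo≤a _ → trans (mem a) (≔-other (mN s) {toℕ v} {bit σ} {a} (ℕₚ.>⇒≢ (ℕₚ.≤-trans (node<lo v) lo≤a)))
          ; written = λ z z∈ → at-leaf z (does⇒ (z Finₚ.≟ v) z∈)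
          ; unread = λ z z∉ → trans (mem (toℕ z)) (≔-other (mN s) {toℕ v} {bit σ} {toℕ z} (λ e → absurd z z∉ (Finₚ.toℕ-injective e))) }
          where
          at-leaf : ∀ z → z ≡ v → mN s₂ (toℕ z) ≡ bit σ
          at-leaf z refl = trans (mem (toℕ v)) (≔-same (mN s) (toℕ v) (bit σ))
          absurd : ∀ z → does (z Finₚ.≟ v) ≡ false → z ≡ v → ⊥
          absurd z e refl with trans (sym e) (dec-true (v Finₚ.≟ v) refl)
          ... | ()
      visit-wp {Q = Q} (p ⊗ q) {σ , ς} {m} {base} {h} {x} {τ} {s} ((lo≤l , l≤ , dl) , (lo≤r , r≤ , dr)) lo≤ ≤base b≤h eN eB eH ex same continue =
        wp-≤ (ℕₚ.≤-reflexive (cong (14 ℕ.+_) (trans (sym (ℕₚ.+-assoc (visits q ℕ.* 14) (visits p ℕ.* 14) τ))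
                (cong (ℕ._+ τ) (sym (ℕₚ.*-distribʳ-+ 14 (visits q) (visits p)))))))
          (wp-while-again {τ₁ = 0} {τ₂ = 12} {τ₃ = visits q ℕ.* 14 ℕ.+ (visits p ℕ.* 14 ℕ.+ τ)} (wp-blk (lt-true {Base} {Heap} {s} eB eH (s≤s b≤h) ,
            wp-⨾ (wp-blk (wp-cond-false (lt-false {L} {N} {s₁} eL eN (ℕₚ.≤-trans (ℕₚ.m≤m+n n _) lo≤l)) (wp-blk {Q = wp outLoop _ Q}
              -- The right item was pushed last and is taken first.
              (visit-wp q {ς} {m} {base} {suc h} dr lo≤r r≤ (ℕₚ.m≤n⇒m≤1+n b≤h) eN eB (cong (λ k → 2 ℕ.+ (k ℕ.∸ 1)) eH) item-r same₂ λ {s₃} V₃ →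
               visit-wp p {σ} {m} {base} {h} dl lo≤l l≤ b≤h (trans (Visited.regN V₃) eN) (trans (Visited.regBase V₃) eB) (Visited.regHeap V₃)
                 (trans (Visited.kept V₃ h (ℕₚ.≤-trans (ℕₚ.≤-trans lo≤ (ℕₚ.≤-trans (ℕₚ.m≤n+m x 2) ≤base)) b≤h) ℕₚ.≤-refl) item-l)
                 (λ a lo≤a a< → trans (Visited.kept V₃ a lo≤a (ℕₚ.≤-trans a< (ℕₚ.m≤n⇒m≤1+n b≤h))) (same₂ a lo≤a a<)) λ {s₄} V₄ →
               continue (visited V₃ V₄))))))))
        where
        s₁ s₂ : Store
        s₁ = effs popItem s
        s₂ = effs pushItems s₁
        eItem : mN s (rN s Heap ℕ.∸ 1) ≡ x
        eItem = trans (cong (λ k → mN s (k ℕ.∸ 1)) eH) ex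
        eL : mN s (mN s (rN s Heap ℕ.∸ 1)) ≡ m x
        eL = trans (cong (mN s) eItem) (same x lo≤ (ℕₚ.≤-trans (ℕₚ.n≤1+n (suc x)) ≤base))
        eR : mN s (suc (mN s (rN s Heap ℕ.∸ 1))) ≡ m (suc x)
        eR = trans (cong (λ k → mN s (suc k)) eItem) (same (suc x) (ℕₚ.m≤n⇒m≤1+n lo≤) ≤base)
        mem : ∀ k → mN s₂ k ≡ ((mN s [ h ≔ m x ]) [ suc h ≔ m (suc x) ]) k
        mem k = ≡.trans (cong₂ (λ a b → ((mN s [ rN s Heap ℕ.∸ 1 ≔ a ]) [ suc (rN s Heap ℕ.∸ 1) ≔ b ]) k) eL eR)
          (cong (λ a → ((mN s [ a ≔ m x ]) [ suc a ≔ m (suc x) ]) k) (cong (ℕ._∸ 1) eH))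
        item-l : mN s₂ h ≡ m x
        item-l = trans (mem h) (write-fst (mN s) h (m x) (m (suc x)))
        item-r : mN s₂ (suc h) ≡ m (suc x)
        item-r = trans (mem (suc h)) (write-snd (mN s) h (m x) (m (suc x)))
        below : ∀ a → a < h → mN s₂ a ≡ mN s a
        below a a< = trans (mem a) (write-below (mN s) a< (m x) (m (suc x)))
        same₂ : ∀ a → lo ≤ a → a < base → mN s₂ a ≡ m a
        same₂ a lo≤a a< = trans (below a (ℕₚ.≤-trans a< b≤h)) (same a lo≤a a<)
        node<h : ∀ (z : Fin n) → toℕ z < h
        node<h z = ℕₚ.≤-trans (node<lo z) (ℕₚ.≤-trans (ℕₚ.≤-trans lo≤ (ℕₚ.≤-trans (ℕₚ.m≤n+m x 2) ≤base)) b≤h)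
        visited : ∀ {s₃ s₄} → Visited q ς (suc h) s₂ s₃ → Visited p σ h s₃ s₄ → Visited (p ⊗ q) (σ , ς) h s s₄
        visited {s₃} {s₄} V₃ V₄ = record
          { regHeap = V₄.regHeap ; regBase = trans V₄.regBase V₃.regBase ; regN = trans V₄.regN V₃.regN ; result = trans V₄.result V₃.result
          ; kept = λ a lo≤a a< → trans (V₄.kept a lo≤a a<) (trans (V₃.kept a lo≤a (ℕₚ.m<n⇒m<1+n a<)) (below a a<))
          ; written = written
          ; unread = unread }
          where
          module V₃ = Visited V₃
          module V₄ = Visited V₄
          written : ∀ z → inPlan (p ⊗ q) z ≡ true → mN s₄ (toℕ z) ≡ bit (pick (p ⊗ q) (σ , ς) z)
          written z z∈ with inPlan p z in e
          ... | true  = V₄.written z e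
          ... | false = trans (V₄.unread z e) (V₃.written z z∈)
          unread : ∀ z → inPlan (p ⊗ q) z ≡ false → mN s₄ (toℕ z) ≡ mN s (toℕ z)
          unread z z∉ with inPlan p z in e
          ... | false = trans (V₄.unread z e) (trans (V₃.unread z z∉) (below (toℕ z) (node<h z)))

    open OrderedField K using (Carrier; 0#; _≈_; _*_; _+_) renaming (_≤_ to _≤ᶠ_)
    module ≈ = OrderedField K
    open FieldProperties K using (≤-trans; ≤-respʳ-≈; ≤-respˡ-≈) renaming (≤-refl to ≤ᶠ-refl)
    open Hulls K
    open RowLoops K
    open Plans K inst
    open Bridges K inst
    open Forests K inst
    open Instance inst
    open Depths tree

    record Answer (s : Store) : Set (c Level.⊔ ℓ₁ Level.⊔ ℓ₂) where
      field
        chosen  : Subset n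
        bits    : ∀ v → mN s (toℕ v) ≡ (if lookup chosen v then 1 else 0)
        optimal : Optimal chosen
        worth   : rF s 0 ≈ G chosen 0#

    total-≥ : ∀ {m} (f : Fin m → ℕ) z → f z ≤ total f
    total-≥ f Fin.zero    = ℕₚ.m≤m+n _ _
    total-≥ f (Fin.suc z) = ℕₚ.≤-trans (total-≥ (f ∘ Fin.suc) z) (ℕₚ.m≤n+m _ _)

    abstract
      -- Every subset acts on the plan of the root as some choice. Coverage at `y = 0` bounds its
      -- profit by that of an entry, and `Peak` bounds all entries by the last.
      outCmd-wp : ∀ {s ρ} → Forest s (λ z → 0 < depth z) ρ → wp outCmd (28 ℕ.* n ℕ.+ 12) Answer s
      outCmd-wp {s} {ρ} F = wp-≤ bound (wp-⨾ (wp-blk (visit-wp p {choice t} {mN s} {rN s Heap} {rN s Heap} {end a xs} {2} {s₁}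
          denotes lo≤x x≤ ℕₚ.≤-refl F.regN refl refl item (λ k _ k< → ≔-other (mN s) {rN s Heap} (ℕₚ.<⇒≢ k<))
          (λ {s₂} V → wp-while-exit (wp-blk (lt-false {Base} {Heap} {s₂} (Visited.regBase V) (Visited.regHeap V) ℕₚ.≤-refl , answer V))))))
        where
        module F = Forest F
        ¬M : ¬ (0 < depth root)
        ¬M p = ℕₚ.<⇒≢ p (sym depth-root)
        p : Plan n
        p = F.plan root
        H : Held s lo (mN s (startAt root)) (mN s (stopAt root)) p
        H = proj₁ (F.held root ¬M)
        module H = Held H
        a : ℕ
        a = mN s (startAt root)
        pk : Peak (H.x₀ ∷ H.xs)
        pk = proj₂ (F.held root ¬M)
        xs : List (Point (Choice p))
        xs = proj₁ pk
        t : Point (Choice p)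
        t = proj₁ (proj₂ pk)
        eq : H.x₀ ∷ H.xs ≡ xs ∷ʳ t
        eq = proj₁ (proj₂ (proj₂ pk))
        last : PointAt s (end a xs) t × end a (xs ∷ʳ t) ≡ 2 ℕ.+ end a xs
        last = segment-last xs (subst (Segment s a) eq H.segment)
        stop≡ : mN s (stopAt root) ≡ 2 ℕ.+ end a xs
        stop≡ = trans H.stop (trans (cong (end a) eq) (proj₂ last))
        s₁ : Store
        s₁ = effs outHead s
        address : mN s (rN s N ℕ.+ (rN s N ℕ.+ rN s Root)) ℕ.∸ 2 ≡ end a xs
        address = cong (ℕ._∸ 2) (trans (cong (mN s) (cong₂ ℕ._+_ F.regN (cong₂ ℕ._+_ F.regN F.regRoot))) stop≡)
        item : mN s₁ (rN s Heap) ≡ end a xs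
        item = trans (≔-same (mN s) (rN s Heap) _) address
        lo≤x : lo ≤ end a xs
        lo≤x = ℕₚ.≤-trans H.low (end-≥ a xs)
        x≤ : 2 ℕ.+ end a xs ≤ rN s Heap
        x≤ = subst (_≤ rN s Heap) stop≡ H.below
        denotes : Denotes (mN s) lo (rN s Heap) p (choice t) (mN s (end a xs)) (mN s (suc (end a xs)))
        denotes = subst₂ (Denotes (mN s) lo (rN s Heap) p (choice t)) (sym (leftᵃ (proj₁ last))) (sym (rightᵃ (proj₁ last)))
          (All.lookup (subst (All _) eq H.denotes) (∈-++⁺ʳ xs (here refl)))
        bound : 10 ℕ.+ (visits p ℕ.* 14 ℕ.+ 2) ≤ 28 ℕ.* n ℕ.+ 12
        bound = ℕₚ.≤-trans (ℕₚ.≤-reflexive (solve 1 (λ x → con 10 :+ (x :* con 14 :+ con 2) := con 14 :* x :+ con 12) refl (visits p)))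
          (ℕₚ.+-monoˡ-≤ 12 (ℕₚ.≤-trans (ℕₚ.*-monoʳ-≤ 14 (ℕₚ.≤-trans (ℕₚ.n≤1+n _) (ℕₚ.≤-trans (visits-≤ p) (ℕₚ.*-monoʳ-≤ 2 leaves≤))))
            (ℕₚ.≤-reflexive (solve 1 (λ x → con 14 :* (con 2 :* x) := con 28 :* x) refl n))))
          where
          open +-*-Solver
          leaves≤ : leaves p ≤ n
          leaves≤ = ℕₚ.≤-trans (ℕₚ.≤-reflexive (sym (F.extents root ¬M))) (subst (F.extent root ≤_) F.total≡ (total-≥ F.extent root))
        everywhere : ∀ z → inPlan p z ≡ true
        everywhere z with F.covered z
        ... | u , ¬Mu , z∈ = subst (λ u → inPlan (F.plan u) z ≡ true) (depth≡0⇒root (ℕₚ.n≤0⇒n≡0 (ℕₚ.≮⇒≥ ¬Mu))) z∈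
        S : Subset n
        S = tabulate (pick p (choice t))
        restrict≡ : restrict S p ≡ choice t
        restrict≡ = restrict-pick S p (choice t) (F.distinct root ¬M) (λ z _ → lookup∘tabulate (pick p (choice t)) z)
        G≈ : ∀ S → G S 0# ≈ planProfit p (restrict S p)
        G≈ = G≈planProfit {p} (F.measures root ¬M) everywhere
        t∈ : t ∈ᴸ H.x₀ ∷ H.xs
        t∈ = subst (t ∈ᴸ_) (sym eq) (∈-++⁺ʳ xs (here refl))
        worth≈ : profit t ≈ G S 0#
        worth≈ = ≈.trans (proj₁ (All.lookup (Chain.exact H.chain) t∈))
          (≈.sym (≈.trans (G≈ S) (≈.reflexive (cong (planProfit p) restrict≡))))
        best : ∀ σ → planProfit p σ ≤ᶠ profit t
        best σ with find (Chain.covers H.chain σ {0#} ≤ᶠ-refl)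
        ... | x , x∈ , bound = ≤-trans (≤-respˡ-≈ (drop-zero _ _) (≤-respʳ-≈ (drop-zero _ _) bound))
                                 (All.lookup (proj₂ (proj₂ (proj₂ pk))) x∈)
          where
          drop-zero : ∀ c q → c + 0# * q ≈ c
          drop-zero c q = ≈.trans (≈.+-congˡ (≈.zeroˡ q)) (≈.+-identityʳ c)
        answer : ∀ {s₂} → Visited p (choice t) (rN s Heap) s₁ s₂ → Answer s₂
        answer {s₂} V = record
          { chosen = S
          ; bits = λ v → trans (Visited.written V v (everywhere v)) (cong bit (sym (lookup∘tabulate (pick p (choice t)) v)))
          ; optimal = λ S′ → ≤-respˡ-≈ (≈.sym (G≈ S′)) (≤-respʳ-≈ worth≈ (best (restrict S′ p)))
          ; worth = ≈.trans (≈.reflexive (trans (Visited.result V) (trans (cong (mF s) address) (profitᵃ (proj₁ last))))) worth≈ }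

-- Initialisation: depths and trees of single nodes.

module Init where
  open Field
  open Hull
  open Machine
  open Prog
  open Scan
  open Rows
  open Plan
  open Merge
  open Tree
  open Bridge
  open Grove
  open Levels
  open Output
  open import Data.Fin.Base using (Fin; toℕ)
  import Data.Fin.Properties as Finₚ
  open import Data.List.Base using (List; []; _∷_)
  open import Data.List.Relation.Unary.All using ([]; _∷_)
  open import Data.Nat.Base as ℕ using (ℕ; zero; suc; _≤_; _<_; z≤n; s≤s)
  import Data.Nat.Properties as ℕₚ
  open import Data.Product.Base using (_,_; proj₁; proj₂)
  open import Data.Bool.Base using (true; false)
  open import Function.Base using (_∘_)
  import Level
  open import Relation.Binary.PropositionalEquality using (_≡_; _≢_; refl; sym; trans; cong; cong₂; subst; subst₂)
  open import Relation.Nullary using (¬_; Dec; yes; no; does)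
  open import Relation.Nullary.Decidable using (dec-true; dec-false)

  -- The empty choice is always pushed, with profit 0 and miss probability 1; the choice of the node
  -- follows only if its expected prize is positive.
  leafHead leafPoint leafTail : List Instr
  leafHead  = addᴺ Adr N V ∷ addᴺ Adr N Adr ∷ addᴺ Adr N Adr ∷ storeᴺ Adr Lev ∷ addᴺ Adr N V ∷ storeᴺ Adr Heap ∷
              zeroᶠ 1 ∷ oneᶠ 2 ∷ moveᴺ L V ∷ setᴺ R 0 ∷ []
  leafPoint = addᴺ Adr N V ∷ loadᶠ 3 Adr ∷ oneᶠ 2 ∷ subᶠ 2 2 3 ∷ addᴺ Adr N Adr ∷ loadᶠ 4 Adr ∷ mulᶠ 1 4 3 ∷
              setᴺ R 1 ∷ zeroᶠ 5 ∷ []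
  leafTail  = addᴺ Adr N V ∷ addᴺ Adr N Adr ∷ storeᴺ Adr Heap ∷ setᴺ Tmp 1 ∷ addᴺ V Tmp V ∷ []

  depthLoop initBody initLoop initCmd mainCmd : Cmd
  -- The tests only compare by order; the two truncated differences add up to 0 exactly when `U` has
  -- reached the root.
  depthLoop = while (blk (subᴺ Tmp U Root ∷ subᴺ Adr Root U ∷ addᴺ Adr Tmp Adr ∷ setᴺ Tmp 0 ∷ [])) (lt Tmp Adr)
                (blk (loadᴺ U U ∷ setᴺ Tmp 1 ∷ addᴺ Lev Tmp Lev ∷ []))
  initBody  = blk (moveᴺ U V ∷ setᴺ Lev 0 ∷ []) ⨾ depthLoop ⨾ blk leafHead ⨾ blk push ⨾ blk leafPoint ⨾
                cond (le 1 5) skip (blk push) ⨾ blk leafTail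
  initLoop  = while skip (lt V N) initBody
  initCmd   = blk (addᴺ Heap N N ∷ addᴺ Heap N Heap ∷ addᴺ Heap N Heap ∷ setᴺ V 0 ∷ []) ⨾ initLoop ⨾ blk (moveᴺ Lev N ∷ [])
  mainCmd   = initCmd ⨾ mergeLoop ⨾ outCmd

  module Inits {c ℓ₁ ℓ₂} (K : OrderedField c ℓ₁ ℓ₂) {n} (inst : Instance K n) where
    open OrderedField K using (Carrier; 0#; 1#; _+_; _*_; _-_; _≤?_) renaming (_≤_ to _≤ᶠ_)
    open FieldProperties K using (<⇒≤) renaming (≤-refl to ≤ᶠ-refl)
    open Hulls K
    open Machines K
    open Programs K
    open Scans K
    open RowLoops K
    open Plans K inst
    open Merges K inst
    open Bridges K inst
    open Forests K inst
    open LevelLoops K inst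
    open Outputs K inst
    open Instance inst
    open Depths tree

    record Started (s : Store) (k : ℕ) : Set (c Level.⊔ ℓ₁ Level.⊔ ℓ₂) where
      field
        regN      : rN s N ≡ n
        regRoot   : rN s Root ≡ toℕ root
        regV      : rN s V ≡ k
        memParent : ∀ z → mN s (toℕ z) ≡ toℕ (parent z)
        memWeight : ∀ z → mF s (toℕ z) ≡ weight z
        memProb   : ∀ z → mF s (startAt z) ≡ probability z
        memPrize  : ∀ z → mF s (stopAt z) ≡ prize z
        heap≥     : lo ≤ rN s Heap
        memDepth  : ∀ z → toℕ z < k → mN s (depthAt z) ≡ depth z
        held      : ∀ z → toℕ z < k → Crowned s lo (mN s (startAt z)) (mN s (stopAt z)) (leaf z)

    abstract
      -- Each node walks to the root on its own, at 9 steps per edge. As depths are at most `n`,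
      -- this stays quadratic in total.
      depthLoop-wp : ∀ d {k u s} → depth u ≡ d → rN s U ≡ toℕ u → rN s Root ≡ toℕ root → rN s Lev ≡ k →
        (∀ z → mN s (toℕ z) ≡ toℕ (parent z)) → wp depthLoop (d ℕ.* 9 ℕ.+ 6) (λ s′ → rN s′ Lev ≡ k ℕ.+ d) s
      depthLoop-wp zero {k} {u} {s} ed eU eR eL eP = wp-while-exit (wp-blk (lt-false {Tmp} {Adr} {s₀} refl zero-distance z≤n ,
        trans eL (sym (ℕₚ.+-identityʳ k))))
        where
        s₀ : Store
        s₀ = effs (subᴺ Tmp U Root ∷ subᴺ Adr Root U ∷ addᴺ Adr Tmp Adr ∷ setᴺ Tmp 0 ∷ []) s
        same : rN s U ≡ rN s Root
        same = trans eU (trans (cong toℕ (depth≡0⇒root ed)) (sym eR))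
        zero-distance : (rN s U ℕ.∸ rN s Root) ℕ.+ (rN s Root ℕ.∸ rN s U) ≡ 0
        zero-distance = cong₂ ℕ._+_ (ℕₚ.m≤n⇒m∸n≡0 (ℕₚ.≤-reflexive same)) (ℕₚ.m≤n⇒m∸n≡0 (ℕₚ.≤-reflexive (sym same)))
      depthLoop-wp (suc d) {k} {u} {s} ed eU eR eL eP =
        wp-while-again {τ₁ = 4} {τ₂ = 3} {τ₃ = d ℕ.* 9 ℕ.+ 6} (wp-blk (lt-true {Tmp} {Adr} {s₀} refl refl positive ,
          wp-blk (wp-post (λ _ e → trans e (sym (ℕₚ.+-suc k d)))
            (depthLoop-wp d {suc k} {parent u} {s₁} (ℕₚ.suc-injective (trans (sym (depth-suc u≢r)) ed))
              (trans (cong (mN s) eU) (eP u)) eR (cong suc eL) eP))))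
        where
        s₀ s₁ : Store
        s₀ = effs (subᴺ Tmp U Root ∷ subᴺ Adr Root U ∷ addᴺ Adr Tmp Adr ∷ setᴺ Tmp 0 ∷ []) s
        s₁ = effs (loadᴺ U U ∷ setᴺ Tmp 1 ∷ addᴺ Lev Tmp Lev ∷ []) s₀
        u≢r : u ≢ root
        u≢r = positive⇒≢root (subst (1 ≤_) (sym ed) (s≤s z≤n))
        positive : 0 < (rN s U ℕ.∸ rN s Root) ℕ.+ (rN s Root ℕ.∸ rN s U)
        positive = ℕₚ.n≢0⇒n>0 λ e → u≢r (Finₚ.toℕ-injective (trans (sym eU) (trans
          (ℕₚ.≤-antisym (ℕₚ.m∸n≡0⇒m≤n (ℕₚ.m+n≡0⇒m≡0 (rN s U ℕ.∸ rN s Root) e))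
                        (ℕₚ.m∸n≡0⇒m≤n (ℕₚ.m+n≡0⇒n≡0 (rN s U ℕ.∸ rN s Root) e))) eR)))

    module _ {s} (v : Fin n) (St : Started s (toℕ v)) where
      private
        module St = Started St
        h : ℕ
        h = rN s Heap

        start<h : ∀ (z : Fin n) → startAt z < h
        start<h z = ℕₚ.≤-trans (ℕₚ.<-trans (start<stop z z) (ℕₚ.<-trans (stop<depth z z) (depth<lo z))) St.heap≥
        stop<h : ∀ (z : Fin n) → stopAt z < h
        stop<h z = ℕₚ.≤-trans (ℕₚ.<-trans (stop<depth z z) (depth<lo z)) St.heap≥
        depth<h : ∀ (z : Fin n) → depthAt z < h
        depth<h z = ℕₚ.≤-trans (depth<lo z) St.heap≥
        node<h : ∀ (z : Fin n) → toℕ z < h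
        node<h z = ℕₚ.<-trans (node<start z z) (start<h z)

      record Planted (s′ : Store) : Set (c Level.⊔ ℓ₁ Level.⊔ ℓ₂) where
        field
          regN    : rN s′ N ≡ n
          regRoot : rN s′ Root ≡ toℕ root
          regV    : rN s′ V ≡ toℕ v
          grow    : h ≤ rN s′ Heap
          sameᴺ   : ∀ a → a < h → a ≢ depthAt v → a ≢ startAt v → mN s′ a ≡ mN s a
          sameᶠ   : ∀ a → a < h → mF s′ a ≡ mF s a
          atDepth : mN s′ (depthAt v) ≡ depth v
          atStart : mN s′ (startAt v) ≡ h
          crowned : Crowned s′ lo h (rN s′ Heap) (leaf v)

      private abstract
        planted-started : ∀ {s′} → Planted s′ → Started (effs leafTail s′) (suc (toℕ v))
        planted-started {s′} Pl = record
          { regN = P.regN ; regRoot = P.regRoot ; regV = cong suc P.regV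
          ; memParent = λ z → trans (below (toℕ z) (node<h z) (ℕₚ.<⇒≢ (ℕₚ.<-trans (node<start z v) (ℕₚ.<-trans (start<stop v v) (stop<depth v v))))
              (ℕₚ.<⇒≢ (node<start z v)) (ℕₚ.<⇒≢ (ℕₚ.<-trans (node<start z v) (start<stop v v)))) (St.memParent z)
          ; memWeight = λ z → trans (P.sameᶠ _ (node<h z)) (St.memWeight z)
          ; memProb = λ z → trans (P.sameᶠ _ (start<h z)) (St.memProb z)
          ; memPrize = λ z → trans (P.sameᶠ _ (stop<h z)) (St.memPrize z)
          ; heap≥ = ℕₚ.≤-trans St.heap≥ P.grow
          ; memDepth = λ z z< → by-cases z z< (trans (mem (depthAt v)) (trans (≔-other (mN s′) {stopAt v} {rN s′ Heap} {depthAt v} (ℕₚ.>⇒≢ (stop<depth v v))) P.atDepth))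
              (λ z≢v z<v → trans (below (depthAt z) (depth<h z) (depth≢ z≢v) (ℕₚ.>⇒≢ (ℕₚ.<-trans (start<stop v z) (stop<depth z z)))
                 (ℕₚ.>⇒≢ (stop<depth v z))) (St.memDepth z z<v))
          ; held = λ z z< → by-cases z z< here-held (λ z≢v z<v →
              subst₂ (λ x y → Crowned s₁ lo x y (leaf z))
                (sym (below (startAt z) (start<h z) (ℕₚ.<⇒≢ (ℕₚ.<-trans (start<stop z v) (stop<depth v v))) (start≢ z≢v) (ℕₚ.<⇒≢ (start<stop z v))))
                (sym (below (stopAt z) (stop<h z) (ℕₚ.<⇒≢ (stop<depth z v)) (ℕₚ.>⇒≢ (start<stop v z)) (stop≢ z≢v)))
                (crowned-keep (λ a lo≤a a< → below a a< (ℕₚ.>⇒≢ (ℕₚ.≤-trans (depth<lo v) lo≤a))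
                    (ℕₚ.>⇒≢ (ℕₚ.≤-trans (ℕₚ.<-trans (start<stop v v) (ℕₚ.<-trans (stop<depth v v) (depth<lo v))) lo≤a))
                    (ℕₚ.>⇒≢ (ℕₚ.≤-trans (ℕₚ.<-trans (stop<depth v v) (depth<lo v)) lo≤a)) , P.sameᶠ a a<) P.grow (St.held z z<v))) }
          where
          module P = Planted Pl
          s₁ : Store
          s₁ = effs leafTail s′
          mem : ∀ a → mN s₁ a ≡ (mN s′ [ stopAt v ≔ rN s′ Heap ]) a
          mem a = cong (λ x → (mN s′ [ x ≔ rN s′ Heap ]) a) (cong₂ ℕ._+_ P.regN (cong₂ ℕ._+_ P.regN P.regV))
          below : ∀ a → a < h → a ≢ depthAt v → a ≢ startAt v → a ≢ stopAt v → mN s₁ a ≡ mN s a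
          below a a< ≢₁ ≢₂ ≢₃ = trans (mem a) (trans (≔-other (mN s′) {stopAt v} {rN s′ Heap} {a} ≢₃) (P.sameᴺ a a< ≢₁ ≢₂))
          depth≢ : ∀ {z} → z ≢ v → depthAt z ≢ depthAt v
          depth≢ z≢v e = stop≢ z≢v (ℕₚ.+-cancelˡ-≡ n _ _ e)
          by-cases : ∀ {a} {P : Fin n → Set a} z → toℕ z < suc (toℕ v) → P v → (z ≢ v → toℕ z < toℕ v → P z) → P z
          by-cases z z< Pv Pz with z Finₚ.≟ v
          ... | yes refl = Pv
          ... | no  z≢v  = Pz z≢v (ℕₚ.≤∧≢⇒< (ℕₚ.≤-pred z<) (z≢v ∘ Finₚ.toℕ-injective))
          here-held : Crowned s₁ lo (mN s₁ (startAt v)) (mN s₁ (stopAt v)) (leaf v)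
          here-held = subst₂ (λ x y → Crowned s₁ lo x y (leaf v))
            (sym (trans (mem (startAt v)) (trans (≔-other (mN s′) {stopAt v} {rN s′ Heap} {startAt v} (ℕₚ.<⇒≢ (start<stop v v))) P.atStart)))
            (sym (trans (mem (stopAt v)) (≔-same (mN s′) (stopAt v) (rN s′ Heap))))
            (crowned-keep {s′} {s₁} (λ a lo≤a _ → trans (mem a) (≔-other (mN s′) {stopAt v} {rN s′ Heap} {a}
               (ℕₚ.>⇒≢ (ℕₚ.≤-trans (ℕₚ.<-trans (stop<depth v v) (depth<lo v)) lo≤a))) , refl) ℕₚ.≤-refl P.crowned)

      abstract
        -- The 42 consists of 10 + 8 + 9 + 5 for the straight blocks and 10 for the conditional
        -- push.
        initBody-wp : wp initBody (2 ℕ.+ ((n ℕ.* 9 ℕ.+ 6) ℕ.+ 42)) (λ s′ → Started s′ (suc (toℕ v))) s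
        initBody-wp = wp-⨾ (wp-blk (wp-⨾ (wp-≤ (ℕₚ.+-monoˡ-≤ 6 (ℕₚ.*-monoˡ-≤ 9 (depth-≤ v))) (wp-post (λ {s₁} pr e → afterDepth {s₁} pr e)
            (depthLoop-wp (depth v) {0} {v} {s₀} refl St.regV St.regRoot refl St.memParent)))))
          where
          s₀ : Store
          s₀ = effs (moveᴺ U V ∷ setᴺ Lev 0 ∷ []) s
          Post : Store → Set (c Level.⊔ ℓ₁ Level.⊔ ℓ₂)
          Post s′ = Started s′ (suc (toℕ v))
          afterDepth : ∀ {s₁} → Preserved depthLoop s₀ s₁ → rN s₁ Lev ≡ depth v →
            wp (blk leafHead ⨾ blk push ⨾ blk leafPoint ⨾ cond (le 1 5) skip (blk push) ⨾ blk leafTail) 42 Post s₁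
          afterDepth {s₁} pr eLev = wp-⨾ (wp-blk (wp-⨾ (wp-blk (wp-⨾ (wp-blk (wp-⨾ (branch (x ≤? 0#))))))))
            where
            s₂ s₃ s₄ s₅ : Store
            s₂ = effs leafHead s₁
            s₃ = effs push s₂
            s₄ = effs leafPoint s₃
            s₅ = effs push s₄
            x : Carrier
            x = prize v * probability v
            eN : rN s₁ N ≡ n
            eN = trans (Preserved.regᴺ pr N refl) St.regN
            eRoot : rN s₁ Root ≡ toℕ root
            eRoot = trans (Preserved.regᴺ pr Root refl) St.regRoot
            eV : rN s₁ V ≡ toℕ v
            eV = trans (Preserved.regᴺ pr V refl) St.regV
            eH : rN s₁ Heap ≡ h
            eH = Preserved.regᴺ pr Heap refl
            mem₂ : ∀ a → mN s₂ a ≡ ((mN s [ depthAt v ≔ depth v ]) [ startAt v ≔ h ]) a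
            mem₂ a = trans (cong (λ m → ((m [ rN s₁ N ℕ.+ (rN s₁ N ℕ.+ (rN s₁ N ℕ.+ rN s₁ V)) ≔ rN s₁ Lev ]) [ rN s₁ N ℕ.+ rN s₁ V ≔ rN s₁ Heap ]) a) (Preserved.memᴺ pr refl))
              (trans (cong₂ (λ i j → ((mN s [ i ≔ j ]) [ rN s₁ N ℕ.+ rN s₁ V ≔ rN s₁ Heap ]) a)
                       (cong₂ ℕ._+_ eN (cong₂ ℕ._+_ eN (cong₂ ℕ._+_ eN eV))) eLev)
                (cong₂ (λ i j → ((mN s [ depthAt v ≔ depth v ]) [ i ≔ j ]) a) (cong₂ ℕ._+_ eN eV) eH))
            p₀ p₁ : Point (Choice (leaf {n} v))
            p₀ = point 0# 1# (toℕ v) 0 false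
            p₁ = point x (1# - probability v) (toℕ v) 1 true
            p₀ᵃ : PointAt s₃ h p₀
            p₀ᵃ = subst (λ a → PointAt s₃ a p₀) eH (push-point {p = p₀} s₂ (refl , refl , eV , refl))
            same₃ : Agree h s₂ s₃
            same₃ = agree-≤ (ℕₚ.≤-reflexive (sym eH)) (push-agree s₂)
            memᶠ₃ : ∀ a → a < h → mF s₃ a ≡ mF s a
            memᶠ₃ a a< = trans (proj₂ (on same₃ a a<)) (cong (λ m → m a) (Preserved.memᶠ pr refl))
            prob : mF s₃ (rN s₁ N ℕ.+ rN s₁ V) ≡ probability v
            prob = trans (cong (mF s₃) (cong₂ ℕ._+_ eN eV)) (trans (memᶠ₃ (startAt v) (start<h v)) (St.memProb v))
            priz : mF s₃ (rN s₁ N ℕ.+ (rN s₁ N ℕ.+ rN s₁ V)) ≡ prize v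
            priz = trans (cong (mF s₃) (cong₂ ℕ._+_ eN (cong₂ ℕ._+_ eN eV))) (trans (memᶠ₃ (stopAt v) (stop<h v)) (St.memPrize v))
            loaded₁ : Loaded s₄ p₁
            loaded₁ = cong₂ _*_ priz prob , cong (1# -_) prob , eV , refl
            test : holds (le 1 5) s₄ ≡ does (x ≤? 0#)
            test = cong (λ y → does (y ≤? 0#)) (cong₂ _*_ priz prob)
            same₄ : Agree h s₂ s₄
            same₄ = agree-trans same₃ (agree-≡ {s = s₃} {s′ = s₄} refl refl)
            same₅ : Agree h s₂ s₅
            same₅ = agree-trans same₄ (agree-≤ (ℕₚ.≤-trans (ℕₚ.≤-reflexive (sym eH)) (ℕₚ.m≤n+m _ 2)) (push-agree s₄))
            plant : ∀ {s′} → rN s′ N ≡ n → rN s′ Root ≡ toℕ root → rN s′ V ≡ toℕ v → h ≤ rN s′ Heap → Agree h s₂ s′ →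
                    Crowned s′ lo h (rN s′ Heap) (leaf v) → Planted s′
            plant {s′} a b d g same C = record
              { regN = a ; regRoot = b ; regV = d ; grow = g
              ; sameᴺ = λ k k< ≢₁ ≢₂ → trans (proj₁ (on same k k<)) (trans (mem₂ k)
                  (trans (≔-other (mN s [ depthAt v ≔ depth v ]) {startAt v} {h} {k} ≢₂) (≔-other (mN s) {depthAt v} {depth v} {k} ≢₁)))
              ; sameᶠ = λ k k< → trans (proj₂ (on same k k<)) (cong (λ m → m k) (Preserved.memᶠ pr refl))
              ; atDepth = trans (proj₁ (on same (depthAt v) (depth<h v))) (trans (mem₂ (depthAt v))
                  (trans (≔-other (mN s [ depthAt v ≔ depth v ]) {startAt v} {h} {depthAt v} (ℕₚ.>⇒≢ (ℕₚ.<-trans (start<stop v v) (stop<depth v v))))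
                    (≔-same (mN s) (depthAt v) (depth v))))
              ; atStart = trans (proj₁ (on same (startAt v) (start<h v))) (trans (mem₂ (startAt v))
                  (≔-same (mN s [ depthAt v ≔ depth v ]) (startAt v) h))
              ; crowned = C }
            top₄ : rN s₄ Heap ≡ 2 ℕ.+ h
            top₄ = cong (2 ℕ.+_) eH
            top₅ : rN s₅ Heap ≡ 4 ℕ.+ h
            top₅ = cong (4 ℕ.+_) eH
            p₀ᵃ₄ : PointAt s₄ h p₀
            p₀ᵃ₄ = pointAt-agree (agree-≡ {s = s₃} {s′ = s₄} refl refl) ℕₚ.≤-refl p₀ᵃ
            crowned₄ : x ≤ᶠ 0# → Crowned s₄ lo h (rN s₄ Heap) (leaf v)
            crowned₄ x≤0 = record
              { chain = chain-leaf-empty x≤0 ; segment = p₀ᵃ₄ , _ ; stop = top₄ ; below = ℕₚ.≤-refl ; low = St.heap≥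
              ; denotes = (refl , refl) ∷ [] } , [] , p₀ , refl , ≤ᶠ-refl ∷ []
            crowned₅ : ¬ x ≤ᶠ 0# → Crowned s₅ lo h (rN s₅ Heap) (leaf v)
            crowned₅ x>0 = record
              { chain = chain-leaf-both
              ; segment = pointAt-agree (push-agree s₄) (ℕₚ.≤-reflexive (sym top₄)) p₀ᵃ₄ ,
                          subst (λ a → PointAt s₅ a p₁) top₄ (push-point {p = p₁} s₄ loaded₁) , _
              ; stop = top₅ ; below = ℕₚ.≤-refl ; low = St.heap≥
              ; denotes = (refl , refl) ∷ (refl , refl) ∷ [] } , p₀ ∷ [] , p₁ , refl , <⇒≤ x>0 ∷ ≤ᶠ-refl ∷ []
            branch : Dec (x ≤ᶠ 0#) → wp (cond (le 1 5) skip (blk push)) 10 (wp (blk leafTail) 5 Post) s₄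
            branch (yes p) = wp-≤ (≤! 2 10) (wp-cond-true (trans test (dec-true (x ≤? 0#) p)) (wp-blk {Q = wp (blk leafTail) 5 Post}
              (wp-blk (planted-started (plant eN eRoot eV (ℕₚ.≤-trans (ℕₚ.m≤n+m h 2) (ℕₚ.≤-reflexive (sym top₄))) same₄ (crowned₄ p))))))
            branch (no ¬p) = wp-cond-false (trans test (dec-false (x ≤? 0#) ¬p)) (wp-blk {Q = wp (blk leafTail) 5 Post}
              (wp-blk (planted-started (plant eN eRoot eV (ℕₚ.≤-trans (ℕₚ.m≤n+m h 4) (ℕₚ.≤-reflexive (sym top₅))) same₅ (crowned₅ ¬p)))))

-- The total running time and the theorem.

open Machine
open Prog
open Plan
open Merge
open Tree
open Bridge
open Grove
open Levels
open Output
open Init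
open import Data.Fin.Base as Fin using (Fin; toℕ; fromℕ<)
import Data.Fin.Properties as Finₚ
open import Data.List.Base using ([]; _∷_; _++_; tabulate)
open import Data.Maybe.Base using (fromMaybe)
open import Data.Nat.Base as ℕ using (ℕ; zero; suc; _≤_; _<_; _*_; _^_; z≤n; s≤s)
import Data.Nat.Properties as ℕₚ
open import Data.Nat.Solver using (module +-*-Solver)
open import Data.Product.Base using (∃-syntax; _×_; _,_)
open import Data.Unit.Base using (tt)
open import Function.Base using (_∘_)
import Data.List.Properties
import Data.Bool.Base
import Relation.Nullary.Decidable
open import Relation.Binary.PropositionalEquality using (_≡_; refl; sym; trans; cong; subst)
open import Relation.Nullary using (does)

nth-tabulate : ∀ {a} {A : Set a} {n} (f : Fin n → A) ys z d → fromMaybe d (nth (tabulate f ++ ys) (toℕ z)) ≡ f z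
nth-tabulate f ys Fin.zero    d = refl
nth-tabulate f ys (Fin.suc z) d = nth-tabulate (f ∘ Fin.suc) ys z d

nth-skip : ∀ {a} {A : Set a} {n} (f : Fin n → A) ys k → nth (tabulate f ++ ys) (n ℕ.+ k) ≡ nth ys k
nth-skip {n = zero}  f ys k = refl
nth-skip {n = suc n} f ys k = nth-skip (f ∘ Fin.suc) ys k

module Solutions {c ℓ₁ ℓ₂} (K : OrderedField c ℓ₁ ℓ₂) {n} (inst : Instance K n) where
  open Machines K
  open Programs K
  open Merges K inst
  open Bridges K inst
  open Forests K inst
  open LevelLoops K inst
  open Outputs K inst
  open Inits K inst
  open Instance inst
  open Depths tree

  private
    bodyTime : ℕ
    bodyTime = 2 ℕ.+ ((n ℕ.* 9 ℕ.+ 6) ℕ.+ 42)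

  abstract
    initLoop-wp : ∀ r k {s} → k ℕ.+ r ≡ n → Started s k → wp initLoop (r ℕ.* (bodyTime ℕ.+ 2) ℕ.+ 2) (λ s′ → Started s′ n) s
    initLoop-wp zero k {s} e St = wp-while-exit (wp-blk (lt-false {V} {N} {s} (Started.regV St) (Started.regN St) (ℕₚ.≤-reflexive (sym k≡n)) ,
      subst (Started s) k≡n St))
      where
      k≡n : k ≡ n
      k≡n = trans (sym (ℕₚ.+-identityʳ k)) e
    initLoop-wp (suc r) k {s} e St = wp-≤ (ℕₚ.≤-reflexive (sym (ℕₚ.+-assoc (bodyTime ℕ.+ 2) (r ℕ.* (bodyTime ℕ.+ 2)) 2)))
      (wp-while-again {τ₁ = 0} {τ₂ = bodyTime} {τ₃ = r ℕ.* (bodyTime ℕ.+ 2) ℕ.+ 2}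
        (wp-blk (lt-true {V} {N} {s} (Started.regV St) (Started.regN St) k<n ,
          wp-post (λ {s′} _ St′ → initLoop-wp r (suc k) (trans (sym (ℕₚ.+-suc k r)) e) (subst (λ k → Started s′ (suc k)) v≡k St′))
            (initBody-wp v (subst (Started s) (sym v≡k) St)))))
      where
      k<n : k < n
      k<n = subst (k <_) e (ℕₚ.m<m+n k (s≤s z≤n))
      v : Fin n
      v = fromℕ< k<n
      v≡k : toℕ v ≡ k
      v≡k = Finₚ.toℕ-fromℕ< k<n

    -- Since no depth exceeds `n`, nothing counts as merged under `Above n`. The squares of `n`
    -- single nodes add up to `n`, which leaves the potential `n * n - n`.
    started-forest : ∀ {s s′} → rN s′ N ≡ rN s N → rN s′ Root ≡ rN s Root → rN s′ Heap ≡ rN s Heap → mN s′ ≡ mN s → mF s′ ≡ mF s →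
                     Started s n → Forest s′ (Above n) (n ℕ.* n ℕ.∸ n)
    started-forest {s} {s′} eN eR eH refl refl St = record
      { regN = trans eN regN ; regRoot = trans eR regRoot
      ; memParent = memParent ; memWeight = memWeight ; memDepth = λ z → memDepth z (Finₚ.toℕ<n z)
      ; heap≥ = subst (lo ≤_) (sym eH) heap≥
      ; plan = leaf ; extent = λ _ → 1
      ; held = λ u _ → crowned-keep {s} {s′} (λ _ _ _ → refl , refl) (ℕₚ.≤-reflexive (sym eH)) (held u (Finₚ.toℕ<n u))
      ; measures = λ u _ → measures-leaf u
      ; distinct = λ _ _ → tt
      ; climbs = λ u _ z z∈ → 0 , does⇒ (z Finₚ.≟ u) z∈ , λ _ ()
      ; covered = λ z → z , ℕₚ.≤⇒≯ (depth-≤ z) , self z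
      ; extents = λ _ _ → refl
      ; total≡ = total-ones n
      ; squares = trans (cong (ℕ._+ (n ℕ.* n ℕ.∸ n)) (total-ones n)) (ℕₚ.m+[n∸m]≡n (n≤n*n n)) }
      where
      open Started St
      self : ∀ (z : Fin n) → does (z Finₚ.≟ z) ≡ Data.Bool.Base.true
      self z = Relation.Nullary.Decidable.dec-true (z Finₚ.≟ z) refl
      n≤n*n : ∀ m → m ≤ m ℕ.* m
      n≤n*n zero    = z≤n
      n≤n*n (suc m) = ℕₚ.m≤m+n (suc m) _

  start : Store
  start = store (State.regᴺ (initial K inst)) (State.regᶠ (initial K inst)) (State.memᴺ (initial K inst)) (State.memᶠ (initial K inst))

  initTime : ℕ
  initTime = 4 ℕ.+ ((n ℕ.* (bodyTime ℕ.+ 2) ℕ.+ 2) ℕ.+ 1)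

  abstract
    initCmd-wp : wp initCmd initTime (λ s′ → rN s′ Lev ≡ n × Forest s′ (Above n) (n ℕ.* n ℕ.∸ n)) start
    initCmd-wp = wp-⨾ (wp-blk (wp-⨾ (wp-post (λ {s₁} _ St → wp-blk (Started.regN St ,
        started-forest {s₁} {effs (moveᴺ Lev N ∷ []) s₁} refl refl refl refl refl St))
        (initLoop-wp n 0 {s₀} refl (record
          { regN = refl ; regRoot = refl ; regV = refl
          ; memParent = λ z → trans (cong (λ xs → fromMaybe 0 (nth xs (toℕ z))) (sym (Data.List.Properties.++-identityʳ _)))
                                (nth-tabulate (toℕ ∘ parent) [] z 0)
          ; memWeight = λ z → nth-tabulate weight _ z _
          ; memProb = λ z → trans (cong (fromMaybe _) (nth-skip weight _ (toℕ z))) (nth-tabulate probability _ z _)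
          ; memPrize = λ z → trans (cong (fromMaybe _) (trans (nth-skip weight _ (n ℕ.+ toℕ z)) (nth-skip probability _ (toℕ z))))
              (trans (cong (λ xs → fromMaybe _ (nth xs (toℕ z))) (sym (Data.List.Properties.++-identityʳ _))) (nth-tabulate prize [] z _))
          ; heap≥ = ℕₚ.≤-refl
          ; memDepth = λ _ ()
          ; held = λ _ () })))))
      where
      s₀ : Store
      s₀ = effs (addᴺ Heap N N ∷ addᴺ Heap N Heap ∷ addᴺ Heap N Heap ∷ setᴺ V 0 ∷ []) start

    -- Of the quadratic coefficient 671, the walks to the root contribute 9, the passes over the
    -- levels 12 and the merges 650.
    solution : ∃[ t ] (t ℕ.+ 1 ≤ 800 * n ^ 2 × wp mainCmd t Answer start)
    solution = fromInit initCmd-wp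
      where
      fromInit : wp initCmd initTime (λ s′ → rN s′ Lev ≡ n × Forest s′ (Above n) (n ℕ.* n ℕ.∸ n)) start →
                 ∃[ t ] (t ℕ.+ 1 ≤ 800 * n ^ 2 × wp mainCmd t Answer start)
      fromInit (mk s₁ e₁ p₁ (eL , F₁)) = fromMerges (mergeLoop-wp n eL F₁)
        where
        fromMerges : Timed mergeLoop (Outcome (Above 0) (n ℕ.* (n ℕ.* 12 ℕ.+ 8) ℕ.+ 3) (n ℕ.* n ℕ.∸ n)) s₁ →
                     ∃[ t ] (t ℕ.+ 1 ≤ 800 * n ^ 2 × wp mainCmd t Answer start)
        fromMerges (t , mk s₂ e₂ p₂ (ρ , t≤ , F₂)) =
          initTime ℕ.+ (t ℕ.+ (28 ℕ.* n ℕ.+ 12)) , bound , wp-⨾ (mk s₁ e₁ p₁ (wp-⨾ (mk s₂ e₂ p₂ (outCmd-wp F₂))))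
          where
          -- The root is a node, so `n` is positive and the lower terms are absorbed by `n * n`.
          1≤n : 1 ≤ n
          1≤n = ℕₚ.≤-trans (s≤s z≤n) (Finₚ.toℕ<n root)
          n≤nn : n ≤ n ℕ.* n
          n≤nn = ℕₚ.≤-trans (ℕₚ.≤-reflexive (sym (ℕₚ.*-identityˡ n))) (ℕₚ.*-monoˡ-≤ n 1≤n)
          open ℕₚ.≤-Reasoning
          open +-*-Solver
          bound : (initTime ℕ.+ (t ℕ.+ (28 ℕ.* n ℕ.+ 12))) ℕ.+ 1 ≤ 800 * n ^ 2
          bound = begin
            (initTime ℕ.+ (t ℕ.+ (28 ℕ.* n ℕ.+ 12))) ℕ.+ 1
              ≡⟨ solve 2 (λ n t → ((con 4 :+ ((n :* (con 2 :+ ((n :* con 9 :+ con 6) :+ con 42) :+ con 2) :+ con 2) :+ con 1)) :+ (t :+ (con 28 :* n :+ con 12))) :+ con 1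
                   := (con 9 :* (n :* n) :+ con 80 :* n :+ con 20) :+ t) refl n t ⟩
            (9 ℕ.* (n ℕ.* n) ℕ.+ 80 ℕ.* n ℕ.+ 20) ℕ.+ t
              ≤⟨ ℕₚ.+-monoʳ-≤ (9 ℕ.* (n ℕ.* n) ℕ.+ 80 ℕ.* n ℕ.+ 20) (ℕₚ.≤-trans (ℕₚ.m≤m+n t (650 ℕ.* ρ)) (ℕₚ.≤-trans t≤
                   (ℕₚ.+-monoʳ-≤ (n ℕ.* (n ℕ.* 12 ℕ.+ 8) ℕ.+ 3) (ℕₚ.*-monoʳ-≤ 650 (ℕₚ.m∸n≤m (n ℕ.* n) n))))) ⟩
            (9 ℕ.* (n ℕ.* n) ℕ.+ 80 ℕ.* n ℕ.+ 20) ℕ.+ ((n ℕ.* (n ℕ.* 12 ℕ.+ 8) ℕ.+ 3) ℕ.+ 650 ℕ.* (n ℕ.* n))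
              ≡⟨ solve 1 (λ n → (con 9 :* (n :* n) :+ con 80 :* n :+ con 20) :+ ((n :* (n :* con 12 :+ con 8) :+ con 3) :+ con 650 :* (n :* n))
                   := con 671 :* (n :* n) :+ con 88 :* n :+ con 23) refl n ⟩
            671 ℕ.* (n ℕ.* n) ℕ.+ 88 ℕ.* n ℕ.+ 23
              ≤⟨ ℕₚ.+-mono-≤ (ℕₚ.+-monoʳ-≤ (671 ℕ.* (n ℕ.* n)) (ℕₚ.*-monoʳ-≤ 88 n≤nn)) (ℕₚ.*-monoʳ-≤ 23 (ℕₚ.≤-trans 1≤n n≤nn)) ⟩
            671 ℕ.* (n ℕ.* n) ℕ.+ 88 ℕ.* (n ℕ.* n) ℕ.+ 23 ℕ.* (n ℕ.* n)
              ≡⟨ solve 1 (λ x → con 671 :* x :+ con 88 :* x :+ con 23 :* x := con 782 :* x) refl (n ℕ.* n) ⟩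
            782 ℕ.* (n ℕ.* n)
              ≤⟨ ℕₚ.*-monoˡ-≤ (n ℕ.* n) (≤! 782 800) ⟩
            800 ℕ.* (n ℕ.* n)
              ≡⟨ cong (λ x → 800 ℕ.* (n ℕ.* x)) (sym (ℕₚ.*-identityʳ n)) ⟩
            800 * n ^ 2 ∎

  answered : ∀ cmd {t} → t ℕ.+ 1 ≤ 800 * n ^ 2 → wp cmd t Answer start →
    ∃[ t ] ∃[ s ] ∃[ S ]
    ( Run K (program cmd) (initial K inst) t s
    × t ≤ 800 * n ^ 2
    × OutputsSet K s S
    × Optimal S
    × OutputsValue K s (G S (OrderedField.0# K)))
  answered cmd bound w = let t , s , run , t≤ , answer = program-run cmd w in
    t , at (size cmd) s , Answer.chosen answer , run , ℕₚ.≤-trans t≤ bound ,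
    Answer.bits answer , Answer.optimal answer , Answer.worth answer

theorem1 : ∀ {c ℓ₁ ℓ₂} (K : OrderedField c ℓ₁ ℓ₂) →
    ∃[ prog ] ∃[ C ] (∀ n (I : Instance K n) →
    ∃[ t ] ∃[ s ] ∃[ S ]
    ( Run K prog (initial K I) t s
    × t ≤ C * n ^ 2
    × OutputsSet K s S
    × Instance.Optimal I S
    × OutputsValue K s (Instance.G I S (OrderedField.0# K))))
theorem1 K = program mainCmd , 800 , λ n inst →
  let open Solutions K inst
      _ , bound , w = solution
  in answered mainCmd bound w
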